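{- Let $F$ be a non-Archimedean local field and $E=F\times E'$ with $E'/F$ a ramified quadratic field extension with uniformizer $x$. Let $R$ be an order of $E$ with conductor $(\pi^{f_1})\times(x^{f_2})\subset\mathfrak o\times\mathcal O_{E'}=\mathcal O_E$. Put $b=S(R)-f_1$ and $C=\left\lceil\frac{2S(R)-f_2}{2}\right\rceil$. Then, with all summation indices $a',b'$ ranging over integers, $$\begin{aligned} \#\overline{\mathrm{Cl}}(R)={}&2\sum_{0\le b'\le b}\Biggl(\ \sum_{\substack{0\le a'\le f_1\\ a'\le 2b'+1\\ a'\le C}}q^{\min(\lfloor a'/2\rfloor,\,b-b')}+\sum_{\substack{C<a'\le f_1\\ a'\le 2b'+1\\ \lceil a'/2\rceil-b'\le C-b}}q^{b-b'}\Biggr)-(b+1)\\ &-\sum_{\substack{0<a'\le f_1\\ a'\le C\\ 2\mid(a'-1)}}q^{\min\left(\frac{a'-1}2,\,b-\frac{a'-1}2\right)}-\sum_{\substack{C<a'\le f_1\\ 2\mid(a'-1)\\ b+1\le C}}q^{b-\frac{a'-1}2}\\ &-\sum_{0<b'\le b}\ \sum_{\substack{0<a'\le f_1\\ a'<2b'+1,\ 2\mid a'\\ a'\le C\\ \frac{a'}2\le b-b'}}\left(q^{\frac{a'}2}-q^{\frac{a'}2-1}\right)-\sum_{\substack{C<a'\le f_1\\ 2\mid a'\\ C\le b}}q^{C-\frac{a'}2}. \end{aligned}$$ (A condition not involving the summation index means that the sum is empty unless the condition holds.)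
   Context: $F$ has any characteristic, ring of integers $\mathfrak o$, uniformizer $\pi$, residue field of cardinality $q$; $\mathcal O_{E'}$ is the ring of integers of $E'$, so $\mathcal O_{E'}=\mathfrak o[x]$. The maximal order of $E$ is $\mathcal O_E=\mathfrak o\times\mathcal O_{E'}$. An order of $E$ is a subring $\mathcal O\subset E$ containing $\mathfrak o$ (embedded diagonally), finitely generated as an $\mathfrak o$-module, with $F\mathcal O=E$. The conductor of $R$ is $\{a\in\mathcal O_E: a\mathcal O_E\subset R\}$, and $S(R)$ is the length of $\mathcal O_E/R$ as an $\mathfrak o$-module. A fractional $R$-ideal is a finitely generated $R$-submodule $I\subset E$ with $FI=E$; $\overline{\mathrm{Cl}}(R)$ is the set (monoid) of fractional $R$-ideals modulo multiplication by $E^\times$. -}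

module Defs where

open import Algebra.Bundles using (CommutativeRing)
import Algebra.Construct.DirectProduct as DirectProduct
import Algebra.Definitions
open import Algebra.Morphism.Structures using (module RingMorphisms)
import Algebra.Properties.Ring
import Algebra.Properties.Semiring.Exp
import Algebra.Properties.Semiring.Sum
open import Data.Bool.Base using (if_then_else_)
open import Data.Empty using (⊥-elim)
open import Data.Fin.Base using (Fin; inject₁) renaming (zero to fzero; suc to fsuc)
open import Data.Integer.Base as ℤ using (ℤ; +_; -[1+_])
import Data.Integer.Divisibility as ℤ
import Data.Integer.DivMod as ℤ
import Data.Integer.Properties as ℤ
open import Data.List.Base using (List; foldr; map; upTo)
open import Data.Maybe.Base using (Maybe; just; nothing; zipWith)
open import Data.Nat.Base as ℕ using (ℕ; zero; suc)
open import Data.Maybe.Properties using (just-injective)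
import Data.Nat.Divisibility as ℕ
import Data.Nat.Properties as ℕ
open import Data.Product using (∃!)
open import Data.Product.Base using (Σ; ∃; ∃-syntax; ∃₂; _×_; _,_; proj₁; proj₂)
open import Data.Rational.Base as ℚ using (ℚ; 0ℚ; _/_)
open import Function.Base using (_∘_)
open import Function.Bundles using (Inverse)
open import Level using (Level; _⊔_; 0ℓ) renaming (suc to lsuc)
open import Relation.Binary.Bundles using (Setoid)
open import Relation.Binary.PropositionalEquality as ≡ using (_≡_)
import Relation.Binary.Construct.Add.Supremum.NonStrict as AddSupremum
open import Relation.Nullary using (¬_; Dec; yes; no)
open import Relation.Nullary.Construct.Add.Supremum using (_⁺; ⊤⁺; [_])
open import Relation.Nullary.Decidable.Core using (does; _×-dec_)
open import Relation.Unary using (Pred; _⊆_; _⊂_; _≐_)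
open import Relation.Binary.Definitions using (_Respects_)

open AddSupremum ℤ._≤_ public
  using () renaming (_≤⁺_ to _≤∞_; _≤⊤⁺ to _≤∞⊤; [_] to fin≤)

infixl 6 _+∞_

_+∞_ : ℤ ⁺ → ℤ ⁺ → ℤ ⁺
_+∞_ = zipWith ℤ._+_

private
  double : ∀ k → k ℤ.+ k ≡ k → k ≡ + 0
  double k eq = ≡.trans (≡.sym (ℤ.+-identityʳ k))
    (≡.trans (≡.cong (λ j → k ℤ.+ j) (≡.sym (ℤ.+-inverseʳ k)))
    (≡.trans (≡.sym (ℤ.+-assoc k k (ℤ.- k)))
    (≡.trans (≡.cong (ℤ._- k) eq) (ℤ.+-inverseʳ k))))

  half : ∀ k → k ℤ.+ k ≡ + 0 → k ≡ + 0
  half (+ zero)  eq = ≡.refl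
  half (+ suc n) ()
  half -[1+ n ]  ()

  +∞-identityˡ : ∀ k → [ + 0 ] +∞ k ≡ k
  +∞-identityˡ nothing  = ≡.refl
  +∞-identityˡ (just k) = ≡.cong just (ℤ.+-identityˡ k)

record DiscretelyValuedField (c ℓ : Level) : Set (lsuc (c ⊔ ℓ)) where
  field
    commutativeRing : CommutativeRing c ℓ

  open CommutativeRing commutativeRing public
  open Algebra.Definitions _≈_ public using (Invertible)
  open Algebra.Properties.Semiring.Exp semiring public using (_^_)

  field
    1≉0        : ¬ (1# ≈ 0#)
    invertible : ∀ x → ¬ (x ≈ 0#) → Invertible 1# _*_ x
    v          : Carrier → ℤ ⁺
    v-cong     : ∀ {x y} → x ≈ y → v x ≡ v y
    v-0        : v 0# ≡ ⊤⁺
    v-∞        : ∀ x → v x ≡ ⊤⁺ → x ≈ 0#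
    v-*        : ∀ x y → v (x * y) ≡ v x +∞ v y
    -- v (x + y) ≥ min (v x) (v y)
    v-+        : ∀ x y k → k ≤∞ v x → k ≤∞ v y → k ≤∞ v (x + y)

  IsUniformizer : Pred Carrier 0ℓ
  IsUniformizer x = v x ≡ [ + 1 ]

  -- v is normalised, i.e. maps the nonzero elements onto ℤ
  field
    uniformizer : ∃ IsUniformizer

  𝒪 : Pred Carrier 0ℓ
  𝒪 x = [ + 0 ] ≤∞ v x

  𝔪 : Pred Carrier 0ℓ
  𝔪 x = [ + 1 ] ≤∞ v x

  ⟨_⟩ : Carrier → Pred Carrier (c ⊔ ℓ)
  ⟨ x ⟩ y = ∃[ t ] 𝒪 t × y ≈ t * x

  IsCauchy : Pred (ℕ → Carrier) 0ℓ
  IsCauchy s = ∀ (k : ℤ) → ∃[ N ] (∀ m n → N ℕ.≤ m → N ℕ.≤ n → [ k ] ≤∞ v (s m - s n))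

  _⟶_ : (ℕ → Carrier) → Carrier → Set
  s ⟶ l = ∀ (k : ℤ) → ∃[ N ] (∀ n → N ℕ.≤ n → [ k ] ≤∞ v (s n - l))

  private
    module RP = Algebra.Properties.Ring ring
    import Relation.Binary.Reasoning.Setoid setoid as ≈-R

    v-1 : v 1# ≡ [ + 0 ]
    v-1 with v 1# in eq
    ... | nothing = ⊥-elim (1≉0 (v-∞ 1# eq))
    ... | just k  = ≡.cong just (double k (just-injective
            (≡.trans (≡.sym (≡.cong₂ _+∞_ eq eq))
            (≡.trans (≡.sym (v-* 1# 1#))
            (≡.trans (v-cong (*-identityˡ 1#)) eq)))))

    v--1 : v (- 1#) ≡ [ + 0 ]
    v--1 = go (v (- 1#)) (≡.trans (≡.sym (v-* (- 1#) (- 1#)))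
             (≡.trans (v-cong -1*-1) v-1))
      where
      -1*-1 : - 1# * - 1# ≈ 1#
      -1*-1 = trans (RP.-1*x≈-x (- 1#)) (RP.-‿involutive 1#)

      go : ∀ k → k +∞ k ≡ [ + 0 ] → k ≡ [ + 0 ]
      go nothing  ()
      go (just k) eq = ≡.cong just (half k (just-injective eq))

    v-neg : ∀ x → v (- x) ≡ v x
    v-neg x = ≡.trans (v-cong (sym (RP.-1*x≈-x x)))
      (≡.trans (v-* (- 1#) x)
      (≡.trans (≡.cong (_+∞ v x) v--1) (+∞-identityˡ (v x))))

    flip-sub : ∀ x y → - (x - y) ≈ y - x
    flip-sub x y = begin
      - (x + - y)     ≈⟨ RP.-‿+-comm x (- y) ⟨
      - x + - - y     ≈⟨ +-congˡ (RP.-‿involutive y) ⟩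
      - x + y         ≈⟨ +-comm (- x) y ⟩
      y + - x         ∎
      where open ≈-R

    telescope : ∀ x y z → (x - y) + (y - z) ≈ x - z
    telescope x y z = begin
      (x + - y) + (y + - z)   ≈⟨ +-assoc x (- y) (y + - z) ⟩
      x + (- y + (y + - z))   ≈⟨ +-congˡ (+-assoc (- y) y (- z)) ⟨
      x + ((- y + y) + - z)   ≈⟨ +-congˡ (+-congʳ (-‿inverseˡ y)) ⟩
      x + (0# + - z)          ≈⟨ +-congˡ (+-identityˡ (- z)) ⟩
      x + - z                 ∎
      where open ≈-R

  -- the residue field 𝒪 / 𝔪, as a setoid
  residueField : Setoid c 0ℓ
  residueField = record
    { Carrier       = Σ Carrier 𝒪
    ; _≈_           = λ (x , _) (y , _) → 𝔪 (x - y)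
    ; isEquivalence = record
      { refl  = λ { {x , _} → ≡.subst ([ + 1 ] ≤∞_)
                    (≡.sym (≡.trans (v-cong (-‿inverseʳ x)) v-0)) (_ ≤∞⊤) }
      ; sym   = λ { {x , _} {y , _} p → ≡.subst ([ + 1 ] ≤∞_)
                    (≡.trans (≡.sym (v-neg (x - y))) (v-cong (flip-sub x y))) p }
      ; trans = λ { {x , _} {y , _} {z , _} p p′ → ≡.subst ([ + 1 ] ≤∞_)
                    (v-cong (telescope x y z)) (v-+ _ _ _ p p′) }
      }
    }

record LocalField (c ℓ : Level) : Set (lsuc (c ⊔ ℓ)) where
  field
    discretelyValuedField : DiscretelyValuedField c ℓ

  open DiscretelyValuedField discretelyValuedField public

  field
    complete       : ∀ s → IsCauchy s → ∃[ l ] s ⟶ l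
    q              : ℕ
    residueField-q : Inverse residueField (≡.setoid (Fin q))

  q-nonZero : ℕ.NonZero q
  q-nonZero = go q (Inverse.to residueField-q
      (0# , ≡.subst ([ + 0 ] ≤∞_) (≡.sym v-0) (_ ≤∞⊤)))
    where
    go : ∀ n → Fin n → ℕ.NonZero n
    go (suc n) _ = _

-- e is the ramification index: both valuations are normalised, and that of
-- E′ restricts to e times that of F.
record Extension {c ℓ} (F E′ : LocalField c ℓ) : Set (c ⊔ ℓ) where
  private
    module F  = LocalField F
    module E′ = LocalField E′
  open RingMorphisms F.rawRing E′.rawRing using (IsRingHomomorphism)
  open Algebra.Properties.Semiring.Sum E′.semiring using (sum)

  field
    ι                  : F.Carrier → E′.Carrier
    isRingHomomorphism : IsRingHomomorphism ι
    e                  : ℕ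
    e-positive         : 0 ℕ.< e
    v-ι                : ∀ a k → F.v a ≡ [ k ] → E′.v (ι a) ≡ [ + e ℤ.* k ]

  IsRamified : Set
  IsRamified = 1 ℕ.< e

  HasDegree : ℕ → Set (c ⊔ ℓ)
  HasDegree n = ∃ λ (basis : Fin n → E′.Carrier) → ∀ y →
    ∃! (λ a b → ∀ i → a i F.≈ b i)
       (λ (a : Fin n → F.Carrier) → y E′.≈ sum (λ i → ι (a i) E′.* basis i))

module Product {c ℓ} {F E′ : LocalField c ℓ} (ext : Extension F E′) where
  private
    module F  = LocalField F
    module E′ = LocalField E′
  open Extension ext using (ι)

  E : CommutativeRing c ℓ
  E = DirectProduct.commutativeRing F.commutativeRing E′.commutativeRing

  open CommutativeRing E
  open Algebra.Definitions _≈_ using (Invertible)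
  open Algebra.Properties.Semiring.Sum semiring using (sum)

  Subset : Set (lsuc (c ⊔ ℓ))
  Subset = Pred Carrier (c ⊔ ℓ)

  Δ : F.Carrier → Carrier
  Δ a = a , ι a

  ΔF : Subset
  ΔF y = ∃[ a ] y ≈ Δ a

  Δ𝔬 : Subset
  Δ𝔬 y = ∃[ a ] F.𝒪 a × y ≈ Δ a

  𝒪E : Pred Carrier 0ℓ
  𝒪E (a , b) = F.𝒪 a × E′.𝒪 b

  Combinations : Subset → ∀ {n} → (Fin n → Carrier) → Subset
  Combinations A {n} g y =
    ∃ λ (a : Fin n → Carrier) → (∀ i → A (a i)) × y ≈ sum (λ i → a i * g i)

  -- the additive subgroup generated by all products (for A closed under negation)
  _·_ : Subset → Subset → Subset
  (A · S) y = ∃₂ λ n (g : Fin n → Carrier) → (∀ i → S (g i)) × Combinations A g y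

  record IsSubring (S : Subset) : Set (c ⊔ ℓ) where
    field
      resp       : S Respects _≈_
      0∈         : S 0#
      1∈         : S 1#
      +-closed   : ∀ {x y} → S x → S y → S (x + y)
      neg-closed : ∀ {x} → S x → S (- x)
      *-closed   : ∀ {x y} → S x → S y → S (x * y)

  -- A-submodules of E, for a subring A
  record IsSubmodule (A S : Subset) : Set (c ⊔ ℓ) where
    field
      resp       : S Respects _≈_
      0∈         : S 0#
      +-closed   : ∀ {x y} → S x → S y → S (x + y)
      *-closed   : ∀ {a x} → A a → S x → S (a * x)

  IsFinitelyGenerated : (A S : Subset) → Set (c ⊔ ℓ)
  IsFinitelyGenerated A S = ∃₂ λ n (g : Fin n → Carrier) → S ≐ Combinations A g

  SpansE : Subset → Set (c ⊔ ℓ)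
  SpansE S = ∀ y → (ΔF · S) y

  record IsOrder (R : Subset) : Set (c ⊔ ℓ) where
    field
      isSubring : IsSubring R
      𝔬⊆        : Δ𝔬 ⊆ R
      fg        : IsFinitelyGenerated Δ𝔬 R
      spans     : SpansE R

  Conductor : Subset → Subset
  Conductor R a = 𝒪E a × (∀ y → 𝒪E y → R (a * y))

  IsConductorExponents : (R : Subset) (π : F.Carrier) (x : E′.Carrier) (f₁ f₂ : ℕ) → Set (c ⊔ ℓ)
  IsConductorExponents R π x f₁ f₂ =
    Conductor R ≐ λ (a , b) → F.⟨ π F.^ f₁ ⟩ a × E′.⟨ x E′.^ f₂ ⟩ b

  -- A strict chain of n + 1 submodules of the 𝔬-module 𝒪E / R, given by
  -- their preimages in 𝒪E.
  record Chain (R : Subset) (n : ℕ) : Set (lsuc (c ⊔ ℓ)) where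
    field
      term        : Fin (suc n) → Subset
      isSubmodule : ∀ i → IsSubmodule Δ𝔬 (term i)
      lower       : ∀ i → R ⊆ term i
      upper       : ∀ i → term i ⊆ 𝒪E
      strict      : ∀ (i : Fin n) → term (inject₁ i) ⊂ term (fsuc i)

  -- s is the length of 𝒪E / R as an 𝔬-module, the supremum of the
  -- lengths of chains of submodules
  QuotientLength : (R : Subset) → ℕ → Set (lsuc (c ⊔ ℓ))
  QuotientLength R s = Chain R s × (∀ n → Chain R n → n ℕ.≤ s)

  record FractionalIdeal (R : Subset) : Set (lsuc (c ⊔ ℓ)) where
    field
      carrier     : Subset
      isSubmodule : IsSubmodule R carrier
      fg          : IsFinitelyGenerated R carrier
      spans       : SpansE carrier

  open FractionalIdeal

  _⋆_ : Carrier → Subset → Subset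
  (u ⋆ S) y = ∃[ z ] S z × y ≈ u * z

  SameClass : ∀ {R} (I J : FractionalIdeal R) → Set (c ⊔ ℓ)
  SameClass I J = ∃[ u ] Invertible 1# _*_ u × carrier J ≐ (u ⋆ carrier I)

  private
    module Ideal {R} (I : FractionalIdeal R) = IsSubmodule (isSubmodule I)

    cancel : ∀ {u u′} → u′ * u ≈ 1# → ∀ z → u′ * (u * z) ≈ z
    cancel {u} {u′} eq z =
      trans (sym (*-assoc u′ u z)) (trans (*-congʳ eq) (*-identityˡ z))

    ~-refl : ∀ {R} {I : FractionalIdeal R} → SameClass I I
    ~-refl {I = I} = 1# , (1# , *-identityˡ 1# , *-identityˡ 1#) ,
      (λ {y} p → y , p , sym (*-identityˡ y)) ,
      (λ (z , p , eq) → Ideal.resp I (sym (trans eq (*-identityˡ z))) p)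

    ~-sym : ∀ {R} {I J : FractionalIdeal R} → SameClass I J → SameClass J I
    ~-sym {I = I} {J} (u , (u′ , l , r) , J⊆ , ⊆J) = u′ , (u , r , l) ,
      (λ {y} p → u * y , ⊆J (y , p , refl) , sym (cancel l y)) ,
      (λ (z , p , eq) → let (w , Iw , eq′) = J⊆ p in
         Ideal.resp I (sym (trans eq (trans (*-congˡ eq′) (cancel l w)))) Iw)

    ~-trans : ∀ {R} {I J K : FractionalIdeal R} → SameClass I J → SameClass J K → SameClass I K
    ~-trans {I = I} {J} {K} (u , (u′ , l , r) , J⊆ , ⊆J) (t , (t′ , l′ , r′) , K⊆ , ⊆K) =
      t * u ,
      (u′ * t′ ,
        trans (*-assoc u′ t′ (t * u)) (trans (*-congˡ (cancel l′ u)) l) ,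
        trans (*-assoc t u (u′ * t′)) (trans (*-congˡ (cancel r t′)) r′)) ,
      (λ p → let (z , Jz , eq) = K⊆ p ; (w , Iw , eq′) = J⊆ Jz in
         w , Iw , trans eq (trans (*-congˡ eq′) (sym (*-assoc t u w)))) ,
      (λ (w , Iw , eq) → ⊆K (u * w , ⊆J (w , Iw , refl) , trans eq (*-assoc t u w)))

  Cl : Subset → Setoid (lsuc (c ⊔ ℓ)) (c ⊔ ℓ)
  Cl R = record
    { Carrier       = FractionalIdeal R
    ; _≈_           = SameClass
    ; isEquivalence = record
      { refl  = λ {I} → ~-refl {I = I}
      ; sym   = λ {I} {J} → ~-sym {I = I} {J}
      ; trans = λ {I} {J} {K} → ~-trans {I = I} {J} {K}
      }
    }

infix 5 _⋯_

-- the integers from lo to hi inclusive, empty when hi < lo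
_⋯_ : ℤ → ℤ → List ℤ
lo ⋯ hi = map (λ i → lo ℤ.+ + i) (upTo (length (hi ℤ.- lo)))
  where
  length : ℤ → ℕ
  length (+ n)    = suc n
  length -[1+ _ ] = 0

∑ : List ℤ → (ℤ → ℚ) → ℚ
∑ is f = foldr ℚ._+_ 0ℚ (map f is)

infix 5 ∑
syntax ∑ is (λ i → t) = ∑[ i ∈ is ] t

infix 6 _when_

_when_ : ∀ {a} {P : Set a} → ℚ → Dec P → ℚ
t when P? = if does P? then t else 0ℚ

⌊_/2⌋ ⌈_/2⌉ : ℤ → ℤ
⌊ n /2⌋ = n ℤ./ (+ 2)
⌈ n /2⌉ = ℤ.- ⌊ ℤ.- n /2⌋

2∣?_ : ∀ n → Dec (+ 2 ℤ.∣ n)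
2∣? n = 2 ℕ.∣? ℤ.∣ n ∣

module Formula (q : ℕ) .{{_ : ℕ.NonZero q}} (s f₁ f₂ : ℕ) where

  -- genuine integer powers of q, so that negative exponents are not truncated
  q^_ : ℤ → ℚ
  q^ (+ n)    = + (q ℕ.^ n) / 1
  q^ -[1+ n ] = (+ 1 / (q ℕ.^ suc n)) {{ℕ.m^n≢0 q (suc n)}}

  b C f : ℤ
  b = + s ℤ.- + f₁
  C = ⌈ + 2 ℤ.* + s ℤ.- + f₂ /2⌉
  f = + f₁

  open import Data.Integer.Base using (_+_; _-_; _*_; _⊓_)
  open import Data.Integer.Properties using (_≤?_; _<?_)

  -- Where ⌊_/2⌋ is applied under a divisibility condition by 2, it is
  -- exact division.

  main₁ main₂ : ℤ → ℚ
  main₁ b′ = ∑[ a′ ∈ + 0 ⋯ f ]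
    (q^ (⌊ a′ /2⌋ ⊓ (b - b′))
      when (a′ ≤? + 2 * b′ + + 1 ×-dec a′ ≤? C))
  main₂ b′ = ∑[ a′ ∈ (C + + 1) ⋯ f ]
    (q^ (b - b′)
      when (a′ ≤? + 2 * b′ + + 1 ×-dec ⌈ a′ /2⌉ - b′ ≤? C - b))

  odd₁ odd₂ : ℚ
  odd₁ = ∑[ a′ ∈ + 1 ⋯ f ]
    (q^ (⌊ a′ - + 1 /2⌋ ⊓ (b - ⌊ a′ - + 1 /2⌋))
      when (a′ ≤? C ×-dec 2∣? (a′ - + 1)))
  odd₂ = ∑[ a′ ∈ (C + + 1) ⋯ f ]
    (q^ (b - ⌊ a′ - + 1 /2⌋)
      when (2∣? (a′ - + 1) ×-dec b + + 1 ≤? C))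

  even₁ : ℤ → ℚ
  even₁ b′ = ∑[ a′ ∈ + 1 ⋯ f ]
    ((q^ ⌊ a′ /2⌋ ℚ.- q^ (⌊ a′ /2⌋ - + 1))
      when (a′ <? + 2 * b′ + + 1 ×-dec 2∣? a′ ×-dec a′ ≤? C ×-dec ⌊ a′ /2⌋ ≤? b - b′))

  even₂ : ℚ
  even₂ = ∑[ a′ ∈ (C + + 1) ⋯ f ]
    (q^ (C - ⌊ a′ /2⌋)
      when (2∣? a′ ×-dec C ≤? b))

  count : ℚ
  count =
    (+ 2 / 1) ℚ.* (∑[ b′ ∈ + 0 ⋯ b ] (main₁ b′ ℚ.+ main₂ b′))
      ℚ.- ((b + + 1) / 1)
      ℚ.- odd₁
      ℚ.- odd₂
      ℚ.- (∑[ b′ ∈ + 1 ⋯ b ] even₁ b′)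
      ℚ.- even₂

{-# OPTIONS --safe #-}
module Submission where

-- Write E′ = F ⊕ F x. Every lattice of E′ is a multiple of R_m = 𝔬 + π^m x 𝔬 for a unique m. A fractional
-- ideal J of R can be scaled so that its projection to F is 𝔬, whence J = 𝔬 (1, g) + 0 × N; let M be its
-- projection to E′, and scale further so that M = R_m and g = 1. If N is stable under R_m, then J is the
-- overorder of R in which N is spanned by π^a and θ = π^m x - β, where π^a divides the norm of θ. Otherwise
-- N is a multiple of R_n with n > m, and J is a multiple of the dual of such an overorder. The class of J
-- determines its type, m, a and β mod π^a. As R itself is the order with parameters b, f₁, γ, it acts on J
-- if and only if m ≤ b, a ≤ f₁ and π^(b-m) β ≡ γ mod π^a, and the solutions β of this congruence are a coset
-- whose size depends only on C, the valuation of γ truncated at f₁ and b + 1. So the classes are counted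
-- twice, once for each type, except that orders whose dual is a multiple of an order count once: these make
-- up the subtracted terms of the formula.

open import Defs
open import Algebra.Bundles using (CommutativeRing)
open import Algebra.Morphism.Structures using (module RingMorphisms)
import Algebra.Properties.CommutativeSemigroup
import Algebra.Properties.Ring
import Algebra.Properties.Semiring.Exp
import Algebra.Properties.Semiring.Mult.TCOptimised
import Algebra.Properties.Semiring.Sum
import Algebra.Solver.Ring
open import Algebra.Solver.Ring.AlmostCommutativeRing using (fromCommutativeRing; _-Raw-AlmostCommutative⟶_)
open import Axiom.ExcludedMiddle using (ExcludedMiddle)
open import Data.Bool.Base using (Bool; if_then_else_)
open import Data.Empty using (⊥; ⊥-elim)
open import Data.Fin.Base as Fin using (Fin; toℕ; inject₁) renaming (zero to fzero; suc to fsuc)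
import Data.Fin.Properties as Fin
open import Data.Integer.Base as ℤ using (ℤ; +_; -[1+_])
import Data.Integer.Properties as ℤ
open import Data.List.Base using (foldr; map; upTo; applyUpTo)
open import Data.Maybe.Base as Maybe using (Maybe; just; nothing)
open import Data.Maybe.Properties using (just-injective)
open import Data.Nat.Base as ℕ using (ℕ; zero; suc; z≤n; s≤s)
import Data.Nat.Divisibility as ℕ
import Data.Nat.DivMod as ℕ
import Data.Nat.Properties as ℕ
open import Data.Product.Base using (∃; ∃-syntax; ∃₂; _×_; _,_; proj₁; proj₂)
open import Data.Rational.Base as ℚ using (ℚ; 0ℚ; _/_)
import Data.Rational.Properties as ℚ
import Data.Rational.Unnormalised.Base as ℚᵘ
import Data.Rational.Unnormalised.Properties as ℚᵘ
open import Data.Sum.Base using (_⊎_; inj₁; inj₂; [_,_]′)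
open import Function.Base using (_∘_; id; case_of_)
open import Function.Bundles using (Inverse; _⇔_; mk⇔; module Equivalence)
open import Level using (Level; _⊔_; 0ℓ)
open import Relation.Binary.Bundles using (Setoid)
open import Relation.Binary.Definitions using (tri<; tri≈; tri>; _Respects_)
open import Relation.Binary.PropositionalEquality as ≡ using (_≡_; _≢_)
open import Relation.Nullary using (¬_; Dec; yes; no)
open import Relation.Nullary.Construct.Add.Supremum using (⊤⁺; [_])
open import Relation.Nullary.Decidable using (does; _×-dec_; does-⇔)
open import Relation.Unary using (Pred; _⊆_; _⊂_; _≐_)

-- Ring equations with integer coefficients

-- Let θ̄ be the conjugate of θ over F. `norm m β` is θ θ̄, and also the minimal polynomial of π^m x
-- evaluated at β. If π^a divides it, π^m x ↦ β defines a ring homomorphism R_m → 𝔬/π^a, and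
-- `Over m a β` is the fibre product of 𝔬 and R_m over 𝔬/π^a. Modulo π^a R_m, moreover, θ̄ is an
-- eigenvector of π^m x with eigenvalue β, and `Dual m a β` is 𝔬 (1, -θ̄) + 0 × π^a R_m. This is why
-- the same congruence lets R act on either lattice. If the norm has valuation exactly a,
-- multiplication by (1, -θ/norm) carries the dual to the order `Over m a β`. Hence only the duals
-- with π^(a+1) dividing the norm are counted separately. They are told from orders by their
-- multipliers: π^(m-1) x preserves M but not N. Ramification makes the count explicit. The
-- valuation of the norm is min(2 v(β), 2 m + 1), so its divisibility is a bound on m together with
-- a bound on v(β), and the admissible β are the solutions of a linear congruence in some π^j 𝔬.

module IntegerCoefficients {c ℓ} (R : CommutativeRing c ℓ) where
  open CommutativeRing R
  open Algebra.Properties.Semiring.Mult.TCOptimised semiring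
    using (×-homo-+; ×1-homo-*; 1+×) renaming (_×_ to _×′_)
  open Algebra.Properties.Ring ring
    using (-‿involutive; -‿+-comm; -0#≈0#; -‿distribˡ-*; -‿distribʳ-*)
  open import Relation.Binary.Reasoning.Setoid setoid

  -- Equality in the ring comes without a decision procedure, so the solver takes its coefficients
  -- from ℤ. The optimised multiple makes `+ 0` and `+ 1` denote `0#` and `1#` definitionally, so
  -- that goals with these constants match.
  fromℤ : ℤ → Carrier
  fromℤ (+ n)    = n ×′ 1#
  fromℤ -[1+ n ] = - (suc n ×′ 1#)

  private
    fromℤ-⊖ : ∀ m n → fromℤ (m ℤ.⊖ n) ≈ m ×′ 1# - n ×′ 1#
    fromℤ-⊖ zero zero = sym (-‿inverseʳ 0#)
    fromℤ-⊖ zero (suc n) = sym (+-identityˡ _)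
    fromℤ-⊖ (suc m) zero = sym (trans (+-congˡ -0#≈0#) (+-identityʳ _))
    fromℤ-⊖ (suc m) (suc n) = begin
      fromℤ (suc m ℤ.⊖ suc n)                   ≡⟨ ≡.cong fromℤ (ℤ.[1+m]⊖[1+n]≡m⊖n m n) ⟩
      fromℤ (m ℤ.⊖ n)                           ≈⟨ fromℤ-⊖ m n ⟩
      m ×′ 1# - n ×′ 1#                           ≈⟨ +-identityˡ _ ⟨
      0# + (m ×′ 1# - n ×′ 1#)                    ≈⟨ +-congʳ (-‿inverseʳ 1#) ⟨
      (1# - 1#) + (m ×′ 1# - n ×′ 1#)             ≈⟨ swap 1# (- 1#) _ _ ⟩
      (1# + m ×′ 1#) + (- 1# - n ×′ 1#)           ≈⟨ +-congˡ (-‿+-comm _ _) ⟩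
      (1# + m ×′ 1#) - (1# + n ×′ 1#)             ≈⟨ +-cong (1+× m 1#) (-‿cong (1+× n 1#)) ⟨
      suc m ×′ 1# - suc n ×′ 1#                   ∎
      where
      swap : ∀ u v w z → (u + v) + (w + z) ≈ (u + w) + (v + z)
      swap u v w z = begin
        (u + v) + (w + z) ≈⟨ +-assoc u v _ ⟩
        u + (v + (w + z)) ≈⟨ +-congˡ (+-assoc v w z) ⟨
        u + ((v + w) + z) ≈⟨ +-congˡ (+-congʳ (+-comm v w)) ⟩
        u + ((w + v) + z) ≈⟨ +-congˡ (+-assoc w v z) ⟩
        u + (w + (v + z)) ≈⟨ +-assoc u w _ ⟨
        (u + w) + (v + z) ∎

    fromℤ-neg : ∀ i → fromℤ (ℤ.- i) ≈ - fromℤ i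
    fromℤ-neg (+ zero)  = sym -0#≈0#
    fromℤ-neg (+ suc n) = refl
    fromℤ-neg -[1+ n ]  = sym (-‿involutive _)

    fromℤ-+ : ∀ i j → fromℤ (i ℤ.+ j) ≈ fromℤ i + fromℤ j
    fromℤ-+ (+ m) (+ n) = ×-homo-+ 1# m n
    fromℤ-+ (+ m) -[1+ n ] = fromℤ-⊖ m (suc n)
    fromℤ-+ -[1+ m ] (+ n) = trans (fromℤ-⊖ n (suc m)) (+-comm _ _)
    fromℤ-+ -[1+ m ] -[1+ n ] = begin
      - (suc (suc (m ℕ.+ n)) ×′ 1#)     ≡⟨ ≡.cong (λ k → - (suc k ×′ 1#)) (ℕ.+-suc m n) ⟨
      - ((suc m ℕ.+ suc n) ×′ 1#)       ≈⟨ -‿cong (×-homo-+ 1# (suc m) (suc n)) ⟩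
      - (suc m ×′ 1# + suc n ×′ 1#)      ≈⟨ -‿+-comm _ _ ⟨
      - (suc m ×′ 1#) - suc n ×′ 1#      ∎

    fromℤ-* : ∀ i j → fromℤ (i ℤ.* j) ≈ fromℤ i * fromℤ j
    fromℤ-* (+ m) (+ n) = begin
      fromℤ (+ m ℤ.* + n)          ≡⟨ ≡.cong fromℤ (ℤ.pos-* m n) ⟨
      (m ℕ.* n) ×′ 1#               ≈⟨ ×1-homo-* m n ⟩
      m ×′ 1# * n ×′ 1#              ∎
    fromℤ-* (+ m) -[1+ n ] = begin
      fromℤ (+ m ℤ.* -[1+ n ])         ≡⟨ ≡.cong fromℤ (ℤ.neg-distribʳ-* (+ m) (+ suc n)) ⟨
      fromℤ (ℤ.- (+ m ℤ.* + suc n))    ≈⟨ fromℤ-neg (+ m ℤ.* + suc n) ⟩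
      - fromℤ (+ m ℤ.* + suc n)        ≈⟨ -‿cong (fromℤ-* (+ m) (+ suc n)) ⟩
      - (m ×′ 1# * suc n ×′ 1#)          ≈⟨ -‿distribʳ-* _ _ ⟩
      m ×′ 1# * - (suc n ×′ 1#)          ∎
    fromℤ-* -[1+ m ] (+ n) = begin
      fromℤ (-[1+ m ] ℤ.* + n)         ≡⟨ ≡.cong fromℤ (ℤ.neg-distribˡ-* (+ suc m) (+ n)) ⟨
      fromℤ (ℤ.- (+ suc m ℤ.* + n))    ≈⟨ fromℤ-neg (+ suc m ℤ.* + n) ⟩
      - fromℤ (+ suc m ℤ.* + n)        ≈⟨ -‿cong (fromℤ-* (+ suc m) (+ n)) ⟩
      - (suc m ×′ 1# * n ×′ 1#)          ≈⟨ -‿distribˡ-* _ _ ⟩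
      - (suc m ×′ 1#) * n ×′ 1#          ∎
    fromℤ-* -[1+ m ] -[1+ n ] = begin
      (suc m ℕ.* suc n) ×′ 1#               ≈⟨ ×1-homo-* (suc m) (suc n) ⟩
      suc m ×′ 1# * suc n ×′ 1#              ≈⟨ -‿involutive _ ⟨
      - - (suc m ×′ 1# * suc n ×′ 1#)        ≈⟨ -‿cong (-‿distribˡ-* _ _) ⟩
      - (- (suc m ×′ 1#) * suc n ×′ 1#)      ≈⟨ -‿distribʳ-* _ _ ⟩
      - (suc m ×′ 1#) * - (suc n ×′ 1#)      ∎

    homomorphism : ℤ.+-*-rawRing -Raw-AlmostCommutative⟶ fromCommutativeRing R
    homomorphism = record
      { ⟦_⟧    = fromℤ
      ; +-homo = fromℤ-+
      ; *-homo = fromℤ-*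
      ; -‿homo = fromℤ-neg
      ; 0-homo = refl
      ; 1-homo = refl
      }

    fromℤ-≟ : ∀ i j → Maybe (fromℤ i ≈ fromℤ j)
    fromℤ-≟ i j with i ℤ.≟ j
    ... | yes i≡j = just (reflexive (≡.cong fromℤ i≡j))
    ... | no  _   = nothing

  open Algebra.Solver.Ring ℤ.+-*-rawRing (fromCommutativeRing R) homomorphism fromℤ-≟ public
    using (solve; _:=_; _:+_; _:*_; _:-_; :-_; con; Polynomial)

  :0 :1 : ∀ {n} → Polynomial n
  :0 = con (+ 0)
  :1 = con (+ 1)

  x-y≈0⇒x≈y : ∀ {a b} → a - b ≈ 0# → a ≈ b
  x-y≈0⇒x≈y {a} {b} h = trans (solve 2 (λ a b → a := (a :- b) :+ b) refl a b) (trans (+-congʳ h) (+-identityˡ b))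

module Cancellation {c ℓ} (R : CommutativeRing c ℓ) where
  open CommutativeRing R

  cancel-inverse : ∀ {g h} → g * h ≈ 1# → ∀ y → g * (h * y) ≈ y
  cancel-inverse {g} {h} gh y = trans (sym (*-assoc g h y)) (trans (*-congʳ gh) (*-identityˡ y))

  cancel-middle : ∀ {b c} → b * c ≈ 1# → ∀ a d → (a * b) * (c * d) ≈ a * d
  cancel-middle {b} {c} bc a d = trans (*-assoc a b (c * d)) (*-congˡ (cancel-inverse bc d))

  swap-left : ∀ x y z → x * (y * z) ≈ y * (x * z)
  swap-left x y z = trans (sym (*-assoc x y z)) (trans (*-congʳ (*-comm x y)) (*-assoc y x z))

-- Valuations

parity : ∀ n → ∃ λ t → n ≡ t ℕ.+ t ⊎ n ≡ suc (t ℕ.+ t)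
parity zero = 0 , inj₁ ≡.refl
parity (suc n) with parity n
... | t , inj₁ ≡.refl = t , inj₂ ≡.refl
... | t , inj₂ ≡.refl = suc t , inj₁ (≡.cong suc (≡.sym (ℕ.+-suc t t)))

abstract
  -- The exponents minimised below are cut out by membership in arbitrary lattices, for which there
  -- is no decision; excluded middle supplies it.
  least : (∀ {a} → ExcludedMiddle a) → ∀ {a} (P : ℕ → Set a) → ∃ P →
          ∃ λ m → P m × (∀ i → P i → m ℕ.≤ i)
  least em P (n , p) = go n p (λ i i<0 _ → ℕ.n≮0 i<0) (ℕ.+-identityʳ n)
    where
    -- `k` is the distance from the search position `l` to the known member `m`, so the search stops
    -- there at the latest.
    go : ∀ {m} k → P m → ∀ {l} → (∀ i → i ℕ.< l → ¬ P i) → k ℕ.+ l ≡ m →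
         ∃ λ m → P m × (∀ i → P i → m ℕ.≤ i)
    go {m} k p {l} below eq with em {P = P l}
    ... | yes pl = l , pl , λ i pi → ℕ.≮⇒≥ (λ i<l → below i i<l pi)
    go {m} zero p {l} below ≡.refl | no ¬pl = ⊥-elim (¬pl p)
    go {m} (suc k) p {l} below eq | no ¬pl =
      go k p below′ (≡.trans (ℕ.+-suc k l) eq)
      where
      below′ : ∀ i → i ℕ.< suc l → ¬ P i
      below′ i (s≤s i≤l) pi with ℕ.m≤n⇒m<n∨m≡n i≤l
      ... | inj₁ i<l = below i i<l pi
      ... | inj₂ ≡.refl = ¬pl pi

module Valuation {c ℓ} (K : DiscretelyValuedField c ℓ) where
  open DiscretelyValuedField K
  open Algebra.Properties.Ring ring using (-1*x≈-x; -‿involutive)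
  open Algebra.Properties.Semiring.Exp semiring using (^-homo-*)
  open IntegerCoefficients commutativeRing

  private
    module ℤ-Ring = Algebra.Properties.Ring ℤ.+-*-ring

    ≤-<-connex : ∀ i j → i ℤ.≤ j ⊎ j ℤ.< i
    ≤-<-connex i j with i ℤ.≤? j
    ... | yes i≤j = inj₁ i≤j
    ... | no i≰j = inj₂ (ℤ.≰⇒> i≰j)

    double : ∀ k → k ℤ.+ k ≡ k → k ≡ + 0
    double k eq = ℤ-Ring.+-identityʳ-unique k k eq

    half : ∀ k → k ℤ.+ k ≡ + 0 → k ≡ + 0
    half (+ zero)  eq = ≡.refl
    half (+ suc n) ()
    half -[1+ n ]  ()

    ≤∞-weaken : ∀ {j k x} → j ℤ.≤ k → [ k ] ≤∞ x → [ j ] ≤∞ x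
    ≤∞-weaken j≤k (fin≤ p) = fin≤ (ℤ.≤-trans j≤k p)
    ≤∞-weaken j≤k (_ ≤∞⊤)  = _ ≤∞⊤

    +∞-mono : ∀ {i j x y} → [ i ] ≤∞ x → [ j ] ≤∞ y → [ i ℤ.+ j ] ≤∞ x +∞ y
    +∞-mono (fin≤ p) (fin≤ q)  = fin≤ (ℤ.+-mono-≤ p q)
    +∞-mono (fin≤ p) (_ ≤∞⊤)   = _ ≤∞⊤
    +∞-mono (_ ≤∞⊤)  q         = _ ≤∞⊤

    +∞-cancel : ∀ {i j x} → [ i ℤ.+ j ] ≤∞ x +∞ [ j ] → [ i ] ≤∞ x
    +∞-cancel {i} {j} {just k} (fin≤ p) = fin≤ (≡.subst₂ ℤ._≤_ (lemma i) (lemma k) (ℤ.+-monoˡ-≤ (ℤ.- j) p))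
      where
      lemma : ∀ l → l ℤ.+ j ℤ.- j ≡ l
      lemma l = ≡.trans (ℤ.+-assoc l j (ℤ.- j))
        (≡.trans (≡.cong (λ z → l ℤ.+ z) (ℤ.+-inverseʳ j)) (ℤ.+-identityʳ l))
    +∞-cancel {x = nothing} p = _ ≤∞⊤

  v-1 : v 1# ≡ [ + 0 ]
  v-1 with v 1# in eq
  ... | nothing = ⊥-elim (1≉0 (v-∞ 1# eq))
  ... | just k  = ≡.cong just (double k (just-injective
          (≡.trans (≡.sym (≡.cong₂ _+∞_ eq eq))
          (≡.trans (≡.sym (v-* 1# 1#))
          (≡.trans (v-cong (*-identityˡ 1#)) eq)))))

  v-neg1 : v (- 1#) ≡ [ + 0 ]
  v-neg1 = go (v (- 1#)) (≡.trans (≡.sym (v-* (- 1#) (- 1#)))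
           (≡.trans (v-cong (trans (-1*x≈-x (- 1#)) (-‿involutive 1#))) v-1))
    where
    go : ∀ k → k +∞ k ≡ [ + 0 ] → k ≡ [ + 0 ]
    go nothing  ()
    go (just k) eq = ≡.cong just (half k (just-injective eq))

  infix 4 _≤v_ _∈π^_

  _≤v_ : ℤ → Carrier → Set
  k ≤v a = [ k ] ≤∞ v a

  ≤v-weaken : ∀ {j k a} → j ℤ.≤ k → k ≤v a → j ≤v a
  ≤v-weaken = ≤∞-weaken

  ≤v-cong : ∀ {k a b} → a ≈ b → k ≤v a → k ≤v b
  ≤v-cong a≈b = ≡.subst ([ _ ] ≤∞_) (v-cong a≈b)

  ≤v-0 : ∀ {k} → k ≤v 0#
  ≤v-0 = ≡.subst ([ _ ] ≤∞_) (≡.sym v-0) (_ ≤∞⊤)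

  ≤v-* : ∀ {j k a b} → j ≤v a → k ≤v b → j ℤ.+ k ≤v a * b
  ≤v-* {a = a} {b} p q = ≡.subst ([ _ ] ≤∞_) (≡.sym (v-* a b)) (+∞-mono p q)

  ≤v-+ : ∀ {k a b} → k ≤v a → k ≤v b → k ≤v a + b
  ≤v-+ = v-+ _ _ _

  ≤v-neg : ∀ {k a} → k ≤v a → k ≤v - a
  ≤v-neg {k} {a} p = ≤v-cong (-1*x≈-x a)
    (≡.subst (_≤v (- 1# * a)) (ℤ.+-identityˡ k)
      (≤v-* {j = + 0} (≡.subst ([ + 0 ] ≤∞_) (≡.sym v-neg1) (fin≤ ℤ.≤-refl)) p))

  ≤v-sub : ∀ {k a b} → k ≤v a → k ≤v b → k ≤v a - b
  ≤v-sub p q = ≤v-+ p (≤v-neg q)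

  ≤v? : ∀ k a → Dec (k ≤v a)
  ≤v? k a = ≤⁺-dec ℤ._≤?_ [ k ] (v a)
    where open import Relation.Binary.Construct.Add.Supremum.NonStrict ℤ._≤_ using (≤⁺-dec)

  ≤v-cancel : ∀ {j k a b} → v b ≡ [ k ] → j ℤ.+ k ≤v a * b → j ≤v a
  ≤v-cancel {j} {k} {a} {b} vb p = +∞-cancel {i = j} {j = k}
    (≡.subst ([ j ℤ.+ k ] ≤∞_) (≡.trans (v-* a b) (≡.cong (v a +∞_) vb)) p)

  ≡⇒≤v : ∀ {k a} → v a ≡ [ k ] → k ≤v a
  ≡⇒≤v eq = ≡.subst ([ _ ] ≤∞_) (≡.sym eq) (fin≤ ℤ.≤-refl)

  v-exact : ∀ {k a} → k ≤v a → ¬ (k ℤ.+ + 1 ≤v a) → v a ≡ [ k ]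
  v-exact {k} {a} p ¬q with v a
  v-exact {k} {a} (fin≤ p) ¬q | just i with ≤-<-connex i k
  ... | inj₁ i≤k = ≡.cong just (ℤ.≤-antisym i≤k p)
  ... | inj₂ k<i = ⊥-elim (¬q (fin≤ (≡.subst (ℤ._≤ i) (ℤ.+-comm (+ 1) k) (ℤ.i<j⇒suc[i]≤j k<i))))
  v-exact {k} {a} p ¬q | nothing = ⊥-elim (¬q (_ ≤∞⊤))

  private
    +-split< : ∀ {k a b i} → v a ≡ [ i ] → i ℤ.+ + 1 ≤v b → k ≤v a + b → k ≤v a
    +-split< {k} {a} {b} {i} va i<b p with ≤-<-connex k i
    ... | inj₁ k≤i = ≡.subst ([ k ] ≤∞_) (≡.sym va) (fin≤ k≤i)
    ... | inj₂ i<k = ⊥-elim (contra (≡.subst ([ i ℤ.+ + 1 ] ≤∞_) va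
          (≤v-cong (solve 2 (λ a b → (a :+ b) :- b := a) refl a b)
            (≤v-sub (≤v-weaken (≡.subst (ℤ._≤ k) (ℤ.+-comm (+ 1) i) (ℤ.i<j⇒suc[i]≤j i<k)) p) i<b))))
      where
      contra : ¬ ([ i ℤ.+ + 1 ] ≤∞ [ i ])
      contra (fin≤ q) = ℤ.<-irrefl ≡.refl (ℤ.suc[i]≤j⇒i<j (≡.subst (ℤ._≤ i) (ℤ.+-comm i (+ 1)) q))

  -- Summands of different valuation cannot cancel, so the ultrametric inequality is an equality.
  -- Applied to `ι p` and `ι r * x`, this makes 1 and x an orthogonal basis.
  +-split : ∀ {k a b} → ((i : ℤ) → v a ≡ [ i ] → ¬ (v b ≡ [ i ])) → k ≤v a + b → k ≤v a × k ≤v b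
  +-split {k} {a} {b} distinct p = k≤a , k≤b
    where
    k≤a : k ≤v a
    k≤a with v a in va | v b in vb
    ... | nothing | _ = _ ≤∞⊤
    ... | just i | nothing = ≡.subst ([ k ] ≤∞_) va (+-split< va (≡.subst ([ _ ] ≤∞_) (≡.sym vb) (_ ≤∞⊤)) p)
    ... | just i | just j with ℤ.<-cmp i j
    ...   | tri< i<j _ _ = ≡.subst ([ k ] ≤∞_) va (+-split< va
              (≡.subst ([ _ ] ≤∞_) (≡.sym vb) (fin≤ (≡.subst (ℤ._≤ j) (ℤ.+-comm (+ 1) i) (ℤ.i<j⇒suc[i]≤j i<j)))) p)
    ...   | tri≈ _ ≡.refl _ = ⊥-elim (distinct i ≡.refl ≡.refl)
    ...   | tri> _ _ j<i = fin≤ (ℤ.≤-trans (k≤j (≡.subst ([ k ] ≤∞_) vb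
              (+-split< vb (≡.subst ([ _ ] ≤∞_) (≡.sym va) (fin≤ (≡.subst (ℤ._≤ i) (ℤ.+-comm (+ 1) j) (ℤ.i<j⇒suc[i]≤j j<i))))
                (≤v-cong (+-comm a b) p)))) (ℤ.<⇒≤ j<i))
      where
      k≤j : [ k ] ≤∞ [ j ] → k ℤ.≤ j
      k≤j (fin≤ q) = q
    k≤b : k ≤v b
    k≤b = ≤v-cong (solve 2 (λ a b → (a :+ b) :- a := b) refl a b) (≤v-sub p k≤a)

  _∈π^_ : Carrier → ℕ → Set
  a ∈π^ n = + n ≤v a

  module Uniformized (π : Carrier) (π-uniformizer : IsUniformizer π) where

    ∈-weaken : ∀ {j k a} → j ℕ.≤ k → a ∈π^ k → a ∈π^ j
    ∈-weaken j≤k = ≤v-weaken (ℤ.+≤+ j≤k)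

    ∈⇒𝒪 : ∀ {k a} → a ∈π^ k → 𝒪 a
    ∈⇒𝒪 = ∈-weaken z≤n

    ∈-* : ∀ {j k a b} → a ∈π^ j → b ∈π^ k → a * b ∈π^ j ℕ.+ k
    ∈-* = ≤v-*

    ∈-*ˡ : ∀ {k a b} → 𝒪 a → b ∈π^ k → a * b ∈π^ k
    ∈-*ˡ = ≤v-*

    ∈-*ʳ : ∀ {k a b} → a ∈π^ k → 𝒪 b → a * b ∈π^ k
    ∈-*ʳ p q = ≤v-cong (*-comm _ _) (≤v-* {j = + 0} q p)

    v-π^ : ∀ n → v (π ^ n) ≡ [ + n ]
    v-π^ zero = v-1
    v-π^ (suc n) = ≡.trans (v-* π (π ^ n)) (≡.cong₂ _+∞_ π-uniformizer (v-π^ n))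

    π^∈ : ∀ n → π ^ n ∈π^ n
    π^∈ n = ≡⇒≤v (v-π^ n)

    𝒪-1 : 𝒪 1#
    𝒪-1 = π^∈ 0

    π^-≤ : ∀ {m n} → π ^ n ∈π^ m → m ℕ.≤ n
    π^-≤ {m} {n} p with v (π ^ n) | v-π^ n
    π^-≤ (fin≤ (ℤ.+≤+ p)) | _ | ≡.refl = p

    π^-+ : ∀ m n → π ^ (m ℕ.+ n) ≈ π ^ m * π ^ n
    π^-+ = ^-homo-* π

    private
      finite⇒≉0 : ∀ {a k} → v a ≡ [ k ] → ¬ (a ≈ 0#)
      finite⇒≉0 va a≈0 with ≡.trans (≡.sym va) (≡.trans (v-cong a≈0) v-0)
      ... | ()

      v-inverse : ∀ {a w k} → a * w ≈ 1# → v a ≡ [ k ] → v w ≡ [ ℤ.- k ]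
      v-inverse {a} {w} {k} aw va = go (v w) (≡.trans (≡.cong (_+∞ v w) (≡.sym va))
          (≡.trans (≡.sym (v-* a w)) (≡.trans (v-cong aw) v-1)))
        where
        go : ∀ z → [ k ] +∞ z ≡ [ + 0 ] → z ≡ [ ℤ.- k ]
        go nothing ()
        go (just j) eq = ≡.cong just (ℤ-Ring.+-inverseʳ-unique k j (just-injective eq))

    abstract
      inverse : ∀ {a k} → v a ≡ [ k ] → ∃ λ w → a * w ≈ 1# × v w ≡ [ ℤ.- k ]
      inverse {a} va = let (w , _ , aw) = invertible a (finite⇒≉0 va) in w , aw , v-inverse aw va

    *-cancelʳ-≈ : ∀ {a b z w} → z * w ≈ 1# → a * z ≈ b * z → a ≈ b
    *-cancelʳ-≈ {a} {b} {z} {w} zw eq = trans (sym (undo a)) (trans (*-congʳ eq) (undo b))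
      where
      undo : ∀ a → a * z * w ≈ a
      undo a = trans (*-assoc a z w) (trans (*-congˡ zw) (*-identityʳ a))

    abstract
      divide : ∀ {a n} → a ∈π^ n → ∃ λ t → 𝒪 t × a ≈ t * π ^ n
      divide {a} {n} p = let (w , πw , vw) = inverse (v-π^ n) in
        a * w , ≡.subst (_≤v (a * w)) (ℤ.+-inverseʳ (+ n)) (≤v-* p (≡⇒≤v vw)) ,
        sym (trans (*-assoc a w _) (trans (*-congˡ (trans (*-comm w _) πw)) (*-identityʳ a)))

    cancel : ∀ {t k} n → t * π ^ n ∈π^ k ℕ.+ n → t ∈π^ k
    cancel {k = k} n = ≤v-cancel {j = + k} (v-π^ n)

    π^-cancelʳ : ∀ {a b} n → a * π ^ n ≈ b * π ^ n → a ≈ b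
    π^-cancelʳ n = *-cancelʳ-≈ (proj₁ (proj₂ (inverse (v-π^ n))))

    abstract
      unit : ∀ {a} → 𝒪 a → ¬ a ∈π^ 1 → ∃ λ w → 𝒪 w × a * w ≈ 1#
      unit {a} p ¬q = let (w , aw , vw) = inverse (v-exact p ¬q) in w , ≡⇒≤v vw , aw

      -- The valuation i of such an element is finite and below k; `w` is π^i divided by it.
      factor : ∀ {a k} → 𝒪 a → ¬ a ∈π^ k → ∃₂ λ i w → i ℕ.< k × 𝒪 w × a * w ≈ π ^ i × a ∈π^ i
      factor {a} {zero} p ¬q = ⊥-elim (¬q p)
      factor {a} {suc k} p ¬q with ≤v? (+ k) a
      ... | no ¬r = let (i , w , i<k , rest) = factor p ¬r in i , w , ℕ.m<n⇒m<1+n i<k , rest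
      ... | yes r = let va = v-exact r (≡.subst (λ z → ¬ (z ≤v a)) (≡.cong +_ (≡.sym (ℕ.+-comm k 1))) ¬q)
                        (w , aw , vw) = inverse va in
            k , w * π ^ k , ℕ.n<1+n k ,
            ≡.subst (_≤v (w * π ^ k)) (ℤ.+-inverseˡ (+ k)) (≤v-* (≡⇒≤v vw) (π^∈ k)) ,
            trans (sym (*-assoc a w _)) (trans (*-congʳ aw) (*-identityˡ _)) , r

      -- The form in which minimality of an exponent is used: an element of too small a valuation
      -- would, multiplied by the integral `w`, put a smaller power of π into the same lattice.
      ∈-unless : ∀ {a k} → 𝒪 a → (∀ {i w} → i ℕ.< k → 𝒪 w → a * w ≈ π ^ i → ⊥) → a ∈π^ k
      ∈-unless {a} {k} a∈ absurd with ≤v? (+ k) a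
      ... | yes h = h
      ... | no ¬h = let (i , w , i<k , w∈ , aw , _) = factor a∈ ¬h in ⊥-elim (absurd i<k w∈ aw)

      nonzero : ∀ {a} → ¬ (a ≈ 0#) → ∃ λ k → ¬ (a ∈π^ k)
      nonzero {a} a≉0 with v a in va
      ... | nothing = ⊥-elim (a≉0 (v-∞ a va))
      ... | just (+ k) = suc k , λ { (fin≤ (ℤ.+≤+ q)) → ℕ.1+n≰n q }
      ... | just -[1+ k ] = 0 , λ { (fin≤ ()) }

      denominator : ∀ a → ∃ λ n → 𝒪 (π ^ n * a)
      denominator a with v a in va
      ... | nothing = 0 , ≤v-cong (sym (*-congˡ (v-∞ a va))) (≤v-cong (sym (zeroʳ _)) ≤v-0)
      ... | just (+ k) = 0 , ≤v-* {j = + 0} 𝒪-1 (≤v-weaken (ℤ.+≤+ z≤n) (≡⇒≤v va))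
      ... | just -[1+ k ] = suc k , ≡.subst (_≤v (π ^ suc k * a)) (ℤ.+-inverseʳ (+ suc k)) (≤v-* (π^∈ (suc k)) (≡⇒≤v va))

    denominator-weaken : ∀ {a m n} → m ℕ.≤ n → 𝒪 (π ^ m * a) → 𝒪 (π ^ n * a)
    denominator-weaken {a} {m} {n} m≤n p = ≤v-cong
      (trans (sym (*-assoc _ _ a)) (*-congʳ (trans (sym (π^-+ (n ℕ.∸ m) m)) (reflexive (≡.cong (π ^_) (ℕ.m∸n+n≡m m≤n))))))
      (∈-*ˡ {k = 0} (∈⇒𝒪 (π^∈ (n ℕ.∸ m))) p)

-- Ramified quadratic extensions

record QuadraticSetting c ℓ : Set (Level.suc (c ⊔ ℓ)) where
  field
    F E′          : LocalField c ℓ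
    ext           : Extension F E′
    degree-2      : Extension.HasDegree ext 2
    ramified      : Extension.IsRamified ext
    π             : LocalField.Carrier F
    π-uniformizer : LocalField.IsUniformizer F π
    x             : LocalField.Carrier E′
    x-uniformizer : LocalField.IsUniformizer E′ x

module RamifiedQuadratic {c ℓ} (setting : QuadraticSetting c ℓ) where
  open QuadraticSetting setting

  private
    module F = LocalField F
    module E′ = LocalField E′
    module VF = Valuation F.discretelyValuedField
    module VE = Valuation E′.discretelyValuedField

  open Extension ext
  open RingMorphisms.IsRingHomomorphism isRingHomomorphism
    using (+-homo; *-homo; 0#-homo; 1#-homo; -‿homo) renaming (⟦⟧-cong to ι-cong) public
  open VF.Uniformized π π-uniformizer
  open E′ using (_≈_; _+_; _*_; -_; _-_; 0#; 1#; v)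
  open IntegerCoefficients E′.commutativeRing using (solve; _:=_; _:+_; _:*_; _:-_; :-_)

  κ : F.Carrier → F.Carrier → E′.Carrier
  κ p r = ι p + ι r * x

  κ-cong : ∀ {p p′ r r′} → p F.≈ p′ → r F.≈ r′ → κ p r ≈ κ p′ r′
  κ-cong p≈ r≈ = E′.+-cong (ι-cong p≈) (E′.*-congʳ (ι-cong r≈))

  κ-+ : ∀ p r p′ r′ → κ p r + κ p′ r′ ≈ κ (p F.+ p′) (r F.+ r′)
  κ-+ p r p′ r′ = E′.trans
    (solve 5 (λ P R P′ R′ X → (P :+ R :* X) :+ (P′ :+ R′ :* X) := (P :+ P′) :+ (R :+ R′) :* X)
      E′.refl (ι p) (ι r) (ι p′) (ι r′) x)
    (E′.+-cong (E′.sym (+-homo p p′)) (E′.*-congʳ (E′.sym (+-homo r r′))))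

  private
    e-as-ℤ : ℤ
    e-as-ℤ = + e

    v-ι-0 : ∀ {p} → p F.≈ F.0# → v (ι p) ≡ ⊤⁺
    v-ι-0 p≈0 = ≡.trans (E′.v-cong (E′.trans (ι-cong p≈0) 0#-homo)) E′.v-0

    v-ι-map : ∀ p → v (ι p) ≡ Maybe.map (e-as-ℤ ℤ.*_) (F.v p)
    v-ι-map p with F.v p in eq
    ... | nothing = v-ι-0 (F.v-∞ p eq)
    ... | just k  = v-ι p k eq

    v-ιx-map : ∀ r → v (ι r * x) ≡ Maybe.map (λ k → e-as-ℤ ℤ.* k ℤ.+ + 1) (F.v r)
    v-ιx-map r = ≡.trans (E′.v-* (ι r) x) (≡.trans (≡.cong₂ _+∞_ (v-ι-map r) x-uniformizer) (lemma (F.v r)))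
      where
      lemma : ∀ z → Maybe.map (e-as-ℤ ℤ.*_) z +∞ [ + 1 ] ≡ Maybe.map (λ k → e-as-ℤ ℤ.* k ℤ.+ + 1) z
      lemma nothing = ≡.refl
      lemma (just _) = ≡.refl

    -- One valuation is divisible by e, the other is 1 modulo e. If they agreed, e would divide 1,
    -- against e > 1.
    distinct : ∀ p r i → v (ι p) ≡ [ i ] → ¬ (v (ι r * x) ≡ [ i ])
    distinct p r i vp vr with F.v p | F.v r | v-ι-map p | v-ιx-map r
    ... | nothing | _ | eq | _ = case ≡.trans (≡.sym vp) eq of λ ()
    ... | just _ | nothing | _ | eq = case ≡.trans (≡.sym vr) eq of λ ()
    ... | just j | just k | eq | eq′ = ℕ.<⇒≢ ramified (≡.sym (ℕ.m*n≡1⇒m≡1 e ℤ.∣ j ℤ.- k ∣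
          (≡.trans (≡.sym (ℤ.abs-* e-as-ℤ (j ℤ.- k))) (≡.cong ℤ.∣_∣ difference))))
      where
      ej≡ek+1 : e-as-ℤ ℤ.* j ≡ e-as-ℤ ℤ.* k ℤ.+ + 1
      ej≡ek+1 = just-injective (≡.trans (≡.sym eq) (≡.trans vp (≡.trans (≡.sym vr) eq′)))
      difference : e-as-ℤ ℤ.* (j ℤ.- k) ≡ + 1
      difference = ≡.trans (ℤ.*-distribˡ-+ e-as-ℤ j (ℤ.- k))
        (≡.trans (≡.cong₂ ℤ._+_ ej≡ek+1 (≡.sym (ℤ.neg-distribʳ-* e-as-ℤ k)))
        (≡.trans (≡.cong (ℤ._- (e-as-ℤ ℤ.* k)) (ℤ.+-comm (e-as-ℤ ℤ.* k) (+ 1)))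
        (≡.trans (ℤ.+-assoc (+ 1) (e-as-ℤ ℤ.* k) (ℤ.- (e-as-ℤ ℤ.* k)))
        (≡.cong (λ z → + 1 ℤ.+ z) (ℤ.+-inverseʳ (e-as-ℤ ℤ.* k))))))

    κ-split : ∀ {k p r} → k VE.≤v κ p r → k VE.≤v ι p × k VE.≤v ι r * x
    κ-split {p = p} {r} = VE.+-split (distinct p r)

    ≤-all⇒∞ : ∀ {z} → (∀ k → [ k ] ≤∞ z) → z ≡ ⊤⁺
    ≤-all⇒∞ {nothing} _ = ≡.refl
    ≤-all⇒∞ {just i} h with h (+ 1 ℤ.+ i)
    ... | fin≤ q = ⊥-elim (ℤ.<-irrefl ≡.refl (ℤ.suc[i]≤j⇒i<j q))

    ι-injective₀ : ∀ {p} → v (ι p) ≡ ⊤⁺ → p F.≈ F.0#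
    ι-injective₀ {p} h with F.v p in eq | v-ι-map p
    ... | nothing | _ = F.v-∞ p eq
    ... | just _ | eq′ = case ≡.trans (≡.sym h) eq′ of λ ()

    ιx-injective₀ : ∀ {r} → v (ι r * x) ≡ ⊤⁺ → r F.≈ F.0#
    ιx-injective₀ {r} h with F.v r in eq | v-ιx-map r
    ... | nothing | _ = F.v-∞ r eq
    ... | just _ | eq′ = case ≡.trans (≡.sym h) eq′ of λ ()

  -- Zero satisfies every valuation bound, and each bound passes to both coordinates.
  κ-injective₀ : ∀ {p r} → κ p r ≈ 0# → p F.≈ F.0# × r F.≈ F.0#
  κ-injective₀ {p} {r} h =
    ι-injective₀ (≤-all⇒∞ (λ k → proj₁ (κ-split (all k)))) ,
    ιx-injective₀ (≤-all⇒∞ (λ k → proj₂ (κ-split (all k))))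
    where
    all : ∀ k → k VE.≤v κ p r
    all k = VE.≤v-cong (E′.sym h) VE.≤v-0

  κ-injective : ∀ {p r p′ r′} → κ p r ≈ κ p′ r′ → p F.≈ p′ × r F.≈ r′
  κ-injective {p} {r} {p′} {r′} h = let (p≈ , r≈) = κ-injective₀ difference in
    -≈0⇒≈ p≈ , -≈0⇒≈ r≈
    where
    open IntegerCoefficients F.commutativeRing using () renaming (x-y≈0⇒x≈y to -≈0⇒≈)
    difference : κ (p F.- p′) (r F.- r′) ≈ 0#
    difference = E′.trans
      (E′.trans (E′.sym (κ-+ p r (F.- p′) (F.- r′)))
        (E′.+-cong h (E′.trans (E′.+-cong (-‿homo p′) (E′.*-congʳ (-‿homo r′)))
          (solve 3 (λ P R X → (:- P) :+ (:- R) :* X := :- (P :+ R :* X)) E′.refl (ι p′) (ι r′) x))))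
      (E′.-‿inverseʳ _)

  private
    module Basis (b : Fin 2 → E′.Carrier)
        (decompose : ∀ y → ∃₂ λ α β → y ≈ ι α * b fzero + ι β * b (fsuc fzero)) where
      e₀ = b fzero
      e₁ = b (fsuc fzero)
      a₀ a₁ c₀ c₁ det : F.Carrier
      a₀ = proj₁ (decompose 1#)
      a₁ = proj₁ (proj₂ (decompose 1#))
      c₀ = proj₁ (decompose x)
      c₁ = proj₁ (proj₂ (decompose x))
      det = a₀ F.* c₁ F.- a₁ F.* c₀
      1≈ : 1# ≈ ι a₀ * e₀ + ι a₁ * e₁
      1≈ = proj₂ (proj₂ (decompose 1#))
      x≈ : x ≈ ι c₀ * e₀ + ι c₁ * e₁
      x≈ = proj₂ (proj₂ (decompose x))

      ι-det : ι det ≈ ι a₀ * ι c₁ - ι a₁ * ι c₀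
      ι-det = E′.trans (+-homo _ _) (E′.+-cong (*-homo _ _) (E′.trans (-‿homo _) (E′.-‿cong (*-homo _ _))))

      -- Eliminating one basis vector expresses `det` times the other through 1 and x, with
      -- coefficients among `± a` and `± c`. If `det` vanished, independence of 1 and x would force
      -- `a₀` and `a₁` to vanish, and with them 1 itself. Cramer's rule then gives `spans`.
      det≉0 : ¬ (det F.≈ F.0#)
      det≉0 det≈0 = E′.1≉0 (E′.trans 1≈ (E′.trans (E′.+-cong (E′.*-congʳ (ι≈0 a₀≈0)) (E′.*-congʳ (ι≈0 a₁≈0)))
          (E′.trans (E′.+-cong (E′.zeroˡ e₀) (E′.zeroˡ e₁)) (E′.+-identityˡ 0#))))
        where
        ι≈0 : ∀ {p} → p F.≈ F.0# → ι p ≈ 0#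
        ι≈0 p≈0 = E′.trans (ι-cong p≈0) 0#-homo
        vanish : ∀ p r y → ι p * (ι a₀ * e₀ + ι a₁ * e₁) + ι r * (ι c₀ * e₀ + ι c₁ * e₁) ≈ ι det * y → κ p r ≈ 0#
        vanish p r y eq = E′.trans
          (E′.+-cong (E′.trans (E′.sym (E′.*-identityʳ _)) (E′.*-congˡ 1≈)) (E′.*-congˡ x≈))
          (E′.trans eq (E′.trans (E′.*-congʳ (ι≈0 det≈0)) (E′.zeroˡ y)))
        a₁≈0 : a₁ F.≈ F.0#
        a₁≈0 = F.trans (F.sym (-‿involutive a₁)) (F.trans (F.-‿cong (proj₂ (κ-injective₀ (vanish c₁ (F.- a₁) e₀
          (E′.trans (E′.+-congˡ (E′.*-congʳ (-‿homo a₁))) (E′.trans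
            (solve 6 (λ A B C D X Y → D :* (A :* X :+ B :* Y) :+ (:- B) :* (C :* X :+ D :* Y) := (A :* D :- B :* C) :* X)
              E′.refl (ι a₀) (ι a₁) (ι c₀) (ι c₁) e₀ e₁)
            (E′.*-congʳ (E′.sym ι-det)))))))) -0#≈0#)
          where open Algebra.Properties.Ring F.ring using (-‿involutive; -0#≈0#)
        a₀≈0 : a₀ F.≈ F.0#
        a₀≈0 = proj₂ (κ-injective₀ (vanish (F.- c₀) a₀ e₁
          (E′.trans (E′.+-congʳ (E′.*-congʳ (-‿homo c₀))) (E′.trans
            (solve 6 (λ A B C D X Y → (:- C) :* (A :* X :+ B :* Y) :+ A :* (C :* X :+ D :* Y) := (A :* D :- B :* C) :* Y)
              E′.refl (ι a₀) (ι a₁) (ι c₀) (ι c₁) e₀ e₁)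
            (E′.*-congʳ (E′.sym ι-det))))))

      spans : ∀ y → ∃₂ λ p r → y ≈ κ p r
      spans y = let (α , β , y≈) = decompose y
                    (w , _ , det*w) = F.invertible det det≉0
                in w F.* (α F.* c₁ F.- β F.* c₀) , w F.* (β F.* a₀ F.- α F.* a₁) , (begin
        y ≈⟨ y≈ ⟩
        ι α * e₀ + ι β * e₁ ≈⟨ E′.*-identityˡ _ ⟨
        1# * (ι α * e₀ + ι β * e₁) ≈⟨ E′.*-congʳ (E′.trans (E′.sym 1#-homo) (E′.trans (ι-cong (F.sym det*w))
            (E′.trans (*-homo det w) (E′.*-congʳ ι-det)))) ⟩
        ((ι a₀ * ι c₁ - ι a₁ * ι c₀) * ι w) * (ι α * e₀ + ι β * e₁)
          ≈⟨ solve 9 (λ A B C D X Y P Q W → ((A :* D :- B :* C) :* W) :* (P :* X :+ Q :* Y) :=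
               (W :* (P :* D :- Q :* C)) :* (A :* X :+ B :* Y) :+ (W :* (Q :* A :- P :* B)) :* (C :* X :+ D :* Y))
               E′.refl (ι a₀) (ι a₁) (ι c₀) (ι c₁) e₀ e₁ (ι α) (ι β) (ι w) ⟩
        (ι w * (ι α * ι c₁ - ι β * ι c₀)) * (ι a₀ * e₀ + ι a₁ * e₁) +
          (ι w * (ι β * ι a₀ - ι α * ι a₁)) * (ι c₀ * e₀ + ι c₁ * e₁)
          ≈⟨ E′.+-cong (E′.*-cong (E′.sym (expand w α c₁ β c₀)) (E′.sym 1≈)) (E′.*-cong (E′.sym (expand w β a₀ α a₁)) (E′.sym x≈)) ⟩
        ι (w F.* (α F.* c₁ F.- β F.* c₀)) * 1# + ι (w F.* (β F.* a₀ F.- α F.* a₁)) * x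
          ≈⟨ E′.+-congʳ (E′.*-identityʳ _) ⟩
        κ _ _ ∎)
        where
        open import Relation.Binary.Reasoning.Setoid E′.setoid
        expand : ∀ w α c β d → ι (w F.* (α F.* c F.- β F.* d)) ≈ ι w * (ι α * ι c - ι β * ι d)
        expand w α c β d = E′.trans (*-homo _ _) (E′.*-congˡ (E′.trans (+-homo _ _)
          (E′.+-cong (*-homo _ _) (E′.trans (-‿homo _) (E′.-‿cong (*-homo _ _))))))

  abstract
    κ-surjective : ∀ y → ∃₂ λ p r → y ≈ κ p r
    κ-surjective = Basis.spans (proj₁ degree-2) λ y → let (a , eq , _) = proj₂ degree-2 y in
      a fzero , a (fsuc fzero) , E′.trans eq (E′.+-congˡ (E′.+-identityʳ _))

  private
    x² = κ-surjective (x * x)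

  -- Trace and norm of x: its minimal polynomial is X² - T X + D, and the bounds `T∈`, `D∈` and `D∉`
  -- say that it is Eisenstein.
  T D : F.Carrier
  T = proj₁ (proj₂ x²)
  D = F.- proj₁ x²

  x²≈ : x * x ≈ ι T * x - ι D
  x²≈ = E′.trans (proj₂ (proj₂ x²)) (E′.trans (E′.+-comm _ _)
    (E′.+-congˡ (E′.trans (ι-cong (F.sym (-‿involutive _))) (-‿homo D))))
    where open Algebra.Properties.Ring F.ring using (-‿involutive)

  private
    v-x² : v (κ (proj₁ x²) T) ≡ [ + 2 ]
    v-x² = ≡.trans (E′.v-cong (E′.sym (proj₂ (proj₂ x²))))
      (≡.trans (E′.v-* x x) (≡.cong₂ _+∞_ x-uniformizer x-uniformizer))

    2≤ : + 2 VE.≤v ι (proj₁ x²) × + 2 VE.≤v ι T * x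
    2≤ = κ-split (VE.≡⇒≤v v-x²)

    e-positive-multiple : ∀ j → + 1 ℤ.≤ e-as-ℤ ℤ.* j → + 1 ℤ.≤ j
    e-positive-multiple (+ zero) h = ≡.subst (+ 1 ℤ.≤_) (ℤ.*-zeroʳ e-as-ℤ) h
    e-positive-multiple (+ suc j) h = ℤ.+≤+ (s≤s z≤n)
    e-positive-multiple -[1+ j ] h = ⊥-elim (ℤ.≤⇒≯ (ℤ.≤-trans h
      (≡.subst (e-as-ℤ ℤ.* -[1+ j ] ℤ.≤_) (ℤ.*-zeroʳ e-as-ℤ) (ℤ.*-monoˡ-≤-nonNeg e-as-ℤ ℤ.-≤+))) (ℤ.+<+ (s≤s z≤n)))

    2≤e*j : ∀ j → + 1 ℤ.≤ j → + 2 ℤ.≤ e-as-ℤ ℤ.* j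
    2≤e*j (+ suc j) _ = ≡.subst (+ 2 ℤ.≤_) (ℤ.pos-* e (suc j)) (ℤ.+≤+ (ℕ.*-mono-≤ ramified (s≤s (z≤n {j}))))
    2≤e*j (+ zero) (ℤ.+≤+ ())

  T∈ : T VF.∈π^ 1
  T∈ = go (F.v T) (≡.subst ([ + 2 ] ≤∞_) (v-ιx-map T) (proj₂ 2≤))
    where
    go : ∀ z → [ + 2 ] ≤∞ Maybe.map (λ k → e-as-ℤ ℤ.* k ℤ.+ + 1) z → [ + 1 ] ≤∞ z
    go nothing h = _ ≤∞⊤
    go (just k) (fin≤ h) = fin≤ (e-positive-multiple k (≡.subst (+ 1 ℤ.≤_) (lemma (e-as-ℤ ℤ.* k)) (ℤ.+-monoˡ-≤ (ℤ.- + 1) h)))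
      where
      lemma : ∀ z → z ℤ.+ + 1 ℤ.- + 1 ≡ z
      lemma z = ≡.trans (ℤ.+-assoc z (+ 1) (ℤ.- + 1)) (ℤ.+-identityʳ z)

  private
    3≤ιTx : + 3 VE.≤v ι T * x
    3≤ιTx = ≡.subst ([ + 3 ] ≤∞_) (≡.sym (v-ιx-map T)) (go (F.v T) T∈)
      where
      go : ∀ z → [ + 1 ] ≤∞ z → [ + 3 ] ≤∞ Maybe.map (λ k → e-as-ℤ ℤ.* k ℤ.+ + 1) z
      go nothing _ = _ ≤∞⊤
      go (just k) (fin≤ h) = fin≤ (ℤ.+-monoˡ-≤ (+ 1) (2≤e*j k h))

    v-ιp : v (ι (proj₁ x²)) ≡ [ + 2 ]
    v-ιp = VE.v-exact (proj₁ 2≤) λ 3≤ → absurd (≡.subst ([ + 3 ] ≤∞_) v-x² (VE.≤v-+ 3≤ 3≤ιTx))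
      where
      absurd : ¬ ([ + 3 ] ≤∞ [ + 2 ])
      absurd (fin≤ (ℤ.+≤+ (s≤s (s≤s ()))))

    -- The x-part of x² has valuation at least 3, so the valuation 2 comes from the part in F. It is
    -- e times an integer, and e > 1 leaves only e = 2.
    v-p : e ≡ 2 × F.v (proj₁ x²) ≡ [ + 1 ]
    v-p = go (F.v (proj₁ x²)) (≡.trans (≡.sym (v-ι-map _)) v-ιp)
      where
      go : ∀ z → Maybe.map (e-as-ℤ ℤ.*_) z ≡ [ + 2 ] → e ≡ 2 × z ≡ [ + 1 ]
      go nothing ()
      go (just k) eq with just-injective eq
      ... | ek≡2 with e-positive-multiple k (≡.subst (+ 1 ℤ.≤_) (≡.sym ek≡2) (ℤ.+≤+ (s≤s z≤n)))
      go (just (+ suc zero)) eq | ek≡2 | _ =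
        ≡.trans (≡.sym (ℕ.*-identityʳ e)) (ℤ.+-injective (≡.trans (ℤ.pos-* e 1) ek≡2)) , ≡.refl
      go (just (+ suc (suc k))) eq | ek≡2 | _ = ⊥-elim (ℕ.<⇒≱ (ℕ.*-mono-≤ ramified (s≤s (s≤s (z≤n {k}))))
        (ℕ.≤-trans (ℕ.≤-reflexive (ℤ.+-injective (≡.trans (ℤ.pos-* e (suc (suc k))) ek≡2))) (s≤s (s≤s z≤n))))
      go (just (+ zero)) eq | _ | ℤ.+≤+ ()

    e≡2 : e ≡ 2
    e≡2 = proj₁ v-p

  D∈ : D VF.∈π^ 1
  D∈ = VF.≤v-neg (VF.≡⇒≤v (proj₂ v-p))

  D∉ : ¬ (D VF.∈π^ 2)
  D∉ h = absurd (≡.subst ([ + 2 ] ≤∞_) (proj₂ v-p) (VF.≤v-cong (-‿involutive _) (VF.≤v-neg h)))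
    where
    open Algebra.Properties.Ring F.ring using (-‿involutive)
    absurd : ¬ ([ + 2 ] ≤∞ [ + 1 ])
    absurd (fin≤ (ℤ.+≤+ (s≤s ())))

  κ-* : ∀ p r p′ r′ → κ p r * κ p′ r′ ≈
        κ (p F.* p′ F.- D F.* (r F.* r′)) (p F.* r′ F.+ r F.* p′ F.+ T F.* (r F.* r′))
  κ-* p r p′ r′ = begin
    κ p r * κ p′ r′
      ≈⟨ solve 5 (λ P R P′ R′ X → (P :+ R :* X) :* (P′ :+ R′ :* X) := (P :* P′ :+ (P :* R′ :+ R :* P′) :* X) :+ R :* R′ :* (X :* X))
         E′.refl (ι p) (ι r) (ι p′) (ι r′) x ⟩
    (ι p * ι p′ + (ι p * ι r′ + ι r * ι p′) * x) + ι r * ι r′ * (x * x) ≈⟨ E′.+-congˡ (E′.*-congˡ x²≈) ⟩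
    (ι p * ι p′ + (ι p * ι r′ + ι r * ι p′) * x) + ι r * ι r′ * (ι T * x - ι D)
      ≈⟨ solve 7 (λ P R P′ R′ X t d → (P :* P′ :+ (P :* R′ :+ R :* P′) :* X) :+ R :* R′ :* (t :* X :- d)
           := (P :* P′ :- d :* (R :* R′)) :+ (P :* R′ :+ R :* P′ :+ t :* (R :* R′)) :* X)
         E′.refl (ι p) (ι r) (ι p′) (ι r′) x (ι T) (ι D) ⟩
    (ι p * ι p′ - ι D * (ι r * ι r′)) + (ι p * ι r′ + ι r * ι p′ + ι T * (ι r * ι r′)) * x
      ≈⟨ E′.+-cong (E′.sym ι-p) (E′.*-congʳ (E′.sym ι-r)) ⟩
    κ _ _ ∎
    where
    open import Relation.Binary.Reasoning.Setoid E′.setoid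
    ι-triple : ∀ d → ι (d F.* (r F.* r′)) ≈ ι d * (ι r * ι r′)
    ι-triple d = E′.trans (*-homo _ _) (E′.*-congˡ (*-homo _ _))
    ι-p : ι (p F.* p′ F.- D F.* (r F.* r′)) ≈ ι p * ι p′ - ι D * (ι r * ι r′)
    ι-p = E′.trans (+-homo _ _) (E′.+-cong (*-homo _ _) (E′.trans (-‿homo _) (E′.-‿cong (ι-triple D))))
    ι-r : ι (p F.* r′ F.+ r F.* p′ F.+ T F.* (r F.* r′)) ≈ ι p * ι r′ + ι r * ι p′ + ι T * (ι r * ι r′)
    ι-r = E′.trans (+-homo _ _) (E′.+-cong (E′.trans (+-homo _ _) (E′.+-cong (*-homo _ _) (*-homo _ _))) (ι-triple T))

  private
    2ℤ* : ∀ i → e-as-ℤ ℤ.* i ≡ i ℤ.+ i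
    2ℤ* i = ≡.trans (≡.cong (λ n → + n ℤ.* i) e≡2) (≡.trans (ℤ.suc-* (+ 1) i) (≡.cong (λ z → i ℤ.+ z) (ℤ.*-identityˡ i)))

    halve : ∀ {k i} → k ℤ.+ k ℤ.≤ i ℤ.+ i ℤ.+ + 1 → k ℤ.≤ i
    halve {k} {i} h with k ℤ.≤? i
    ... | yes p = p
    ... | no ¬p = ⊥-elim (ℤ.<-irrefl ≡.refl (ℤ.suc[i]≤j⇒i<j {i ℤ.+ i ℤ.+ + 1}
          (ℤ.≤-trans (ℤ.≤-trans (ℤ.≤-reflexive rearrange) (ℤ.+-mono-≤ i<k i<k)) h)))
      where
      i<k = ℤ.i<j⇒suc[i]≤j (ℤ.≰⇒> ¬p)
      rearrange : + 1 ℤ.+ (i ℤ.+ i ℤ.+ + 1) ≡ (+ 1 ℤ.+ i) ℤ.+ (+ 1 ℤ.+ i)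
      rearrange = ≡.trans (≡.cong (λ z → + 1 ℤ.+ z) (≡.trans (ℤ.+-assoc i i (+ 1)) (≡.cong (λ z → i ℤ.+ z) (ℤ.+-comm i (+ 1)))))
        (≡.sym (ℤ.+-assoc (+ 1) i (+ 1 ℤ.+ i)))

    module _ (k : ℕ) where
      ι-even : ∀ {z} → [ + (k ℕ.+ k) ] ≤∞ Maybe.map (e-as-ℤ ℤ.*_) z → [ + k ] ≤∞ z
      ι-even {nothing} _ = _ ≤∞⊤
      ι-even {just i} (fin≤ h) = fin≤ (halve (ℤ.≤-trans (≡.subst (+ (k ℕ.+ k) ℤ.≤_) (2ℤ* i) h) (ℤ.i≤i+j (i ℤ.+ i) (+ 1))))

      ιx-even : ∀ {z} → [ + (k ℕ.+ k) ] ≤∞ Maybe.map (λ i → e-as-ℤ ℤ.* i ℤ.+ + 1) z → [ + k ] ≤∞ z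
      ιx-even {nothing} _ = _ ≤∞⊤
      ιx-even {just i} (fin≤ h) = fin≤ (halve (≡.subst (λ z → + (k ℕ.+ k) ℤ.≤ z ℤ.+ + 1) (2ℤ* i) h))

      ι-odd : ∀ {z} → [ + suc (k ℕ.+ k) ] ≤∞ Maybe.map (e-as-ℤ ℤ.*_) z → [ + suc k ] ≤∞ z
      ι-odd {nothing} _ = _ ≤∞⊤
      ι-odd {just i} (fin≤ h) = fin≤ (halve (≡.subst₂ ℤ._≤_
        (≡.cong +_ (≡.trans (ℕ.+-comm (suc (k ℕ.+ k)) 1) (≡.sym (≡.cong suc (ℕ.+-suc k k)))))
        (≡.cong (ℤ._+ + 1) (2ℤ* i)) (ℤ.+-monoˡ-≤ (+ 1) h)))

      even-ι : ∀ {z} → [ + k ] ≤∞ z → [ + (k ℕ.+ k) ] ≤∞ Maybe.map (e-as-ℤ ℤ.*_) z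
      even-ι {nothing} _ = _ ≤∞⊤
      even-ι {just i} (fin≤ h) = fin≤ (≡.subst (+ (k ℕ.+ k) ℤ.≤_) (≡.sym (2ℤ* i)) (ℤ.+-mono-≤ h h))

      odd-ιx : ∀ {z} → [ + k ] ≤∞ z → [ + suc (k ℕ.+ k) ] ≤∞ Maybe.map (λ i → e-as-ℤ ℤ.* i ℤ.+ + 1) z
      odd-ιx {nothing} _ = _ ≤∞⊤
      odd-ιx {just i} (fin≤ h) = fin≤ (≡.subst₂ ℤ._≤_ (≡.cong +_ (ℕ.+-comm (k ℕ.+ k) 1)) (≡.cong (ℤ._+ + 1) (≡.sym (2ℤ* i)))
        (ℤ.+-monoˡ-≤ (+ 1) (ℤ.+-mono-≤ h h)))

  module _ {p r : F.Carrier} (k : ℕ) where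
    -- Since e = 2, the valuation of `κ p r` is min(2 v(p), 2 v(r) + 1). The four lemmas are this
    -- formula, read at even and odd exponents in both directions.
    κ-even⁻¹ : κ p r VE.∈π^ (k ℕ.+ k) → p VF.∈π^ k × r VF.∈π^ k
    κ-even⁻¹ h = let (hp , hr) = κ-split h in
      ι-even k (≡.subst ([ _ ] ≤∞_) (v-ι-map p) hp) , ιx-even k (≡.subst ([ _ ] ≤∞_) (v-ιx-map r) hr)

    κ-odd⁻¹ : κ p r VE.∈π^ suc (k ℕ.+ k) → p VF.∈π^ suc k × r VF.∈π^ k
    κ-odd⁻¹ h = let (hp , hr) = κ-split h in
      ι-odd k (≡.subst ([ _ ] ≤∞_) (v-ι-map p) hp) ,
      ιx-even k (≡.subst ([ _ ] ≤∞_) (v-ιx-map r) (VE.≤v-weaken (ℤ.+≤+ (ℕ.n≤1+n _)) hr))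

    κ-odd : p VF.∈π^ suc k → r VF.∈π^ k → κ p r VE.∈π^ suc (k ℕ.+ k)
    κ-odd hp hr = VE.≤v-+
      (VE.≤v-weaken (ℤ.+≤+ (s≤s (ℕ.+-monoʳ-≤ k (ℕ.n≤1+n k)))) (≡.subst ([ _ ] ≤∞_) (≡.sym (v-ι-map p)) (even-ι (suc k) hp)))
      (≡.subst ([ _ ] ≤∞_) (≡.sym (v-ιx-map r)) (odd-ιx k hr))

    κ-even : p VF.∈π^ k → r VF.∈π^ k → κ p r VE.∈π^ (k ℕ.+ k)
    κ-even hp hr = VE.≤v-+ (≡.subst ([ _ ] ≤∞_) (≡.sym (v-ι-map p)) (even-ι k hp))
      (VE.≤v-weaken (ℤ.+≤+ (ℕ.n≤1+n _)) (≡.subst ([ _ ] ≤∞_) (≡.sym (v-ιx-map r)) (odd-ιx k hr)))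

-- Coordinates on F × E′

module Coordinates {c ℓ} (setting : QuadraticSetting c ℓ) where
  open QuadraticSetting setting public
  open Extension ext public using (ι)
  open Product ext public
  open RamifiedQuadratic setting public
  module E = CommutativeRing E
  module F = LocalField F
  module E′ = LocalField E′
  module VE = Valuation E′.discretelyValuedField
  open LocalField F public using (Carrier; _≈_; _+_; _*_; -_; _-_; 0#; 1#; _^_; 𝒪; refl; sym; trans; reflexive;
    +-cong; +-congˡ; +-congʳ; *-cong; *-congˡ; *-congʳ; -‿cong; +-identityˡ; -‿inverseʳ;
    *-assoc; *-comm; *-identityˡ; *-identityʳ; zeroˡ; zeroʳ; distribˡ; distribʳ)
  open Valuation F.discretelyValuedField public
  open Uniformized π π-uniformizer public
  open IntegerCoefficients F.commutativeRing public

  ε : Carrier → Carrier → Carrier → E.Carrier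
  ε u p r = u , κ p r

  ε-cong : ∀ {u u′ p p′ r r′} → u ≈ u′ → p ≈ p′ → r ≈ r′ → ε u p r E.≈ ε u′ p′ r′
  ε-cong u≈ p≈ r≈ = u≈ , κ-cong p≈ r≈

  ε-injective : ∀ {u u′ p p′ r r′} → ε u p r E.≈ ε u′ p′ r′ → u ≈ u′ × p ≈ p′ × r ≈ r′
  ε-injective (u≈ , κ≈) = u≈ , κ-injective κ≈

  ε-surjective : ∀ y → ∃₂ λ u p → ∃ λ r → y E.≈ ε u p r
  ε-surjective (u , e) = let (p , r , e≈) = κ-surjective e in u , p , r , refl , e≈

  ε-+ : ∀ u p r u′ p′ r′ → ε u p r E.+ ε u′ p′ r′ E.≈ ε (u + u′) (p + p′) (r + r′)
  ε-+ u p r u′ p′ r′ = refl , κ-+ p r p′ r′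

  ε-* : ∀ u p r u′ p′ r′ → ε u p r E.* ε u′ p′ r′ E.≈
        ε (u * u′) (p * p′ - D * (r * r′)) (p * r′ + r * p′ + T * (r * r′))
  ε-* u p r u′ p′ r′ = refl , κ-* p r p′ r′

  κ-ι : ∀ a → ι a E′.≈ κ a 0#
  κ-ι a = E′.sym (E′.trans (E′.+-congˡ (E′.trans (E′.*-congʳ 0#-homo) (E′.zeroˡ x))) (E′.+-identityʳ _))

  Δ-ε : ∀ a → Δ a E.≈ ε a a 0#
  Δ-ε a = refl , κ-ι a

  ε-0 : E.0# E.≈ ε 0# 0# 0#
  ε-0 = refl , E′.trans (E′.sym 0#-homo) (κ-ι 0#)

  ε-1 : E.1# E.≈ ε 1# 1# 0#
  ε-1 = refl , E′.trans (E′.sym 1#-homo) (κ-ι 1#)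

  ε-scale : ∀ t u p r → Δ t E.* ε u p r E.≈ ε (t * u) (t * p) (t * r)
  ε-scale t u p r = E.trans (E.*-congʳ {ε u p r} {Δ t} (Δ-ε t)) (E.trans (ε-* t t 0# u p r) (ε-cong refl
    (solve 4 (λ t p r D → t :* p :- D :* (:0 :* r) := t :* p) refl t p r D)
    (solve 4 (λ t p r T → t :* r :+ :0 :* p :+ T :* (:0 :* r) := t :* r) refl t p r T)))

  𝒪E-ε : ∀ {u p r} → 𝒪 u → 𝒪 p → 𝒪 r → 𝒪E (ε u p r)
  𝒪E-ε u∈ p∈ r∈ = u∈ , κ-even 0 p∈ r∈

  𝒪E-ε⁻¹ : ∀ {u p r} → 𝒪E (ε u p r) → 𝒪 u × 𝒪 p × 𝒪 r
  𝒪E-ε⁻¹ (u∈ , e∈) = u∈ , κ-even⁻¹ 0 e∈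

  module 𝔬-Submodule {S : Subset} (isSubmodule : IsSubmodule Δ𝔬 S) where
    open IsSubmodule isSubmodule

    S-resp : ∀ {u u′ p p′ r r′} → u ≈ u′ → p ≈ p′ → r ≈ r′ → S (ε u p r) → S (ε u′ p′ r′)
    S-resp u≈ p≈ r≈ = resp (ε-cong u≈ p≈ r≈)

    S-* : ∀ {t u p r} → 𝒪 t → S (ε u p r) → S (ε (t * u) (t * p) (t * r))
    S-* {t} t∈ s = resp (ε-scale t _ _ _) (*-closed (t , t∈ , E.refl {Δ t}) s)

    S-+ : ∀ {u p r u′ p′ r′} → S (ε u p r) → S (ε u′ p′ r′) → S (ε (u + u′) (p + p′) (r + r′))
    S-+ s s′ = resp (ε-+ _ _ _ _ _ _) (+-closed s s′)

    S-+* : ∀ {t u p r u′ p′ r′} → 𝒪 t → S (ε u p r) → S (ε u′ p′ r′) → S (ε (u + t * u′) (p + t * p′) (r + t * r′))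
    S-+* t∈ s s′ = S-+ s (S-* t∈ s′)

    S-sub* : ∀ {t u p r u′ p′ r′} → 𝒪 t → S (ε u p r) → S (ε u′ p′ r′) → S (ε (u - t * u′) (p - t * p′) (r - t * r′))
    S-sub* {t} t∈ s s′ = S-resp (lemma _ _) (lemma _ _) (lemma _ _) (S-+* (≤v-neg t∈) s s′)
      where
      lemma : ∀ a b → a + (- t) * b ≈ a - t * b
      lemma a b = solve 3 (λ a b t → a :+ (:- t) :* b := a :- t :* b) refl a b t

  abstract
    π⁻_ : ℕ → Carrier
    π⁻ n = proj₁ (inverse (v-π^ n))

    π^*π⁻ : ∀ n → π ^ n * π⁻ n ≈ 1#
    π^*π⁻ n = proj₁ (proj₂ (inverse (v-π^ n)))

  *π⁻*π^ : ∀ n a → a * π⁻ n * π ^ n ≈ a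
  *π⁻*π^ n a = trans (*-assoc a _ _) (trans (*-congˡ (trans (*-comm _ _) (π^*π⁻ n))) (*-identityʳ a))

  T[_] D[_] : ℕ → Carrier
  T[ m ] = T * π ^ m
  D[ m ] = D * (π ^ m * π ^ m)

  -- The norm of π^m x - β.
  norm : ℕ → Carrier → Carrier
  norm m β = β * β - β * T[ m ] + D[ m ]

  T[]∈ : ∀ m → T[ m ] ∈π^ suc m
  T[]∈ m = ∈-* T∈ (π^∈ m)

  D[]∈ : ∀ m → D[ m ] ∈π^ suc (m ℕ.+ m)
  D[]∈ m = ∈-* D∈ (∈-* (π^∈ m) (π^∈ m))

  -- The order 𝔬 (1, 1) + 0 × N, where N is spanned by π^a and π^m x - β (an order if π^a divides the norm) ...
  record Over (m a : ℕ) (β : Carrier) (y : E.Carrier) : Set (c ⊔ ℓ) where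
    constructor over
    field
      u p w : Carrier
      y≈    : y E.≈ ε u p (w * π ^ m)
      u∈    : 𝒪 u
      w∈    : 𝒪 w
      p∈    : p - u + w * β ∈π^ a

  -- ... and its dual, scaled so as to be integral.
  record Dual (m a : ℕ) (β : Carrier) (y : E.Carrier) : Set (c ⊔ ℓ) where
    constructor dual
    field
      u p w : Carrier
      y≈    : y E.≈ ε u p (w * π ^ m)
      u∈    : 𝒪 u
      p∈    : p + u * (T[ m ] - β) ∈π^ a
      w∈    : w - u ∈π^ a

  module _ {m a : ℕ} {β : Carrier} where
    Over-intro : ∀ {u p r w} → r ≈ w * π ^ m → 𝒪 u → 𝒪 w → (p - u + w * β) ∈π^ a → Over m a β (ε u p r)
    Over-intro r≈ u∈ w∈ h = over _ _ _ (ε-cong refl refl r≈) u∈ w∈ h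

    Over-elim : ∀ {u p r} → Over m a β (ε u p r) → 𝒪 u × ∃ λ w → r ≈ w * π ^ m × 𝒪 w × (p - u + w * β) ∈π^ a
    Over-elim (over u′ p′ w y≈ u∈ w∈ h) = let (u≈ , p≈ , r≈) = ε-injective y≈ in
      ≤v-cong (sym u≈) u∈ , w , r≈ , w∈ , ≤v-cong (+-congʳ (+-cong (sym p≈) (-‿cong (sym u≈)))) h

    Dual-intro : ∀ {u p r w} → r ≈ w * π ^ m → 𝒪 u → (p + u * (T[ m ] - β)) ∈π^ a → (w - u) ∈π^ a → Dual m a β (ε u p r)
    Dual-intro r≈ u∈ h h′ = dual _ _ _ (ε-cong refl refl r≈) u∈ h h′

    Dual-elim : ∀ {u p r} → Dual m a β (ε u p r) →
                𝒪 u × ∃ λ w → r ≈ w * π ^ m × (p + u * (T[ m ] - β)) ∈π^ a × (w - u) ∈π^ a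
    Dual-elim (dual u′ p′ w y≈ u∈ h h′) = let (u≈ , p≈ , r≈) = ε-injective y≈ in
      ≤v-cong (sym u≈) u∈ , w , r≈ , ≤v-cong (+-cong (sym p≈) (*-congʳ (sym u≈))) h ,
      ≤v-cong (+-congˡ (-‿cong (sym u≈))) h′

    Over-1 : Over m a β (ε 1# 1# 0#)
    Over-1 = Over-intro (sym (zeroˡ (π ^ m))) 𝒪-1 ≤v-0
      (≤v-cong (solve 1 (λ β → :0 := :1 :- :1 :+ :0 :* β) refl β) ≤v-0)

    Over-π^ : Over m a β (ε 0# (π ^ a) 0#)
    Over-π^ = Over-intro (sym (zeroˡ (π ^ m))) ≤v-0 ≤v-0
      (≤v-cong (solve 2 (λ z β → z := z :- :0 :+ :0 :* β) refl (π ^ a) β) (π^∈ a))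

    Over-θ : Over m a β (ε 0# (- β) (π ^ m))
    Over-θ = Over-intro (sym (*-identityˡ (π ^ m))) ≤v-0 𝒪-1
      (≤v-cong (solve 1 (λ β → :0 := :- β :- :0 :+ :1 :* β) refl β) ≤v-0)

    Dual-1 : Dual m a β (ε 1# (- (T[ m ] - β)) (π ^ m))
    Dual-1 = Dual-intro (sym (*-identityˡ (π ^ m))) 𝒪-1
      (≤v-cong (solve 1 (λ τ → :0 := :- τ :+ :1 :* τ) refl (T[ m ] - β)) ≤v-0)
      (≤v-cong (solve 0 (:0 := :1 :- :1) refl) ≤v-0)

    Dual-π^ : Dual m a β (ε 0# (π ^ a) 0#)
    Dual-π^ = Dual-intro (sym (zeroˡ (π ^ m))) ≤v-0
      (≤v-cong (solve 2 (λ z τ → z := z :+ :0 :* τ) refl (π ^ a) (T[ m ] - β)) (π^∈ a))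
      (≤v-cong (solve 0 (:0 := :0 :- :0) refl) ≤v-0)

    Dual-π^x : Dual m a β (ε 0# 0# (π ^ a * π ^ m))
    Dual-π^x = Dual-intro refl ≤v-0
      (≤v-cong (solve 1 (λ τ → :0 := :0 :+ :0 :* τ) refl (T[ m ] - β)) ≤v-0)
      (≤v-cong (solve 1 (λ z → z := z :- :0) refl (π ^ a)) (π^∈ a))

    Over-resp : Over m a β Respects E._≈_
    Over-resp y≈z (over u p w y≈ u∈ w∈ h) = over u p w (E.trans (E.sym y≈z) y≈) u∈ w∈ h

    Dual-resp : Dual m a β Respects E._≈_
    Dual-resp y≈z (dual u p w y≈ u∈ h h′) = dual u p w (E.trans (E.sym y≈z) y≈) u∈ h h′

    Over-0 : Over m a β E.0#
    Over-0 = Over-resp (E.sym ε-0) (Over-intro (sym (zeroˡ _)) ≤v-0 ≤v-0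
      (≤v-cong (solve 1 (λ β → :0 := :0 :- :0 :+ :0 :* β) refl β) ≤v-0))

    Dual-0 : Dual m a β E.0#
    Dual-0 = Dual-resp (E.sym ε-0) (Dual-intro (sym (zeroˡ _)) ≤v-0
      (≤v-cong (solve 1 (λ β → :0 := :0 :+ :0 :* β) refl (T[ m ] - β)) ≤v-0)
      (≤v-cong (solve 0 (:0 := :0 :- :0) refl) ≤v-0))

    Over-+ : ∀ {y z} → Over m a β y → Over m a β z → Over m a β (y E.+ z)
    Over-+ (over u p w y≈ u∈ w∈ h) (over u′ p′ w′ z≈ u′∈ w′∈ h′) = over (u + u′) (p + p′) (w + w′)
      (E.trans (E.+-cong y≈ z≈) (E.trans (ε-+ _ _ _ _ _ _) (ε-cong refl refl (sym (distribʳ _ _ _)))))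
      (≤v-+ u∈ u′∈) (≤v-+ w∈ w′∈)
      (≤v-cong (solve 7 (λ u p w u′ p′ w′ β → (p :- u :+ w :* β) :+ (p′ :- u′ :+ w′ :* β)
        := (p :+ p′) :- (u :+ u′) :+ (w :+ w′) :* β) refl u p w u′ p′ w′ β) (≤v-+ h h′))

    Dual-+ : ∀ {y z} → Dual m a β y → Dual m a β z → Dual m a β (y E.+ z)
    Dual-+ (dual u p w y≈ u∈ h k) (dual u′ p′ w′ z≈ u′∈ h′ k′) = dual (u + u′) (p + p′) (w + w′)
      (E.trans (E.+-cong y≈ z≈) (E.trans (ε-+ _ _ _ _ _ _) (ε-cong refl refl (sym (distribʳ _ _ _)))))
      (≤v-+ u∈ u′∈)
      (≤v-cong (solve 5 (λ u p u′ p′ β → (p :+ u :* β) :+ (p′ :+ u′ :* β)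
        := (p :+ p′) :+ (u :+ u′) :* β) refl u p u′ p′ (T[ m ] - β)) (≤v-+ h h′))
      (≤v-cong (solve 4 (λ u w u′ w′ → (w :- u) :+ (w′ :- u′) := (w :+ w′) :- (u :+ u′)) refl u w u′ w′) (≤v-+ k k′))

    private
      r-coordinate : ∀ p w p′ w′ → p * (w′ * π ^ m) + (w * π ^ m) * p′ + T * ((w * π ^ m) * (w′ * π ^ m))
                     ≈ (p * w′ + w * p′ + T[ m ] * (w * w′)) * π ^ m
      r-coordinate p w p′ w′ = solve 6 (λ p w p′ w′ z T → p :* (w′ :* z) :+ (w :* z) :* p′ :+ T :* ((w :* z) :* (w′ :* z))
        := (p :* w′ :+ w :* p′ :+ (T :* z) :* (w :* w′)) :* z) refl p w p′ w′ (π ^ m) T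

    p-integral : ∀ {u p w} → 𝒪 β → 𝒪 u → 𝒪 w → (p - u + w * β) ∈π^ a → 𝒪 p
    p-integral {u} {p} {w} β∈ u∈ w∈ h = ≤v-cong
      (solve 4 (λ u p w β → (p :- u :+ w :* β) :+ u :- w :* β := p) refl u p w β)
      (≤v-sub (≤v-+ (∈⇒𝒪 h) u∈) (∈-*ˡ w∈ β∈))

    -- The congruence says that π^m x ↦ β sends the second coordinate to the first modulo π^a.
    -- Products respect it because β is a root of the minimal polynomial of π^m x modulo π^a; the
    -- term subtracted with the factor `w * w′` is the multiple of that polynomial.
    Over-* : ∀ {y z} → 𝒪 β → norm m β ∈π^ a → Over m a β y → Over m a β z → Over m a β (y E.* z)
    Over-* {y} {z} β∈ N∈ (over u p w y≈ u∈ w∈ h) (over u′ p′ w′ z≈ u′∈ w′∈ h′) =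
      Over-resp (E.sym (E.trans (E.*-cong y≈ z≈) (ε-* _ _ _ _ _ _)))
        (Over-intro (r-coordinate p w p′ w′) (∈-*ˡ u∈ u′∈)
          (≤v-+ (≤v-+ (∈-*ˡ p∈′ w′∈) (∈-*ˡ w∈ (p-integral β∈ u′∈ w′∈ h′))) (∈-*ˡ (∈⇒𝒪 (T[]∈ m)) (∈-*ˡ w∈ w′∈)))
          (≤v-cong (solve 10 (λ u p w u′ p′ w′ β T D z →
              (p :- u :+ w :* β) :* (u′ :+ (p′ :- u′ :+ w′ :* β)) :+ u :* (p′ :- u′ :+ w′ :* β)
                :- (w :* w′) :* (β :* β :- β :* (T :* z) :+ D :* (z :* z))
              := p :* p′ :- D :* ((w :* z) :* (w′ :* z)) :- u :* u′ :+ (p :* w′ :+ w :* p′ :+ (T :* z) :* (w :* w′)) :* β)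
              refl u p w u′ p′ w′ β T D (π ^ m))
            (≤v-sub (≤v-+ (∈-*ʳ h (≤v-+ u′∈ (∈⇒𝒪 h′))) (∈-*ˡ u∈ h′)) (∈-*ˡ (∈-*ˡ w∈ w′∈) N∈))))
      where p∈′ = p-integral β∈ u∈ w∈ h

    -- Modulo π^a R_m the second coordinates of the dual are the multiples of θ̄, on which π^m x
    -- acts as β because θ θ̄ is the norm. An element of the order with first coordinate `u`
    -- therefore acts on them as `u`, just as it does on the first coordinate.
    Over-*-Dual : ∀ {y z} → 𝒪 β → norm m β ∈π^ a → Over m a β y → Dual m a β z → Dual m a β (y E.* z)
    Over-*-Dual β∈ N∈ (over u p w y≈ u∈ w∈ h) (dual u′ p′ w′ z≈ u′∈ h′ k′) =
      Dual-resp (E.sym (E.trans (E.*-cong y≈ z≈) (ε-* _ _ _ _ _ _)))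
        (Dual-intro (r-coordinate p w p′ w′) (∈-*ˡ u∈ u′∈)
          (≤v-cong (solve 10 (λ u p w u′ p′ w′ β T D z →
              p :* (p′ :+ u′ :* (T :* z :- β)) :- (p :- u :+ w :* β) :* (u′ :* (T :* z :- β))
                :- (D :* (z :* z)) :* (w :* (w′ :- u′)) :- (w :* u′) :* (β :* β :- β :* (T :* z) :+ D :* (z :* z))
              := p :* p′ :- D :* ((w :* z) :* (w′ :* z)) :+ (u :* u′) :* (T :* z :- β))
              refl u p w u′ p′ w′ β T D (π ^ m))
            (≤v-sub (≤v-sub (≤v-sub (∈-*ˡ (p-integral β∈ u∈ w∈ h) h′) (∈-*ʳ h (∈-*ˡ u′∈ (≤v-sub (∈⇒𝒪 (T[]∈ m)) β∈))))
                   (∈-*ˡ (∈⇒𝒪 (D[]∈ m)) (∈-*ˡ w∈ k′))) (∈-*ˡ (∈-*ˡ w∈ u′∈) N∈)))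
          (≤v-cong (solve 8 (λ u p w u′ p′ w′ β T →
              p :* (w′ :- u′) :+ (p :- u :+ w :* β) :* u′ :+ w :* (p′ :+ u′ :* (T :- β)) :+ (T :* w) :* (w′ :- u′)
              := p :* w′ :+ w :* p′ :+ T :* (w :* w′) :- u :* u′)
              refl u p w u′ p′ w′ β T[ m ])
            (≤v-+ (≤v-+ (≤v-+ (∈-*ˡ (p-integral β∈ u∈ w∈ h) k′) (∈-*ʳ h u′∈)) (∈-*ˡ w∈ h′))
                  (∈-*ˡ (∈-*ˡ (∈⇒𝒪 (T[]∈ m)) w∈) k′))))

    Over-scale : ∀ {y z} → Δ𝔬 y → Over m a β z → Over m a β (y E.* z)
    Over-scale {y} {z} (t , t∈ , y≈) (over u p w z≈ u∈ w∈ h) =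
      Over-resp {ε (t * u) (t * p) (t * (w * π ^ m))} {y E.* z}
        (E.sym {y E.* z} {ε (t * u) (t * p) (t * (w * π ^ m))} (E.trans {y E.* z} {Δ t E.* ε u p (w * π ^ m)} (E.*-cong {y} {Δ t} {z} y≈ z≈) (ε-scale t u p (w * π ^ m))))
        (Over-intro (sym (*-assoc t w _)) (∈-*ˡ t∈ u∈) (∈-*ˡ t∈ w∈)
          (≤v-cong (solve 5 (λ t u p w β → t :* (p :- u :+ w :* β) := t :* p :- t :* u :+ (t :* w) :* β) refl t u p w β)
            (∈-*ˡ t∈ h)))

    Over-𝔬-submodule : IsSubmodule Δ𝔬 (Over m a β)
    Over-𝔬-submodule = record { resp = Over-resp ; 0∈ = Over-0 ; +-closed = Over-+ ; *-closed = Over-scale }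

    Over⊆𝒪E : 𝒪 β → Over m a β ⊆ 𝒪E
    Over⊆𝒪E β∈ (over u p w y≈ u∈ w∈ h) =
      let (u∈′ , e∈) = 𝒪E-ε u∈ (p-integral β∈ u∈ w∈ h) (∈-*ˡ w∈ (∈⇒𝒪 (π^∈ m)))
      in ≤v-cong (sym (proj₁ y≈)) u∈′ , VE.≤v-cong (E′.sym (proj₂ y≈)) e∈

  -- As π^b x is π^(b-m) times π^m x, the evaluation that defines the larger order sends it to
  -- π^(b-m) β, which has to agree with `c` modulo π^a.
  Over-⊆ : ∀ {b f c m a β} → m ℕ.≤ b → a ℕ.≤ f → (π ^ (b ℕ.∸ m) * β - c) ∈π^ a → Over b f c ⊆ Over m a β
  Over-⊆ {b} {f} {c} {m} {a} {β} m≤b a≤f h (over u p w y≈ u∈ w∈ k) = Over-resp (E.sym y≈)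
    (Over-intro
      (trans (*-congˡ (trans (reflexive (≡.cong (π ^_) (≡.sym (ℕ.m∸n+n≡m m≤b)))) (π^-+ (b ℕ.∸ m) m)))
        (sym (*-assoc w _ _)))
      u∈ (∈-*ˡ w∈ (∈⇒𝒪 (π^∈ (b ℕ.∸ m))))
      (≤v-cong (solve 6 (λ u p w c β z → (p :- u :+ w :* c) :+ w :* (z :* β :- c) := p :- u :+ (w :* z) :* β)
          refl u p w c β (π ^ (b ℕ.∸ m)))
        (≤v-+ (∈-weaken a≤f k) (∈-*ˡ w∈ h))))

-- The two families of lattices as fractional ideals

module Ideals {c ℓ} (setting : QuadraticSetting c ℓ) where
  open Coordinates setting
  open Algebra.Properties.Semiring.Sum E.semiring using (sum)

  sum-closed : ∀ {a} (P : Pred E.Carrier a) → P E.0# → (∀ y z → P y → P z → P (y E.+ z)) →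
               ∀ n (t : Fin n → E.Carrier) → (∀ i → P (t i)) → P (sum t)
  sum-closed P 0∈ +∈ zero t ts = 0∈
  sum-closed P 0∈ +∈ (suc n) t ts = +∈ (t fzero) (sum (t ∘ fsuc)) (ts fzero) (sum-closed P 0∈ +∈ n (t ∘ fsuc) (ts ∘ fsuc))

  combination-closed : ∀ {A S n} {g : Fin n → E.Carrier} → IsSubmodule A S → (∀ i → S (g i)) → Combinations A g ⊆ S
  combination-closed {A} {S} {n} {g} isSubmodule gs {y} (a , as , y≈) =
    resp (E.sym {y} {sum (λ i → a i E.* g i)} y≈)
      (sum-closed S 0∈ (λ y z → +-closed {y} {z}) n (λ i → a i E.* g i) (λ i → *-closed {a i} {g i} (as i) (gs i)))
    where open IsSubmodule isSubmodule

  triple : ∀ {a} {A : Set a} → A → A → A → Fin 3 → A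
  triple a₀ a₁ a₂ fzero = a₀
  triple a₀ a₁ a₂ (fsuc fzero) = a₁
  triple a₀ a₁ a₂ (fsuc (fsuc fzero)) = a₂

  sum-ε : ∀ s₀ s₁ s₂ u₀ p₀ r₀ u₁ p₁ r₁ u₂ p₂ r₂ →
          sum (λ i → Δ (triple s₀ s₁ s₂ i) E.* triple (ε u₀ p₀ r₀) (ε u₁ p₁ r₁) (ε u₂ p₂ r₂) i) E.≈
          ε (s₀ * u₀ + (s₁ * u₁ + s₂ * u₂)) (s₀ * p₀ + (s₁ * p₁ + s₂ * p₂)) (s₀ * r₀ + (s₁ * r₁ + s₂ * r₂))
  sum-ε s₀ s₁ s₂ u₀ p₀ r₀ u₁ p₁ r₁ u₂ p₂ r₂ =
    E.trans (E.+-cong (ε-scale s₀ u₀ p₀ r₀) (E.trans (E.+-cong (ε-scale s₁ u₁ p₁ r₁)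
      (E.trans (E.+-identityʳ _) (ε-scale s₂ u₂ p₂ r₂))) (ε-+ _ _ _ _ _ _))) (ε-+ _ _ _ _ _ _)

  module Generated {S : Subset} (resp : S Respects E._≈_) (g : Fin 3 → E.Carrier) (g∈ : ∀ i → S (g i)) where

    ideal : ∀ {R} → Δ𝔬 ⊆ R → IsSubmodule R S →
            (∀ {y} → S y → ∃ λ s → (∀ i → 𝒪 (s i)) × y E.≈ sum (λ i → Δ (s i) E.* g i)) →
            (∀ y → ∃ λ s → y E.≈ sum (λ i → Δ (s i) E.* g i)) → FractionalIdeal R
    ideal Δ𝔬⊆R isSubmodule generates spans = record
      { carrier = S
      ; isSubmodule = isSubmodule
      ; fg = 3 , g ,
          (λ s → let (t , t∈ , y≈) = generates s in
            (Δ ∘ t) , (λ i → Δ𝔬⊆R (t i , t∈ i , E.refl {Δ (t i)})) , y≈) ,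
          combination-closed isSubmodule g∈
      ; spans = λ y → let (t , y≈) = spans y in
          3 , g , g∈ , (Δ ∘ t) , (λ i → t i , E.refl {Δ (t i)}) , y≈
      }

  module _ {R : Subset} (isOrder : IsOrder R) {b f c} (R⊆ : R ⊆ Over b f c)
           {m a β} (β∈ : 𝒪 β) (m≤b : m ℕ.≤ b) (a≤f : a ℕ.≤ f) (compatible : (π ^ (b ℕ.∸ m) * β - c) ∈π^ a) where

    private
      R⊆Over : R ⊆ Over m a β
      R⊆Over y∈ = Over-⊆ m≤b a≤f compatible (R⊆ y∈)

    overIdeal : norm m β ∈π^ a → FractionalIdeal R
    overIdeal N∈ = Generated.ideal Over-resp g g∈ (IsOrder.𝔬⊆ isOrder)
      (record { resp = Over-resp ; 0∈ = Over-0 ; +-closed = Over-+ ; *-closed = λ r s → Over-* β∈ N∈ (R⊆Over r) s })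
      generates spans
      where
      g : Fin 3 → E.Carrier
      g = triple (ε 1# 1# 0#) (ε 0# (π ^ a) 0#) (ε 0# (- β) (π ^ m))

      g∈ : ∀ i → Over m a β (g i)
      g∈ fzero = Over-1
      g∈ (fsuc fzero) = Over-π^
      g∈ (fsuc (fsuc fzero)) = Over-θ

      -- The decomposition holds with coefficients in F: integral ones show generation over 𝔬, and
      -- those obtained by dividing by powers of π show that E is spanned.
      combine : ∀ {y u p w t} → y E.≈ ε u p (w * π ^ m) → p - u + w * β ≈ t * π ^ a →
                y E.≈ sum (λ i → Δ (triple u t w i) E.* g i)
      combine {y} {u} {p} {w} {t} y≈ eq = E.trans y≈ (E.trans
        (ε-cong
          (solve 3 (λ u t w → u := u :* :1 :+ (t :* :0 :+ w :* :0)) refl u t w)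
          (trans (solve 4 (λ u p w β → p := u :* :1 :+ ((p :- u :+ w :* β) :+ w :* :- β)) refl u p w β)
            (+-congˡ (+-congʳ eq)))
          (solve 4 (λ u t w z → w :* z := u :* :0 :+ (t :* :0 :+ w :* z)) refl u t w (π ^ m)))
        (E.sym (sum-ε u t w 1# 1# 0# 0# (π ^ a) 0# 0# (- β) (π ^ m))))

      generates : ∀ {y} → Over m a β y → ∃ λ s → (∀ i → 𝒪 (s i)) × y E.≈ sum (λ i → Δ (s i) E.* g i)
      generates (over u p w y≈ u∈ w∈ h) = let (t , t∈ , eq) = divide h in
        triple u t w , (λ { fzero → u∈ ; (fsuc fzero) → t∈ ; (fsuc (fsuc fzero)) → w∈ }) , combine y≈ eq

      spans : ∀ y → ∃ λ s → y E.≈ sum (λ i → Δ (s i) E.* g i)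
      spans y = let (u , p , r , y≈) = ε-surjective y in
        triple u ((p - u + r * π⁻ m * β) * π⁻ a) (r * π⁻ m) ,
        combine (E.trans y≈ (ε-cong refl refl (sym (*π⁻*π^ m r)))) (sym (*π⁻*π^ a _))

    dualIdeal : norm m β ∈π^ a → FractionalIdeal R
    dualIdeal N∈ = Generated.ideal Dual-resp g g∈ (IsOrder.𝔬⊆ isOrder)
      (record { resp = Dual-resp ; 0∈ = Dual-0 ; +-closed = Dual-+ ; *-closed = λ r s → Over-*-Dual β∈ N∈ (R⊆Over r) s })
      generates spans
      where
      τ = T[ m ] - β

      g : Fin 3 → E.Carrier
      g = triple (ε 1# (- τ) (π ^ m)) (ε 0# (π ^ a) 0#) (ε 0# 0# (π ^ a * π ^ m))

      g∈ : ∀ i → Dual m a β (g i)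
      g∈ fzero = Dual-1
      g∈ (fsuc fzero) = Dual-π^
      g∈ (fsuc (fsuc fzero)) = Dual-π^x

      combine : ∀ {y u p w t t′} → y E.≈ ε u p (w * π ^ m) → p + u * τ ≈ t * π ^ a → w - u ≈ t′ * π ^ a →
                y E.≈ sum (λ i → Δ (triple u t t′ i) E.* g i)
      combine {y} {u} {p} {w} {t} {t′} y≈ eq eq′ = E.trans y≈ (E.trans
        (ε-cong
          (solve 3 (λ u t w → u := u :* :1 :+ (t :* :0 :+ w :* :0)) refl u t t′)
          (trans (solve 4 (λ u p t′ τ → p := u :* (:- τ) :+ ((p :+ u :* τ) :+ t′ :* :0)) refl u p t′ τ)
            (+-congˡ (+-congʳ eq)))
          (trans (solve 4 (λ u t w z → w :* z := u :* z :+ (t :* :0 :+ (w :- u) :* z)) refl u t w (π ^ m))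
            (+-congˡ (+-congˡ (trans (*-congʳ eq′) (*-assoc _ _ _))))))
        (E.sym (sum-ε u t t′ 1# (- τ) (π ^ m) 0# (π ^ a) 0# 0# 0# (π ^ a * π ^ m))))

      generates : ∀ {y} → Dual m a β y → ∃ λ s → (∀ i → 𝒪 (s i)) × y E.≈ sum (λ i → Δ (s i) E.* g i)
      generates (dual u p w y≈ u∈ h k) = let (t , t∈ , eq) = divide h ; (t′ , t′∈ , eq′) = divide k in
        triple u t t′ , (λ { fzero → u∈ ; (fsuc fzero) → t∈ ; (fsuc (fsuc fzero)) → t′∈ }) , combine y≈ eq eq′

      spans : ∀ y → ∃ λ s → y E.≈ sum (λ i → Δ (s i) E.* g i)
      spans y = let (u , p , r , y≈) = ε-surjective y in
        triple u ((p + u * τ) * π⁻ a) ((r * π⁻ m - u) * π⁻ a) ,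
        combine (E.trans y≈ (ε-cong refl refl (sym (*π⁻*π^ m r)))) (sym (*π⁻*π^ a _)) (sym (*π⁻*π^ a _))

-- Normal forms

module NormalForms (em : ∀ {a} → ExcludedMiddle a) {c ℓ} (setting : QuadraticSetting c ℓ) where
  open Coordinates setting

  module _ {S : Subset} (isSubmodule : IsSubmodule Δ𝔬 S) where
    open 𝔬-Submodule isSubmodule

    least-∈π^ : ∀ {a z} → (∀ i → S (ε 0# (π ^ i) 0#) → a ℕ.≤ i) → 𝒪 z → S (ε 0# z 0#) → z ∈π^ a
    least-∈π^ minimal z∈ s = ∈-unless z∈ λ {i} {w} i<a w∈ zw →
      ℕ.<⇒≱ i<a (minimal i (S-resp (zeroʳ w) (trans (*-comm w _) zw) (zeroʳ w) (S-* w∈ s)))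

    module _ (1∈ : S (ε 1# 1# 0#)) where

      abstract
        -- Multiples of (1, 1) clear the coordinate `p`, so the projection is 𝔬 + π^m x 𝔬 for the
        -- least exponent m that occurs. The first coordinate `u` of the witness is kept because it
        -- becomes β.
        projection-form : ∀ {k} → (∀ {u p r} → S (ε u p r) → 𝒪 p × 𝒪 r) → S (ε 0# 0# (π ^ k)) →
          ∃ λ m → (∀ {u p r} → S (ε u p r) → r ∈π^ m) × ∃ λ u → S (ε u 0# (π ^ m))
        projection-form {k} integral full =
          let (m , (u₀ , s₀) , minimal) = least em (λ j → ∃ λ u → S (ε u 0# (π ^ j))) (k , 0# , full) in
          m , (λ s → r∈ m minimal s) , u₀ , s₀
          where
          r∈ : ∀ m → (∀ j → (∃ λ u → S (ε u 0# (π ^ j))) → m ℕ.≤ j) → ∀ {u p r} → S (ε u p r) → r ∈π^ m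
          r∈ m minimal {u} {p} {r} s = ∈-unless (proj₂ (integral s)) λ {i} {w} i<m w∈ rw →
            ℕ.<⇒≱ i<m (minimal i (_ , S-resp refl
              (solve 2 (λ w p → w :* (p :- p :* :1) := :0) refl w p)
              (trans (solve 3 (λ w p r → w :* (r :- p :* :0) := r :* w) refl w p r) rw)
              (S-* w∈ (S-sub* (proj₁ (integral s)) s 1∈))))

      private
        module Form {m a β} (integral : ∀ {u p r} → S (ε u p r) → 𝒪 u × 𝒪 p × r ∈π^ m)
            (β∈ : 𝒪 β) (θ∈ : S (ε 0# (- β) (π ^ m))) (πᵃ∈ : S (ε 0# (π ^ a) 0#))
            (∈πᵃ : ∀ {z} → S (ε 0# z 0#) → z ∈π^ a) where

          -- The relation π^m x θ = (T[m] - β) θ - norm shows that the norm lies in the kernel as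
          -- soon as π^m x θ does.
          norm∈ : S (ε 0# (- (D * (π ^ m * π ^ m))) (π ^ m * (- β) + T * (π ^ m * π ^ m))) → norm m β ∈π^ a
          norm∈ s = ≤v-cong (solve 4 (λ b T D z → :- (:- (D :* (z :* z)) :- (T :* z :- b) :* (:- b))
                := b :* b :- b :* (T :* z) :+ D :* (z :* z)) refl β T D (π ^ m))
            (≤v-neg (∈πᵃ (S-resp
              (solve 1 (λ t → :0 :- t :* :0 := :0) refl (T[ m ] - β))
              refl
              (solve 3 (λ b T z → (z :* (:- b) :+ T :* (z :* z)) :- (T :* z :- b) :* z := :0) refl β T (π ^ m))
              (S-sub* (≤v-sub (∈⇒𝒪 (T[]∈ m)) β∈) s θ∈))))

          S⊆Over : S ⊆ Over m a β
          S⊆Over {y} s =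
            let (u , p , r , y≈) = ε-surjective y
                s′ = IsSubmodule.resp isSubmodule y≈ s
                (u∈ , p∈ , r∈) = integral s′
                (w , w∈ , r≈) = divide r∈
            in Over-resp (E.sym y≈) (Over-intro r≈ u∈ w∈ (∈πᵃ (S-resp
              (solve 2 (λ u w → (u :- u :* :1) :- w :* :0 := :0) refl u w)
              (solve 4 (λ u p w b → (p :- u :* :1) :- w :* (:- b) := p :- u :+ w :* b) refl u p w β)
              (trans (+-congʳ (+-congʳ r≈))
                (solve 3 (λ u w z → (w :* z :- u :* :0) :- w :* z := :0) refl u w (π ^ m)))
              (S-sub* w∈ (S-sub* u∈ s′ 1∈) θ∈))))

          Over⊆S : Over m a β ⊆ S
          Over⊆S (over u p w y≈ u∈ w∈ h) =
            let (t , t∈ , eq) = divide h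
            in IsSubmodule.resp isSubmodule (E.sym y≈) (S-resp
              (solve 3 (λ u w t → (u :* :1 :+ w :* :0) :+ t :* :0 := u) refl u w t)
              (trans (+-congˡ (sym eq))
                (solve 4 (λ u p w b → (u :* :1 :+ w :* (:- b)) :+ (p :- u :+ w :* b) := p) refl u p w β))
              (solve 4 (λ u w t z → (u :* :0 :+ w :* z) :+ t :* :0 := w :* z) refl u w t (π ^ m))
              (S-+* t∈ (S-+* w∈ (S-* u∈ 1∈) θ∈) πᵃ∈))

      abstract
        -- The first coordinate of an element above π^m x serves as β: subtracting β (1, 1) leaves θ
        -- in the kernel.
        over-form : ∀ {m k u₀} → (∀ {u p r} → S (ε u p r) → 𝒪 u × 𝒪 p × r ∈π^ m) → S (ε u₀ 0# (π ^ m)) →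
          (∀ {p r} → S (ε 0# p r) → S (ε 0# (- (D * (π ^ m * r))) (π ^ m * p + T * (π ^ m * r)))) →
          S (ε 0# (π ^ k) 0#) →
          ∃₂ λ a β → 𝒪 β × norm m β ∈π^ a × S (ε 0# (π ^ a) 0#) × S ≐ Over m a β
        over-form {m} {k} {β} integral θ∈′ stable full =
          let (a , πᵃ∈ , minimal) = least em (λ i → S (ε 0# (π ^ i) 0#)) (k , full)
              β∈ = proj₁ (integral θ∈′)
              θ∈ = S-resp (solve 1 (λ b → b :- b :* :1 := :0) refl β)
                (solve 1 (λ b → :0 :- b :* :1 := :- b) refl β)
                (solve 2 (λ b z → z :- b :* :0 := z) refl β (π ^ m)) (S-sub* β∈ θ∈′ 1∈)
              open Form {m} {a} {β} integral β∈ θ∈ πᵃ∈ (λ s → least-∈π^ minimal (proj₁ (proj₂ (integral s))) s)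
          in a , β , β∈ , norm∈ (stable θ∈) , πᵃ∈ , S⊆Over , Over⊆S

  module ConductorOrder {R : Subset} (isOrder : IsOrder R) (R⊆𝒪E : R ⊆ 𝒪E) {f₁ f₂ : ℕ}
      (conductor : IsConductorExponents R π x f₁ f₂) where
    open IsOrder isOrder
    open IsSubring isSubring
    private module VEx = VE.Uniformized x x-uniformizer

    𝔬-submodule : IsSubmodule Δ𝔬 R
    𝔬-submodule = record { resp = resp ; 0∈ = 0∈ ; +-closed = +-closed ; *-closed = λ a∈ → *-closed (𝔬⊆ a∈) }

    open 𝔬-Submodule 𝔬-submodule

    0×conductor : ∀ {p r} → κ p r VE.∈π^ f₂ → Conductor R (ε 0# p r)
    0×conductor e∈ = let (t , t∈ , e≈) = VEx.divide e∈ in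
      proj₂ conductor ((0# , ≤v-0 , sym (zeroˡ _)) , t , t∈ , e≈)

    conductor⊆ : ∀ {y} → Conductor R y → R y
    conductor⊆ {y} y∈ = resp (E.*-identityʳ y) (proj₂ y∈ E.1# (𝒪-1 , VEx.𝒪-1))

    0×conductor⊆ : ∀ {p r} → κ p r VE.∈π^ f₂ → R (ε 0# p r)
    0×conductor⊆ e∈ = conductor⊆ (0×conductor e∈)

    full : ∀ {p r} → p ∈π^ f₂ → r ∈π^ f₂ → R (ε 0# p r)
    full p∈ r∈ = 0×conductor⊆ (VE.≤v-weaken (ℤ.+≤+ (ℕ.m≤m+n f₂ f₂)) (κ-even f₂ p∈ r∈))

    private
      integral : ∀ {u p r} → R (ε u p r) → 𝒪 u × 𝒪 p × 𝒪 r
      integral = 𝒪E-ε⁻¹ ∘ R⊆𝒪E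

      one∈ : R (ε 1# 1# 0#)
      one∈ = resp ε-1 1∈

      projection = projection-form 𝔬-submodule one∈ {k = f₂} (proj₂ ∘ integral) (full ≤v-0 (π^∈ f₂))
      b = proj₁ projection
      u₀∈ = proj₂ (proj₂ (proj₂ projection))

      -- The element of R above π^b x may have a nonzero first coordinate, but on the kernel only
      -- its second one acts.
      stable : ∀ {p r} → R (ε 0# p r) → R (ε 0# (- (D * (π ^ b * r))) (π ^ b * p + T * (π ^ b * r)))
      stable {p} {r} s = S-resp (zeroˡ _)
        (solve 4 (λ p r z D → p :* :0 :- D :* (r :* z) := :- (D :* (z :* r))) refl p r (π ^ b) D)
        (solve 4 (λ p r z T → p :* z :+ r :* :0 :+ T :* (r :* z) := z :* p :+ T :* (z :* r)) refl p r (π ^ b) T)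
        (resp (ε-* _ _ _ _ _ _) (*-closed s u₀∈))

    private
      module _ {a c} (πᵃ∈ : R (ε 0# (π ^ a) 0#)) (R⊆ : R ⊆ Over b a c) (⊆R : Over b a c ⊆ R) where
        π^f₁∈ : R (ε (π ^ f₁) 0# 0#)
        π^f₁∈ = resp (refl , E′.trans (E′.sym 0#-homo) (κ-ι 0#))
          (conductor⊆ (proj₂ conductor ((1# , 𝒪-1 , sym (*-identityˡ _)) , E′.0# , VE.≤v-0 , E′.sym (E′.zeroˡ _))))

        0π^f₁∈ : R (ε 0# (- (π ^ f₁)) 0#)
        0π^f₁∈ = S-resp (solve 1 (λ z → z :- z :* :1 := :0) refl (π ^ f₁))
          (solve 1 (λ z → :0 :- z :* :1 := :- z) refl (π ^ f₁))
          (solve 1 (λ z → :0 :- z :* :0 := :0) refl (π ^ f₁))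
          (S-sub* (∈⇒𝒪 (π^∈ f₁)) π^f₁∈ one∈)

        a≤f₁ : a ℕ.≤ f₁
        a≤f₁ =
          let (_ , w , 0≈ , w∈ , h) = Over-elim {b} {a} {c} (R⊆ 0π^f₁∈)
              w≈0 = π^-cancelʳ b (trans (zeroˡ _) 0≈)
          in π^-≤ {a} {f₁} (≤v-cong (trans (-‿cong (+-congˡ (*-congʳ (sym w≈0))))
            (solve 2 (λ z c → :- ((:- z :- :0) :+ :0 :* c) := z) refl (π ^ f₁) c)) (≤v-neg h))

        multiple∈ : ∀ y → 𝒪E y → R (ε (π ^ a) 0# 0# E.* y)
        multiple∈ y y∈ =
          let (u , p , r , y≈) = ε-surjective y
              (u∈ , _) = 𝒪E-ε⁻¹ (≤v-cong (proj₁ y≈) (proj₁ y∈) , VE.≤v-cong (proj₂ y≈) (proj₂ y∈))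
          in ⊆R (Over-resp (E.sym (E.trans (E.*-congˡ {ε (π ^ a) 0# 0#} y≈) (ε-* (π ^ a) 0# 0# u p r)))
            (Over-intro {w = 0#}
              (solve 4 (λ p r T z → :0 :* r :+ :0 :* p :+ T :* (:0 :* r) := :0 :* z) refl p r T (π ^ b))
              (∈-*ˡ (∈⇒𝒪 (π^∈ a)) u∈) ≤v-0
              (≤v-cong (solve 6 (λ u p r D z c → :- (z :* u) := (:0 :* p :- D :* (:0 :* r)) :- z :* u :+ :0 :* c)
                  refl u p r D (π ^ a) c)
                (≤v-neg (∈-*ʳ (π^∈ a) u∈)))))

        f₁≤a : f₁ ℕ.≤ a
        f₁≤a = let ((t , t∈ , eq) , _) = proj₁ conductor (𝒪E-ε (∈⇒𝒪 (π^∈ a)) ≤v-0 ≤v-0 , multiple∈)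
               in π^-≤ {f₁} {a} (≤v-cong (sym eq) (∈-*ˡ t∈ (π^∈ f₁)))

    abstract
      -- The exponent of the normal form is f₁ because both describe the c with (c, 0) in R.
      -- Subtracting π^f₁ (1, 1) from (π^f₁, 0) gives one inequality; the other holds because (π^a,
      -- 0) multiplies 𝒪E into the normal form.
      order-form : ∃₂ λ b c → 𝒪 c × norm b c ∈π^ f₁ × R ≐ Over b f₁ c
      order-form =
        let (a , c , c∈ , N∈ , πᵃ∈ , R⊆ , ⊆R) = over-form 𝔬-submodule one∈ {m = b} {k = f₂} {u₀ = proj₁ (proj₂ (proj₂ projection))}
              (λ s → let (u∈ , p∈ , _) = integral s in u∈ , p∈ , proj₁ (proj₂ projection) s) u₀∈ stable (full (π^∈ f₂) ≤v-0)
        in b , ≡.subst (λ f → ∃ λ c → 𝒪 c × norm b c ∈π^ f × R ≐ Over b f c)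
                 (ℕ.≤-antisym (a≤f₁ πᵃ∈ R⊆ ⊆R) (f₁≤a πᵃ∈ R⊆ ⊆R)) (c , c∈ , N∈ , R⊆ , ⊆R)

-- Length and conductor

module NormValuation {c ℓ} (setting : QuadraticSetting c ℓ) where
  open Coordinates setting

  π^*-cong-∈ : ∀ {a} d {k} → a ∈π^ k → π ^ d * a ∈π^ d ℕ.+ k
  π^*-cong-∈ d = ∈-* (π^∈ d)

  π^*-cancel-∈ : ∀ {a} d {k n} → k ℕ.+ d ≡ n → π ^ d * a ∈π^ n → a ∈π^ k
  π^*-cancel-∈ {a} d {k} ≡.refl h = cancel {k = k} d (≤v-cong (*-comm _ a) h)

  private
    D[]∉ : ∀ m → ¬ (D[ m ] ∈π^ suc (suc (m ℕ.+ m)))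
    D[]∉ m h = D∉ (cancel {k = 2} (m ℕ.+ m) (≤v-cong (*-congˡ (sym (π^-+ m m))) h))

  -- The middle term never decides: its valuation is at least j + m + 1, which exceeds 2 j if j ≤ m
  -- and 2 m + 1 otherwise.
  norm∈ : ∀ {m a β} j → a ℕ.≤ suc (m ℕ.+ m) → a ℕ.≤ j ℕ.+ j → β ∈π^ j → norm m β ∈π^ a
  norm∈ {m} {a} j a≤ a≤′ β∈ = ≤v-+
    (≤v-sub (∈-weaken a≤′ (∈-* β∈ β∈)) (∈-weaken cross (∈-* β∈ (T[]∈ m))))
    (∈-weaken a≤ (D[]∈ m))
    where
    cross : a ℕ.≤ j ℕ.+ suc m
    cross with ℕ.≤-<-connex j m
    ... | inj₁ j≤m = ℕ.≤-trans a≤′ (ℕ.+-monoʳ-≤ j (ℕ.m≤n⇒m≤1+n j≤m))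
    ... | inj₂ m<j = ℕ.≤-trans a≤ (ℕ.≤-trans (ℕ.≤-reflexive (≡.sym (ℕ.+-suc m m))) (ℕ.+-monoˡ-≤ (suc m) (ℕ.<⇒≤ m<j)))

  -- The valuations 2 v(β) of β² and 2 m + 1 of `D[ m ]` have different parity, and the middle term
  -- lies strictly above the smaller one. So the norm has valuation min(2 v(β), 2 m + 1); the split
  -- at v(β) = m + 1 decides which term dominates.
  norm∈⁻¹ : ∀ {m a β} → 𝒪 β → norm m β ∈π^ a → a ℕ.≤ suc (m ℕ.+ m) × ∃ λ j → a ℕ.≤ j ℕ.+ j × β ∈π^ j
  norm∈⁻¹ {m} {a} {β} β∈ N∈ with ≤v? (+ suc m) β
  ... | yes h = a≤ , suc m , ℕ.≤-trans a≤ (s≤s (ℕ.+-monoʳ-≤ m (ℕ.n≤1+n m))) , h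
    where
    2m+2≤ : suc (suc (m ℕ.+ m)) ℕ.≤ suc m ℕ.+ suc m
    2m+2≤ = s≤s (ℕ.≤-reflexive (≡.sym (ℕ.+-suc m m)))
    a≤ : a ℕ.≤ suc (m ℕ.+ m)
    a≤ = ℕ.≮⇒≥ λ 2m+1<a → D[]∉ m (≤v-cong
      (solve 3 (λ n bb bt → (bb :- bt :+ n) :- (bb :- bt) := n) refl D[ m ] (β * β) (β * T[ m ]))
      (≤v-sub (∈-weaken 2m+1<a N∈)
        (≤v-sub (∈-weaken 2m+2≤ (∈-* h h)) (∈-weaken 2m+2≤ (∈-* h (T[]∈ m))))))
  ... | no ¬h with factor β∈ ¬h
  ...   | i , w , s≤s i≤m , w∈ , βw , β∈′ = ℕ.≤-trans a≤ (ℕ.m≤n⇒m≤1+n (ℕ.+-mono-≤ i≤m i≤m)) , i , a≤ , β∈′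
    where
    -- For a > 2 i all terms of the norm equation other than β² would be divisible by π^(2i+1);
    -- multiplied by w², which turns β² into π^(2i), this is absurd.
    a≤ : a ℕ.≤ i ℕ.+ i
    a≤ = ℕ.≮⇒≥ λ 2i<a → ℕ.1+n≰n {i ℕ.+ i} (π^-≤ {suc (i ℕ.+ i)} {i ℕ.+ i} (≤v-cong
      (trans (solve 4 (λ b w t d → (w :* w) :* ((b :* b :- b :* t :+ d) :+ b :* t :- d) := (b :* w) :* (b :* w)) refl β w T[ m ] D[ m ])
        (trans (*-cong βw βw) (sym (π^-+ i i))))
      (∈-*ˡ (∈-*ˡ w∈ w∈) (≤v-sub (≤v-+ (∈-weaken 2i<a N∈)
          (∈-weaken (ℕ.≤-trans (s≤s (ℕ.+-monoʳ-≤ i i≤m)) (ℕ.≤-reflexive (≡.sym (ℕ.+-suc i m)))) (∈-* β∈′ (T[]∈ m))))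
        (∈-weaken (s≤s (ℕ.+-mono-≤ i≤m i≤m)) (D[]∈ m))))))

-- The length of the maximal order modulo an order

module Length (em : ∀ {a} → ExcludedMiddle a) {c ℓ} (setting : QuadraticSetting c ℓ) where
  open Coordinates setting
  open NormalForms em setting

  private
    -- An integral module that contains (1, 1) is determined by its kernel 0 × N. The two exponents
    -- are the diagonal of the Hermite normal form of N, and their sum is the colength of the module
    -- in 𝒪E.
    record Rank (S : Subset) : Set (c ⊔ ℓ) where
      field
        α β    : ℕ
        α∈     : S (ε 0# (π ^ α) 0#)
        α-least : ∀ i → S (ε 0# (π ^ i) 0#) → α ℕ.≤ i
        p      : Carrier
        β∈     : S (ε 0# p (π ^ β))
        β-least : ∀ j → (∃ λ p → S (ε 0# p (π ^ j))) → β ℕ.≤ j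

    rank-exists : ∀ {S i j p} → S (ε 0# (π ^ i) 0#) → S (ε 0# p (π ^ j)) → Rank S
    rank-exists {S} {i} {j} {p} s s′ =
      let (α , α∈ , α-least) = least em (λ i → S (ε 0# (π ^ i) 0#)) (i , s)
          (β , (p , β∈) , β-least) = least em (λ j → ∃ λ p → S (ε 0# p (π ^ j))) (j , p , s′)
      in record { α = α ; β = β ; α∈ = α∈ ; α-least = α-least ; p = p ; β∈ = β∈ ; β-least = β-least }

    module RankStep {S S′ : Subset} (isS : IsSubmodule Δ𝔬 S) (isS′ : IsSubmodule Δ𝔬 S′) (1∈ : S (ε 1# 1# 0#))
        (S′⊆𝒪E : S′ ⊆ 𝒪E) (r : Rank S) (r′ : Rank S′) (S⊆S′ : S ⊆ S′) where
      module r = Rank r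
      module r′ = Rank r′
      module S = 𝔬-Submodule isS
      module S′ = 𝔬-Submodule isS′

      α′≤α = r′.α-least r.α (S⊆S′ r.α∈)
      β′≤β = r′.β-least r.β (r.p , S⊆S′ r.β∈)

      r∈ : ∀ {p q} → 𝒪 q → S′ (ε 0# p q) → q ∈π^ r′.β
      r∈ {p} {q} q∈ s = ∈-unless q∈ λ {i} {w} i<β w∈ qw →
        ℕ.<⇒≱ i<β (r′.β-least i (w * p ,
          S′.S-resp (zeroʳ w) refl (trans (*-comm w q) qw) (S′.S-* w∈ s)))

      subtract-1 : ∀ {u p q} → 𝒪 u → S′ (ε u p q) → S′ (ε 0# (p - u) q)
      subtract-1 {u} {p} {q} u∈ s = S′.S-resp
        (solve 1 (λ u → u :- u :* :1 := :0) refl u)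
        (solve 2 (λ u p → p :- u :* :1 := p :- u) refl u p)
        (solve 2 (λ u q → q :- u :* :0 := q) refl u q)
        (S′.S-sub* u∈ s (S⊆S′ 1∈))

      subtract-β : ∀ {w p q} → 𝒪 w → q ≈ w * π ^ r.β → S′ (ε 0# p q) → S′ (ε 0# (p - w * r.p) 0#)
      subtract-β {w} w∈ q≈ s = S′.S-resp
        (solve 1 (λ w → :0 :- w :* :0 := :0) refl w) refl
        (trans (+-congʳ q≈) (-‿inverseʳ _))
        (S′.S-sub* w∈ s (S⊆S′ r.β∈))

      rebuild : ∀ {u w t p q} → 𝒪 u → 𝒪 w → 𝒪 t → q ≈ w * π ^ r.β → p - u - w * r.p ≈ t * π ^ r.α → S (ε u p q)
      rebuild {u} {w} {t} {p} {q} u∈ w∈ t∈ q≈ eq = S.S-resp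
        (solve 3 (λ u w t → (u :* :1 :+ w :* :0) :+ t :* :0 := u) refl u w t)
        (trans (+-congˡ (sym eq))
          (solve 4 (λ u w p p₀ → (u :* :1 :+ w :* p₀) :+ ((p :- u) :- w :* p₀) := p) refl u w p r.p))
        (trans (solve 4 (λ u w t z → (u :* :0 :+ w :* z) :+ t :* :0 := w :* z) refl u w t (π ^ r.β)) (sym q≈))
        (S.S-+* t∈ (S.S-+* w∈ (S.S-* u∈ 1∈) r.β∈) r.α∈)

      module _ (≤ : r.α ℕ.+ r.β ℕ.≤ r′.α ℕ.+ r′.β) where
        α≡ : r′.α ≡ r.α
        α≡ = ℕ.≤-antisym α′≤α (ℕ.+-cancelʳ-≤ r.β _ _ (ℕ.≤-trans ≤ (ℕ.+-monoʳ-≤ r′.α β′≤β)))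

        β≡ : r′.β ≡ r.β
        β≡ = ℕ.≤-antisym β′≤β (ℕ.+-cancelˡ-≤ r.α _ _ (ℕ.≤-trans ≤ (ℕ.+-monoˡ-≤ r′.β α′≤α)))

        divide-α : ∀ {z} → S′ (ε 0# z 0#) → ∃ λ t → 𝒪 t × z ≈ t * π ^ r.α
        divide-α {z} s = divide (≡.subst (z ∈π^_) α≡ (least-∈π^ isS′ r′.α-least (proj₁ (proj₂ (𝒪E-ε⁻¹ (S′⊆𝒪E s)))) s))

        divide-β : ∀ {p q} → S′ (ε 0# p q) → ∃ λ w → 𝒪 w × q ≈ w * π ^ r.β
        divide-β {p} {q} s = divide (≡.subst (q ∈π^_) β≡ (r∈ (proj₂ (proj₂ (𝒪E-ε⁻¹ (S′⊆𝒪E s)))) s))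

        S′⊆S-ε : ∀ {u p q} → S′ (ε u p q) → S (ε u p q)
        S′⊆S-ε s =
          let u∈ = proj₁ (𝒪E-ε⁻¹ (S′⊆𝒪E s))
              (w , w∈ , q≈) = divide-β (subtract-1 u∈ s)
              (t , t∈ , eq) = divide-α (subtract-β w∈ q≈ (subtract-1 u∈ s))
          in rebuild u∈ w∈ t∈ q≈ eq

        S′⊆S : S′ ⊆ S
        S′⊆S {y} s = let (u , p , q , y≈) = ε-surjective y in
          IsSubmodule.resp isS (E.sym y≈) (S′⊆S-ε (IsSubmodule.resp isS′ y≈ s))

    -- Enlarging a module can only lower each exponent. If the sum does not drop, neither exponent
    -- does, and then the echelon generators of the smaller module reduce every element of the
    -- larger one to zero.
    rank-⊂ : ∀ {S S′} → IsSubmodule Δ𝔬 S → IsSubmodule Δ𝔬 S′ → S (ε 1# 1# 0#) → S′ ⊆ 𝒪E →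
             (r : Rank S) (r′ : Rank S′) → S ⊂ S′ →
             Rank.α r′ ℕ.+ Rank.β r′ ℕ.< Rank.α r ℕ.+ Rank.β r
    rank-⊂ isS isS′ 1∈ S′⊆𝒪E r r′ (S⊆S′ , S′⊈S) = ℕ.≰⇒> λ ≤ → S′⊈S (RankStep.S′⊆S isS isS′ 1∈ S′⊆𝒪E r r′ S⊆S′ ≤)

    descending : ∀ n (ρ : Fin (suc n) → ℕ) → (∀ (i : Fin n) → ρ (fsuc i) ℕ.< ρ (inject₁ i)) → n ℕ.≤ ρ fzero
    descending zero ρ ρ< = z≤n
    descending (suc n) ρ ρ< = ℕ.≤-trans (s≤s (descending n (ρ ∘ fsuc) (ρ< ∘ fsuc))) (ρ< fzero)

    -- A composition series from Over b f γ to 𝒪E.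
    series : ℕ → ℕ → Carrier → ℕ → Subset
    series f b γ zero = Over b f γ
    series (suc f) b γ (suc i) = series f b γ i
    series zero (suc b) γ (suc i) = series zero b 0# i
    series zero zero γ (suc i) = Over 0 0 γ

    Over-⊂ᵃ : ∀ {m a β} → Over m (suc a) β ⊂ Over m a β
    Over-⊂ᵃ {m} {a} {β} = (λ (over u p w y≈ u∈ w∈ h) → over u p w y≈ u∈ w∈ (∈-weaken (ℕ.n≤1+n a) h)) , λ ⊆ →
      let (_ , w , 0≈ , w∈ , h) = Over-elim {m} {suc a} {β} (⊆ (Over-intro {w = 0#} (sym (zeroˡ (π ^ m))) ≤v-0 ≤v-0
            (≤v-cong (solve 2 (λ z β → z := z :- :0 :+ :0 :* β) refl (π ^ a) β) (π^∈ a))))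
          w≈0 = π^-cancelʳ m (trans (zeroˡ _) 0≈)
      in ℕ.1+n≰n {a} (π^-≤ {suc a} {a} (≤v-cong (trans (+-congˡ (*-congʳ (sym w≈0)))
           (solve 2 (λ z β → z :- :0 :+ :0 :* β := z) refl (π ^ a) β)) h))

    -- At a = 0 the congruence is vacuous for integral coordinates, so β can be reset to 0 when m is
    -- lowered. The element (0, π^m x) witnesses strictness.
    Over-⊂ᵐ : ∀ {m β} → 𝒪 β → Over (suc m) 0 β ⊂ Over m 0 0#
    Over-⊂ᵐ {m} {β} β∈ = (λ {y} → sub {y}) , λ ⊆ →
      let (_ , w , eq , w∈ , _) = Over-elim {suc m} {0} {β} (⊆ (Over-intro {w = 1#} (sym (*-identityˡ (π ^ m))) ≤v-0 𝒪-1
            (≤v-cong (solve 0 (:0 := :0 :- :0 :+ :1 :* :0) refl) ≤v-0)))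
      in ℕ.1+n≰n {m} (π^-≤ {suc m} {m} (≤v-cong (sym eq) (∈-*ˡ w∈ (π^∈ (suc m)))))
      where
      sub : Over (suc m) 0 β ⊆ Over m 0 0#
      sub (over u p w y≈ u∈ w∈ h) = over u p (w * π)
        (E.trans y≈ (ε-cong refl refl (sym (*-assoc w π (π ^ m))))) u∈ (∈-*ˡ w∈ (≤v-weaken (ℤ.+≤+ z≤n) (≡⇒≤v π-uniformizer)))
        (≤v-cong (solve 4 (λ u p w π → p :- u := p :- u :+ (w :* π) :* :0) refl u p w π)
          (≤v-sub (p-integral {suc m} {0} β∈ u∈ w∈ h) u∈))

    series-submodule : ∀ f b γ i → IsSubmodule Δ𝔬 (series f b γ i)
    series-submodule f b γ zero = Over-𝔬-submodule
    series-submodule (suc f) b γ (suc i) = series-submodule f b γ i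
    series-submodule zero (suc b) γ (suc i) = series-submodule zero b 0# i
    series-submodule zero zero γ (suc i) = Over-𝔬-submodule

    series⊆𝒪E : ∀ f b γ i → 𝒪 γ → series f b γ i ⊆ 𝒪E
    series⊆𝒪E f b γ zero γ∈ = Over⊆𝒪E γ∈
    series⊆𝒪E (suc f) b γ (suc i) γ∈ = series⊆𝒪E f b γ i γ∈
    series⊆𝒪E zero (suc b) γ (suc i) γ∈ = series⊆𝒪E zero b 0# i ≤v-0
    series⊆𝒪E zero zero γ (suc i) γ∈ = Over⊆𝒪E γ∈

    ⊆series : ∀ f b γ i → 𝒪 γ → Over b f γ ⊆ series f b γ i
    ⊆series f b γ zero γ∈ y∈ = y∈
    ⊆series (suc f) b γ (suc i) γ∈ y∈ = ⊆series f b γ i γ∈ (proj₁ Over-⊂ᵃ y∈)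
    ⊆series zero (suc b) γ (suc i) γ∈ y∈ = ⊆series zero b 0# i ≤v-0 (proj₁ (Over-⊂ᵐ γ∈) y∈)
    ⊆series zero zero γ (suc i) γ∈ y∈ = y∈

    series-⊂ : ∀ f b γ i → 𝒪 γ → i ℕ.< f ℕ.+ b → series f b γ i ⊂ series f b γ (suc i)
    series-⊂ (suc f) b γ zero γ∈ _ = Over-⊂ᵃ
    series-⊂ (suc f) b γ (suc i) γ∈ (s≤s i<) = series-⊂ f b γ i γ∈ i<
    series-⊂ zero (suc b) γ zero γ∈ _ = Over-⊂ᵐ γ∈
    series-⊂ zero (suc b) γ (suc i) γ∈ (s≤s i<) = series-⊂ zero b 0# i ≤v-0 i<
    series-⊂ zero zero γ i γ∈ ()

  module _ {R : Subset} {b f γ} (γ∈ : 𝒪 γ) (R≐ : R ≐ Over b f γ) where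

    chain : Chain R (f ℕ.+ b)
    chain = record
      { term = λ i → series f b γ (toℕ i)
      ; isSubmodule = λ i → series-submodule f b γ (toℕ i)
      ; lower = λ i y∈ → ⊆series f b γ (toℕ i) γ∈ (proj₁ R≐ y∈)
      ; upper = λ i → series⊆𝒪E f b γ (toℕ i) γ∈
      ; strict = λ i → ≡.subst (λ k → series f b γ k ⊂ series f b γ (suc (toℕ i))) (≡.sym (Fin.toℕ-inject₁ i))
                   (series-⊂ f b γ (toℕ i) γ∈ (Fin.toℕ<n i))
      }

    chain-length≤ : ∀ n → Chain R n → n ℕ.≤ f ℕ.+ b
    chain-length≤ n ch = ℕ.≤-trans
      (descending n (λ i → Rank.α (rank i) ℕ.+ Rank.β (rank i)) λ i →
        rank-⊂ (isSubmodule (inject₁ i)) (isSubmodule (fsuc i)) (lower (inject₁ i) (proj₂ R≐ Over-1)) (upper (fsuc i))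
          (rank (inject₁ i)) (rank (fsuc i)) (strict i))
      (ℕ.+-mono-≤ (Rank.α-least (rank fzero) f (lower fzero (proj₂ R≐ Over-π^)))
                  (Rank.β-least (rank fzero) b (- γ , lower fzero (proj₂ R≐ Over-θ))))
      where
      open Chain ch
      rank : ∀ i → Rank (term i)
      rank i = rank-exists {i = f} {j = b} (lower i (proj₂ R≐ Over-π^)) (lower i (proj₂ R≐ Over-θ))

    quotientLength : ∀ {s} → QuotientLength R s → s ≡ f ℕ.+ b
    quotientLength {s} (ch , maximal) = ℕ.≤-antisym (chain-length≤ s ch) (maximal _ chain)

-- The conductor in the ramified factor

module ConductorExponent (em : ∀ {a} → ExcludedMiddle a) {c ℓ} (setting : QuadraticSetting c ℓ) where
  open Coordinates setting
  open NormalForms em setting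
  open NormValuation setting
  private module VEx = VE.Uniformized x x-uniformizer

  module _ {R : Subset} (isOrder : IsOrder R) (R⊆𝒪E : R ⊆ 𝒪E) {b f f₂ : ℕ} {γ : Carrier}
           (conductor : IsConductorExponents R π x f f₂) (R≐ : R ≐ Over b f γ) where
    open ConductorOrder isOrder R⊆𝒪E {f} {f₂} conductor using (0×conductor⊆)

    private
      R-resp = IsSubring.resp (IsOrder.isSubring isOrder)

      ∈R⇒f≤ : ∀ {i} → R (ε 0# (π ^ i) 0#) → f ℕ.≤ i
      ∈R⇒f≤ {i} s =
        let (_ , w , 0≈ , _ , h) = Over-elim {b} {f} {γ} (proj₁ R≐ s)
            w≈0 = π^-cancelʳ {0#} {w} b (trans (zeroˡ _) 0≈)
        in π^-≤ {f} {i} (≤v-cong (trans (+-congˡ (*-congʳ (sym w≈0)))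
             (solve 2 (λ z γ → z :- :0 :+ :0 :* γ := z) refl (π ^ i) γ)) h)

      π^-split : ∀ {t} → b ℕ.≤ t → π ^ t ≈ π ^ (t ℕ.∸ b) * π ^ b
      π^-split {t} b≤t = trans (reflexive (≡.cong (π ^_) (≡.sym (ℕ.m∸n+n≡m b≤t)))) (π^-+ (t ℕ.∸ b) b)

      ∈R⇒b≤ : ∀ {t} → R (ε 0# 0# (π ^ t)) → b ℕ.≤ t × π ^ (t ℕ.∸ b) * γ ∈π^ f
      ∈R⇒b≤ {t} s =
        let (_ , w , πᵗ≈ , w∈ , h) = Over-elim {b} {f} {γ} (proj₁ R≐ s)
            b≤t = π^-≤ {b} {t} (≤v-cong (sym πᵗ≈) (∈-*ˡ w∈ (π^∈ b)))
            w≈ = π^-cancelʳ {w} {π ^ (t ℕ.∸ b)} b (trans (sym πᵗ≈) (π^-split b≤t))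
        in b≤t , ≤v-cong (trans (solve 2 (λ w γ → :0 :- :0 :+ w :* γ := w :* γ) refl w γ) (*-congʳ w≈)) h

      ⇒∈R : ∀ {t p r} → b ℕ.≤ t → π ^ (t ℕ.∸ b) * γ ∈π^ f → p ∈π^ f → r ∈π^ t → R (ε 0# p r)
      ⇒∈R {t} {p} {r} b≤t h p∈ r∈ =
        let (w , w∈ , r≈) = divide {r} {t} r∈
        in proj₂ R≐ (Over-intro {b} {f} {γ} {w = w * π ^ (t ℕ.∸ b)}
             (trans r≈ (trans (*-congˡ (π^-split b≤t)) (sym (*-assoc w _ _)))) ≤v-0
             (∈-*ˡ w∈ (∈⇒𝒪 (π^∈ (t ℕ.∸ b))))
             (≤v-cong (solve 4 (λ p w z γ → p :+ w :* (z :* γ) := p :- :0 :+ (w :* z) :* γ) refl p w (π ^ (t ℕ.∸ b)) γ)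
               (≤v-+ p∈ (∈-*ˡ w∈ h))))

      multiples⇒conductor : ∀ {p r} → 𝒪 p → 𝒪 r →
        (∀ {p′ r′} → 𝒪 p′ → 𝒪 r′ → R (ε 0# (p * p′ - D * (r * r′)) (p * r′ + r * p′ + T * (r * r′)))) →
        κ p r VE.∈π^ f₂
      multiples⇒conductor {p} {r} p∈ r∈ multiples =
        let (_ , t , t∈ , e≈) = proj₁ conductor {ε 0# p r} (𝒪E-ε ≤v-0 p∈ r∈ , products)
        in VE.≤v-cong (E′.sym e≈) (VEx.∈-*ˡ t∈ (VEx.π^∈ f₂))
        where
        products : ∀ y → 𝒪E y → R (ε 0# p r E.* y)
        products y y∈ =
          let (u′ , p′ , r′ , y≈) = ε-surjective y
              (_ , p′∈ , r′∈) = 𝒪E-ε⁻¹ (≤v-cong (proj₁ y≈) (proj₁ y∈) , VE.≤v-cong (proj₂ y≈) (proj₂ y∈))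
          in R-resp (E.sym (E.trans (E.*-congˡ {ε 0# p r} y≈) (E.trans (ε-* 0# p r u′ p′ r′) (ε-cong (zeroˡ u′) refl refl))))
               (multiples p′∈ r′∈)

    -- C is the valuation of γ, truncated at f and b + 1; it is read off from the parity of f₂.
    Threshold : ℕ → ℕ → Set
    Threshold t C = C ℕ.+ t ≡ f ℕ.+ b × C ℕ.≤ f × C ℕ.≤ suc b × γ ∈π^ C × (C ≡ f ⊎ C ≡ suc b ⊎ ¬ (γ ∈π^ suc C))

    private
      -- That the kernel contains π^t 𝒪E′ means f ≤ t, b ≤ t and π^f dividing π^(t-b) γ. If b = t,
      -- then γ is 0 modulo π^f and C = f. If b < t, maximality of the conductor bounds v(γ) from
      -- above as well, and C = f - (t - b) is its exact value.
      even-threshold : ∀ t → f₂ ≡ t ℕ.+ t → 𝒪 γ → ∃ (Threshold t)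
      even-threshold t f₂≡ γ∈ = go t b≤t f≤t cond ≡.refl
        where
        f≤t : f ℕ.≤ t
        f≤t = ∈R⇒f≤ {t} (0×conductor⊆ (≡.subst (κ (π ^ t) 0# VE.∈π^_) (≡.sym f₂≡) (κ-even t (π^∈ t) ≤v-0)))
        b≤t×cond : b ℕ.≤ t × π ^ (t ℕ.∸ b) * γ ∈π^ f
        b≤t×cond = ∈R⇒b≤ {t} (0×conductor⊆ (≡.subst (κ 0# (π ^ t) VE.∈π^_) (≡.sym f₂≡) (κ-even t ≤v-0 (π^∈ t))))
        b≤t = proj₁ b≤t×cond
        cond = proj₂ b≤t×cond

        -- Otherwise π^t′ x, of valuation f₂ - 1, would multiply 𝒪E′ into the kernel too: the
        -- F-parts of its multiples carry the factor D π^t′, hence π^t and so π^f.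
        sharp : ∀ t′ → t ≡ suc t′ → b ℕ.≤ t′ → ¬ (π ^ (t′ ℕ.∸ b) * γ ∈π^ f)
        sharp t′ ≡.refl b≤t′ h = ℕ.1+n≰n {t′} (π^-≤ {suc t′} {t′} (proj₂ (κ-even⁻¹ (suc t′)
          (≡.subst (κ 0# (π ^ t′) VE.∈π^_) f₂≡ (multiples⇒conductor ≤v-0 (∈⇒𝒪 (π^∈ t′)) λ {p′} {r′} p′∈ r′∈ →
            ⇒∈R {t′} b≤t′ h
              (≤v-cong (solve 4 (λ p r z D → :- (D :* (z :* r)) := :0 :* p :- D :* (z :* r)) refl p′ r′ (π ^ t′) D)
                (≤v-neg (∈-weaken f≤t (∈-* D∈ (∈-*ʳ (π^∈ t′) r′∈)))))
              (≤v-cong (solve 4 (λ p r z T → z :* (p :+ T :* r) := :0 :* r :+ z :* p :+ T :* (z :* r)) refl p′ r′ (π ^ t′) T)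
                (∈-*ʳ (π^∈ t′) (≤v-+ p′∈ (∈-*ˡ (∈⇒𝒪 T∈) r′∈))))))))) 

        go : ∀ t₀ → b ℕ.≤ t₀ → f ℕ.≤ t₀ → π ^ (t₀ ℕ.∸ b) * γ ∈π^ f → t ≡ t₀ → ∃ (Threshold t)
        go t₀ b≤ f≤ h eq with ℕ.m≤n⇒m<n∨m≡n b≤
        go t₀ b≤ f≤ h eq | inj₂ b≡t₀ = f , ≡.cong (f ℕ.+_) (≡.trans eq (≡.sym b≡t₀)) , ℕ.≤-refl , ℕ.m≤n⇒m≤1+n (ℕ.≤-trans f≤ (ℕ.≤-reflexive (≡.sym b≡t₀))) ,
          ≤v-cong (trans (*-congʳ (reflexive (≡.cong (π ^_) (≡.trans (≡.cong (ℕ._∸ b) (≡.sym b≡t₀)) (ℕ.n∸n≡0 b))))) (*-identityˡ γ)) h , inj₁ ≡.refl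
        go (suc t′) b≤ f≤ h eq | inj₁ (s≤s b≤t′) =
          C , sum≡ , ℕ.m∸n≤m f d , ℕ.m≤n⇒m≤1+n C≤b , π^*-cancel-∈ d (ℕ.m∸n+n≡m d≤f) h , inj₂ (inj₂ below)
          where
          d d′ C : ℕ
          d = suc t′ ℕ.∸ b
          d′ = t′ ℕ.∸ b
          C = f ℕ.∸ d
          d≡ : d ≡ suc d′
          d≡ = ℕ.+-∸-assoc 1 b≤t′
          ¬h = sharp t′ eq b≤t′
          d≤f : d ℕ.≤ f
          d≤f = ≡.subst (ℕ._≤ f) (≡.sym d≡) (ℕ.≰⇒> λ f≤d′ → ¬h (∈-weaken f≤d′ (∈-*ʳ (π^∈ d′) γ∈)))
          sum≡ : C ℕ.+ t ≡ f ℕ.+ b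
          sum≡ = ≡.trans (≡.cong (C ℕ.+_) (≡.trans eq (≡.sym (ℕ.m∸n+n≡m b≤))))
            (≡.trans (≡.sym (ℕ.+-assoc C d b)) (≡.cong (ℕ._+ b) (ℕ.m∸n+n≡m d≤f)))
          C≤b : C ℕ.≤ b
          C≤b = ℕ.+-cancelʳ-≤ d C b (ℕ.≤-trans (ℕ.≤-reflexive (ℕ.m∸n+n≡m d≤f))
            (ℕ.≤-trans f≤ (ℕ.≤-reflexive (≡.sym (≡.trans (ℕ.+-comm b d) (ℕ.m∸n+n≡m b≤))))))
          below : ¬ (γ ∈π^ suc C)
          below γ∈′ = ¬h (∈-weaken (ℕ.≤-reflexive (≡.sym (≡.trans (ℕ.+-suc d′ C)
            (≡.trans (≡.cong (ℕ._+ C) (≡.sym d≡)) (≡.trans (ℕ.+-comm d C) (ℕ.m∸n+n≡m d≤f)))))) (π^*-cong-∈ d′ {suc C} γ∈′))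

      -- Odd f₂ forces f = t + 1, since for f ≤ t already π^t, of valuation f₂ - 1, would multiply
      -- 𝒪E′ into the kernel. As π^f divides π^(t-b) γ, it follows that π^(b+1) divides γ, and C
      -- takes its largest value.
      odd-threshold : ∀ t → f₂ ≡ suc (t ℕ.+ t) → 𝒪 γ → Threshold t (suc b)
      odd-threshold t f₂≡ γ∈ = sum≡ , ℕ.≤-trans (s≤s b≤t) (ℕ.≤-reflexive (≡.sym f≡)) , ℕ.≤-refl ,
        π^*-cancel-∈ (t ℕ.∸ b) (≡.trans (≡.cong suc (≡.trans (ℕ.+-comm b _) (ℕ.m∸n+n≡m b≤t))) (≡.sym f≡)) cond , inj₂ (inj₁ ≡.refl)
        where
        f≤1+t : f ℕ.≤ suc t
        f≤1+t = ∈R⇒f≤ {suc t} (0×conductor⊆ (≡.subst (κ (π ^ suc t) 0# VE.∈π^_) (≡.sym f₂≡) (κ-odd t (π^∈ (suc t)) ≤v-0)))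
        b≤t×cond : b ℕ.≤ t × π ^ (t ℕ.∸ b) * γ ∈π^ f
        b≤t×cond = ∈R⇒b≤ {t} (0×conductor⊆ (≡.subst (κ 0# (π ^ t) VE.∈π^_) (≡.sym f₂≡) (κ-odd t ≤v-0 (π^∈ t))))
        b≤t = proj₁ b≤t×cond
        cond = proj₂ b≤t×cond

        f≰t : ¬ (f ℕ.≤ t)
        f≰t f≤t = ℕ.1+n≰n {t} (π^-≤ {suc t} {t} (proj₁ (κ-odd⁻¹ t
          (≡.subst (κ (π ^ t) 0# VE.∈π^_) f₂≡ (multiples⇒conductor (∈⇒𝒪 (π^∈ t)) ≤v-0 λ {p′} {r′} p′∈ r′∈ →
            ⇒∈R {t} b≤t cond
              (≤v-cong (solve 4 (λ p r z D → z :* p := z :* p :- D :* (:0 :* r)) refl p′ r′ (π ^ t) D)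
                (∈-weaken f≤t (∈-*ʳ (π^∈ t) p′∈)))
              (≤v-cong (solve 4 (λ p r z T → z :* r := z :* r :+ :0 :* p :+ T :* (:0 :* r)) refl p′ r′ (π ^ t) T)
                (∈-*ʳ (π^∈ t) r′∈)))))))

        f≡ : f ≡ suc t
        f≡ = ℕ.≤-antisym f≤1+t (ℕ.≰⇒> f≰t)
        sum≡ : suc b ℕ.+ t ≡ f ℕ.+ b
        sum≡ = ≡.trans (≡.cong suc (ℕ.+-comm b t)) (≡.cong (ℕ._+ b) (≡.sym f≡))

    Thresholds : Set
    Thresholds = ∃₂ λ t C → (f₂ ≡ t ℕ.+ t ⊎ f₂ ≡ suc (t ℕ.+ t) × 1 ℕ.≤ C) × Threshold t C

    threshold : 𝒪 γ → Thresholds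
    threshold γ∈ = from-parity (parity f₂)
      where
      from-parity : (∃ λ t → f₂ ≡ t ℕ.+ t ⊎ f₂ ≡ suc (t ℕ.+ t)) → Thresholds
      from-parity (t , inj₁ eq) = let (C , h) = even-threshold t eq γ∈ in t , C , inj₁ eq , h
      from-parity (t , inj₂ eq) = t , suc b , inj₂ (eq , s≤s z≤n) , odd-threshold t eq γ∈

-- Classification of fractional ideals

module DualForms (em : ∀ {a} → ExcludedMiddle a) {c ℓ} (setting : QuadraticSetting c ℓ) where
  open Coordinates setting

  Compatible : ℕ → ℕ → Carrier → ℕ → ℕ → Carrier → Set
  Compatible b f γ m a β = m ℕ.≤ b × a ℕ.≤ f × (π ^ (b ℕ.∸ m) * β - γ) ∈π^ a

  π^-∸ : ∀ {m n} → m ℕ.≤ n → π ^ n ≈ π ^ (n ℕ.∸ m) * π ^ m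
  π^-∸ {m} {n} m≤n = trans (reflexive (≡.cong (π ^_) (≡.sym (ℕ.m∸n+n≡m m≤n)))) (π^-+ (n ℕ.∸ m) m)

  over-compatible : ∀ {b f γ m a β} → Over b f γ ⊆ Over m a β → Compatible b f γ m a β
  over-compatible {b} {f} {γ} {m} {a} {β} ⊆ =
    let (_ , w , πᵇ≈ , w∈ , h) = Over-elim {m} {a} {β} (⊆ Over-θ)
        (_ , w′ , 0≈ , _ , h′) = Over-elim {m} {a} {β} (⊆ Over-π^)
        w′≈0 = π^-cancelʳ {0#} {w′} m (trans (zeroˡ _) 0≈)
        m≤b = π^-≤ {m} {b} (≤v-cong (sym πᵇ≈) (∈-*ˡ w∈ (π^∈ m)))
        w≈ = π^-cancelʳ {w} {π ^ (b ℕ.∸ m)} m (trans (sym πᵇ≈) (π^-∸ m≤b))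
    in m≤b ,
       π^-≤ {a} {f} (≤v-cong (trans (+-congˡ (*-congʳ (sym w′≈0)))
         (solve 2 (λ z β → z :- :0 :+ :0 :* β := z) refl (π ^ f) β)) h′) ,
       ≤v-cong (trans (solve 3 (λ w β γ → :- γ :- :0 :+ w :* β := w :* β :- γ) refl w β γ)
         (+-congʳ (*-congʳ w≈))) h

  -- A multiplier with first coordinate 0 maps the dual into its kernel π^a R_m. The three
  -- conditions are read off from the x-coordinates of three products: (0, π^f) with the generator
  -- (1, -θ̄), and (0, π^b x - γ) with (0, π^a) and with (1, -θ̄).
  dual-compatible : ∀ {b f γ m a β} → (∀ {y z} → Over b f γ y → Dual m a β z → Dual m a β (y E.* z)) →
                    Compatible b f γ m a β
  dual-compatible {b} {f} {γ} {m} {a} {β} closed = m≤b , a≤f , compatible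
    where
    τ = T[ m ] - β
    product : ∀ {p r u′ p′ r′} → Over b f γ (ε 0# p r) → Dual m a β (ε u′ p′ r′) →
              ∃ λ w → (p * r′ + r * p′ + T * (r * r′)) ≈ w * π ^ m × w ∈π^ a
    product {p} {r} {u′} {p′} {r′} s s′ =
      let (_ , w , r≈ , _ , h) = Dual-elim {m} {a} {β} (Dual-resp (ε-* 0# p r u′ p′ r′) (closed s s′))
      in w , r≈ , ≤v-cong (trans (+-congˡ (-‿cong (zeroˡ u′))) (solve 1 (λ w → w :- :0 := w) refl w)) h

    a≤f : a ℕ.≤ f
    a≤f = let (w , eq , w∈) = product Over-π^ Dual-1
              w≈ = π^-cancelʳ {w} {π ^ f} m (trans (sym eq)
                (solve 4 (λ z y τ T → z :* y :+ :0 :* (:- τ) :+ T :* (:0 :* y) := z :* y) refl (π ^ f) (π ^ m) τ T))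
          in π^-≤ {a} {f} (≤v-cong w≈ w∈)

    m≤b : m ℕ.≤ b
    m≤b = let (w , eq , w∈) = product Over-θ Dual-π^
              eq′ = trans (solve 4 (λ z y γ T → z :* y := :- γ :* :0 :+ z :* y :+ T :* (z :* :0)) refl (π ^ b) (π ^ a) γ T) eq
          in ℕ.+-cancelʳ-≤ a m b (≡.subst (ℕ._≤ b ℕ.+ a) (ℕ.+-comm a m)
               (π^-≤ {a ℕ.+ m} {b ℕ.+ a} (≤v-cong (sym (trans (π^-+ b a) eq′)) (∈-* w∈ (π^∈ m)))))

    compatible : (π ^ (b ℕ.∸ m) * β - γ) ∈π^ a
    compatible =
      let (w , eq , w∈) = product Over-θ Dual-1
          w≈ = π^-cancelʳ {w} {π ^ (b ℕ.∸ m) * β - γ} m (trans (sym eq) (trans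
            (+-cong (+-congˡ (*-congʳ (π^-∸ m≤b))) (*-congˡ (*-congʳ (π^-∸ m≤b))))
            (solve 5 (λ z y γ T β → :- γ :* y :+ (z :* y) :* (:- (T :* y :- β)) :+ T :* ((z :* y) :* y)
              := (z :* β :- γ) :* y) refl (π ^ (b ℕ.∸ m)) (π ^ m) γ T β)))
      in ≤v-cong w≈ w∈

  -- If M is stable under π^n′ x and N = R_n with n = n′ + 1, then M is generated over N by
  -- an element π^-a (π^n x + p), up to a scalar.
  module _ {S : Subset} (isSubmodule : IsSubmodule Δ𝔬 S) {n′ : ℕ}
      (N∈ : ∀ {p r} → S (ε 0# p r) → 𝒪 p × r ∈π^ suc n′)
      (∈N : ∀ {p r} → 𝒪 p → r ∈π^ suc n′ → S (ε 0# p r))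
      (u∈𝔬 : ∀ {u p r} → S (ε u p r) → 𝒪 u)
      (stable : ∀ {u p r} → S (ε u p r) → ∃ λ u′ → S (ε u′ (- (D * (π ^ n′ * r))) (π ^ n′ * p + T * (π ^ n′ * r)))) where

    DualForm : Set (c ⊔ ℓ)
    DualForm = ∃₂ λ a β → ∃₂ λ z z⁻¹ → z * z⁻¹ ≈ 1# × 1 ℕ.≤ a × 𝒪 β × norm (suc n′) β ∈π^ suc a ×
      (∀ {u p r} → S (ε u (z * p) (z * r)) → Dual (suc n′) a β (ε u p r)) ×
      (∀ {u p r} → Dual (suc n′) a β (ε u p r) → S (ε u (z * p) (z * r)))

    private
      open 𝔬-Submodule isSubmodule
      n = suc n′

      module Step {p₀ r₀} (s₀ : S (ε 1# p₀ r₀)) {a : ℕ} (p₀∈ : 𝒪 (π ^ a * p₀)) (r₀∈ : π ^ a * r₀ ∈π^ n)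
          (minimal : ∀ i → 𝒪 (π ^ i * p₀) × π ^ i * r₀ ∈π^ n → a ℕ.≤ i) where

        -- M contains N and hence 1, so it also contains π^n′ x, which N = R_n does not. The
        -- multiple `u′` of the generator that is needed to reach it is therefore not divisible by
        -- π^a.
        π^n′x∈ : ∃ λ u → S (ε u 0# (π ^ n′))
        π^n′x∈ = let (u , s) = stable (∈N 𝒪-1 ≤v-0) in u , S-resp refl
          (solve 2 (λ D z → :- (D :* (z :* :0)) := :0) refl D (π ^ n′))
          (solve 2 (λ T z → z :* :1 :+ T :* (z :* :0) := z) refl T (π ^ n′)) s

        u′ : Carrier
        u′ = proj₁ π^n′x∈

        u′∈ : 𝒪 u′
        u′∈ = u∈𝔬 (proj₂ π^n′x∈)

        reduced : 𝒪 (0# - u′ * p₀) × (π ^ n′ - u′ * r₀) ∈π^ n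
        reduced = N∈ (S-resp (solve 1 (λ u → u :- u :* :1 := :0) refl u′) refl refl
          (S-sub* u′∈ (proj₂ π^n′x∈) s₀))

        u′r₀∉ : ¬ (u′ * r₀ ∈π^ n)
        u′r₀∉ h = ℕ.1+n≰n {n′} (π^-≤ {n} {n′} (≤v-cong
          (solve 2 (λ z q → (z :- q) :+ q := z) refl (π ^ n′) (u′ * r₀)) (≤v-+ (proj₂ reduced) h)))

        a≢0 : 1 ℕ.≤ a
        a≢0 = ℕ.n≢0⇒n>0 λ a≡0 → u′r₀∉ (∈-*ˡ u′∈ (≤v-cong
          (trans (*-congʳ (reflexive (≡.cong (π ^_) a≡0))) (*-identityˡ r₀)) r₀∈))

        -- If π^a p₀ were a unit, integrality of u′ p₀ would make π^a divide `u′`.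
        P∈ : π ^ a * p₀ ∈π^ 1
        P∈ with ≤v? (+ 1) (π ^ a * p₀)
        ... | yes h = h
        ... | no ¬h = ⊥-elim (contradiction (unit p₀∈ ¬h))
          where
          contradiction : ¬ ∃ λ w → 𝒪 w × π ^ a * p₀ * w ≈ 1#
          contradiction (w , w∈ , Pw) =
            let u′∈πᵃ = ≤v-cong (trans (solve 4 (λ u z p w → z :* (:- (:0 :- u :* p)) :* w := u :* (z :* p :* w)) refl u′ (π ^ a) p₀ w)
                          (trans (*-congˡ Pw) (*-identityʳ u′)))
                        (∈-*ʳ (∈-*ʳ (π^∈ a) (≤v-neg (proj₁ reduced))) w∈)
                (t , t∈ , u′≈) = divide {u′} {a} u′∈πᵃ
            in u′r₀∉ (≤v-cong (trans (sym (*-assoc t _ _)) (*-congʳ (sym u′≈))) (∈-*ˡ t∈ r₀∈))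

        W-data : ∃ λ W → 𝒪 W × π ^ a * r₀ ≈ W * π ^ n
        W-data = divide r₀∈

        W : Carrier
        W = proj₁ W-data

        -- Otherwise both coordinates of π^a (p₀ + r₀ x) would admit one more division by π inside
        -- R_n, against the minimality of a.
        W∉ : ¬ (W ∈π^ 1)
        W∉ h = go a ≡.refl a≢0
          where
          go : ∀ a′ → a ≡ a′ → 1 ℕ.≤ a′ → ⊥
          go (suc a′) a≡ _ = ℕ.1+n≰n {a′} (≡.subst (ℕ._≤ a′) a≡ (minimal a′
            ( cancel {π ^ a′ * p₀} {0} 1 (≤v-cong (pull p₀) P∈)
            , cancel {π ^ a′ * r₀} {n} 1 (≤v-cong (pull r₀) (≡.subst (π ^ a * r₀ ∈π^_) (ℕ.+-comm 1 n) (≤v-cong (sym (proj₂ (proj₂ W-data))) (∈-* h (π^∈ n)))))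
            )))
            where
            pull : ∀ q → π ^ a * q ≈ π ^ a′ * q * π ^ 1
            pull q = trans (*-congʳ (reflexive (≡.cong (π ^_) a≡)))
              (solve 3 (λ π z q → (π :* z) :* q := z :* q :* (π :* :1)) refl π (π ^ a′) q)

        w₁-data : ∃ λ w → 𝒪 w × W * w ≈ 1#
        w₁-data = unit (proj₁ (proj₂ W-data)) W∉

        -- Division by the scalar `z` turns the generator p₀ + r₀ x into p₁ + π^n x, and N = R_n
        -- into π^a R_n. The choice of `β` makes this generator -θ̄, whose F-part is β - T[n].
        w₁ z p₁ β : Carrier
        w₁ = proj₁ w₁-data
        z = W * π⁻ a
        p₁ = w₁ * (π ^ a * p₀)
        β = T[ n ] + p₁

        p₁∈ : p₁ ∈π^ 1
        p₁∈ = ∈-*ˡ (proj₁ (proj₂ w₁-data)) P∈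

        β∈ : 𝒪 β
        β∈ = ≤v-+ (∈⇒𝒪 (T[]∈ n)) (∈⇒𝒪 p₁∈)

        z-inverse : z * (w₁ * π ^ a) ≈ 1#
        z-inverse = trans (solve 4 (λ W i w y → (W :* i) :* (w :* y) := (W :* w) :* (y :* i)) refl W (π⁻ a) w₁ (π ^ a))
          (trans (*-cong (proj₂ (proj₂ w₁-data)) (π^*π⁻ a)) (*-identityˡ 1#))

        z*p₁ : z * p₁ ≈ p₀
        z*p₁ = trans (solve 4 (λ z w y p → z :* (w :* (y :* p)) := (z :* (w :* y)) :* p) refl z w₁ (π ^ a) p₀)
          (trans (*-congʳ z-inverse) (*-identityˡ p₀))

        z*π^n : z * π ^ n ≈ r₀
        z*π^n = trans (solve 3 (λ W i y → (W :* i) :* y := (W :* y) :* i) refl W (π⁻ a) (π ^ n))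
          (trans (*-congʳ (sym (proj₂ (proj₂ W-data))))
          (trans (solve 3 (λ y r i → (y :* r) :* i := (y :* i) :* r) refl (π ^ a) r₀ (π⁻ a))
          (trans (*-congʳ (π^*π⁻ a)) (*-identityˡ r₀))))

        z*-𝒪 : ∀ {q k} → q ∈π^ a ℕ.+ k → z * q ∈π^ k
        z*-𝒪 {q} {k} h = cancel {z * q} {k} a (≤v-cong
          (trans (*-congˡ (sym (trans (*-congʳ (π^*π⁻ a)) (*-identityˡ q))))
            (solve 4 (λ W y i q → W :* (y :* i :* q) := (W :* i) :* q :* y) refl W (π ^ a) (π⁻ a) q))
          (∈-*ˡ (proj₁ (proj₂ W-data)) (≡.subst (q ∈π^_) (ℕ.+-comm a k) h)))

        z*-𝒪⁻¹ : ∀ {q k} → z * q ∈π^ k → q ∈π^ a ℕ.+ k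
        z*-𝒪⁻¹ {q} {k} h = ≤v-cong
          (trans (solve 4 (λ z w y q → w :* (y :* (z :* q)) := (z :* (w :* y)) :* q) refl z w₁ (π ^ a) q)
            (trans (*-congʳ z-inverse) (*-identityˡ q)))
          (∈-*ˡ (proj₁ (proj₂ w₁-data)) (∈-* (π^∈ a) h))

        p-part : ∀ p u → p + u * (T[ n ] - β) ≈ p - u * p₁
        p-part p u = solve 4 (λ p u t q → p :+ u :* (t :- (t :+ q)) := p :- u :* q) refl p u T[ n ] p₁

        reduce : ∀ {u p r} → S (ε u (z * p) (z * r)) → S (ε 0# (z * (p - u * p₁)) (z * (r - u * π ^ n)))
        reduce {u} {p} {r} s = S-resp (solve 1 (λ u → u :- u :* :1 := :0) refl u)
          (trans (+-congˡ (-‿cong (*-congˡ (sym z*p₁))))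
            (solve 4 (λ z p u q → z :* p :- u :* (z :* q) := z :* (p :- u :* q)) refl z p u p₁))
          (trans (+-congˡ (-‿cong (*-congˡ (sym z*π^n))))
            (solve 4 (λ z p u q → z :* p :- u :* (z :* q) := z :* (p :- u :* q)) refl z r u (π ^ n)))
          (S-sub* (u∈𝔬 s) s s₀)

        to-dual : ∀ {u p r} → S (ε u (z * p) (z * r)) → Dual n a β (ε u p r)
        to-dual {u} {p} {r} s = from-quotient (divide {r - u * π ^ n} {a ℕ.+ n} (z*-𝒪⁻¹ (proj₂ (N∈ (reduce s)))))
          where
          from-quotient : (∃ λ t → 𝒪 t × r - u * π ^ n ≈ t * π ^ (a ℕ.+ n)) → Dual n a β (ε u p r)
          from-quotient (t , t∈ , eq) = Dual-intro {n} {a} {β} {w = u + t * π ^ a}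
            (trans (solve 2 (λ r q → r := q :+ (r :- q)) refl r (u * π ^ n))
              (trans (+-congˡ (trans eq (*-congˡ (π^-+ a n))))
                (solve 4 (λ u t y z → u :* z :+ t :* (y :* z) := (u :+ t :* y) :* z) refl u t (π ^ a) (π ^ n)))) (u∈𝔬 s)
            (≤v-cong (sym (p-part p u)) (≡.subst ((p - u * p₁) ∈π^_) (ℕ.+-identityʳ a) (z*-𝒪⁻¹ (proj₁ (N∈ (reduce s))))))
            (≤v-cong (solve 3 (λ u t y → t :* y := (u :+ t :* y) :- u) refl u t (π ^ a)) (∈-*ˡ t∈ (π^∈ a)))

        from-dual : ∀ {u p r} → Dual n a β (ε u p r) → S (ε u (z * p) (z * r))
        from-dual {u} {p} {r} s =
          let (u∈ , w , r≈ , hp , hw) = Dual-elim {n} {a} {β} s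
          in S-resp (solve 1 (λ u → :0 :+ u :* :1 := u) refl u)
               (trans (+-congˡ (*-congˡ (sym z*p₁)))
                  (solve 4 (λ z p u q → z :* (p :- u :* q) :+ u :* (z :* q) := z :* p) refl z p u p₁))
               (trans (+-congˡ (*-congˡ (sym z*π^n)))
                  (trans (solve 4 (λ z w u q → z :* ((w :- u) :* q) :+ u :* (z :* q) := z :* (w :* q)) refl z w u (π ^ n)) (*-congˡ (sym r≈))))
               (S-+* u∈ (∈N (z*-𝒪 {k = 0} (≡.subst ((p - u * p₁) ∈π^_) (≡.sym (ℕ.+-identityʳ a)) (≤v-cong (p-part p u) hp)))
                            (z*-𝒪 (∈-* hw (π^∈ n)))) s₀)

        shifted : ∃ λ u → Dual n a β (ε u (- (D * (π ^ n′ * π ^ n))) (π ^ n′ * p₁ + T * (π ^ n′ * π ^ n)))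
        shifted = let (u , s) = stable s₀ in u , to-dual (S-resp refl
          (trans (-‿cong (*-congˡ (*-congˡ (sym z*π^n))))
            (solve 4 (λ D z y q → :- (D :* (y :* (z :* q))) := z :* (:- (D :* (y :* q)))) refl D z (π ^ n′) (π ^ n)))
          (trans (+-cong (*-congˡ (sym z*p₁)) (*-congˡ (*-congˡ (sym z*π^n))))
            (solve 5 (λ T z y q p → y :* (z :* p) :+ T :* (y :* (z :* q)) := z :* (y :* p :+ T :* (y :* q))) refl T z (π ^ n′) (π ^ n) p₁)) s)

        πw≈β : ∀ {w} → π ^ n′ * p₁ + T * (π ^ n′ * π ^ n) ≈ w * π ^ n → w * π ≈ β
        πw≈β {w} r≈ = π^-cancelʳ {w * π} {β} n′ (trans (*-assoc w π _) (trans (sym r≈)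
          (solve 4 (λ T y q p → y :* p :+ T :* (y :* q) := (T :* q :+ p) :* y) refl T (π ^ n′) (π ^ n) p₁)))

        norm≈ : ∀ {u w} → w * π ≈ β →
                π * ((w - u) * p₁ - (- (D * (π ^ n′ * π ^ n)) - u * p₁)) ≈ norm n β
        norm≈ {u} {w} eq = trans
          (solve 5 (λ π w u p d → π :* ((w :- u) :* p :- (:- d :- u :* p)) := (w :* π) :* p :+ π :* d)
            refl π w u p₁ (D * (π ^ n′ * π ^ n)))
          (trans (+-congʳ (*-congʳ eq))
            (solve 5 (λ π D y t p → (t :+ p) :* p :+ π :* (D :* (y :* (π :* y)))
              := (t :+ p) :* (t :+ p) :- (t :+ p) :* t :+ D :* ((π :* y) :* (π :* y)))
              refl π D (π ^ n′) T[ n ] p₁))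

        -- The product of π^n′ x and the generator has x-coordinate w π^n with w π = β. Its two
        -- congruences modulo π^a, combined and multiplied by π, produce the norm. The exponent a +
        -- 1 thus comes from stability one power of π below π^n x.
        norm∈a : norm n β ∈π^ suc a
        norm∈a =
          let (u , s) = shifted
              (_ , w , r≈ , hp , hw) = Dual-elim {n} {a} {β} s
          in ≤v-cong (norm≈ (πw≈β r≈)) (∈-* (≡⇒≤v π-uniformizer) (≤v-sub (∈-*ʳ hw (∈⇒𝒪 p₁∈)) (≤v-cong (p-part _ u) hp)))

        conclusion : DualForm
        conclusion = a , β , z , w₁ * π ^ a , z-inverse , a≢0 , β∈ , norm∈a , to-dual , from-dual

    dual-form : ∀ {p₀ r₀} → S (ε 1# p₀ r₀) → DualForm
    dual-form {p₀} {r₀} s₀ =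
      let (a , (p₀∈ , r₀∈) , minimal) = least em (λ i → 𝒪 (π ^ i * p₀) × π ^ i * r₀ ∈π^ n) clear
      in Step.conclusion s₀ {a} p₀∈ r₀∈ minimal
      where
      clear : ∃ λ i → 𝒪 (π ^ i * p₀) × π ^ i * r₀ ∈π^ n
      clear =
        let (k , p₀k∈) = denominator p₀
            (l , r₀l∈) = denominator r₀
        in k ℕ.+ (n ℕ.+ l) , denominator-weaken {p₀} {k} {k ℕ.+ (n ℕ.+ l)} (ℕ.m≤m+n k _) p₀k∈ ,
          ≤v-cong (trans (sym (*-assoc (π ^ k * π ^ n) (π ^ l) r₀))
                    (*-congʳ (sym (trans (π^-+ k (n ℕ.+ l)) (trans (*-congˡ (π^-+ n l)) (sym (*-assoc _ _ _)))))))
            (∈-*ʳ (∈-*ˡ (∈⇒𝒪 (π^∈ k)) (π^∈ n)) r₀l∈)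

-- Scaling, common denominators and full lattices

module Reduction (em : ∀ {a} → ExcludedMiddle a) {c ℓ} (setting : QuadraticSetting c ℓ) where
  open Coordinates setting
  open Ideals setting using (sum-closed)
  open NormalForms em setting
  open DualForms em setting
  open Algebra.Properties.Semiring.Sum E.semiring using (sum)
  open Cancellation E

  Invertible : E.Carrier → Set (c ⊔ ℓ)
  Invertible g = ∃ λ g′ → g′ E.* g E.≈ E.1# × g E.* g′ E.≈ E.1#

  Similar : Subset → Subset → Set (c ⊔ ℓ)
  Similar S S′ = ∃ λ u → Invertible u × S′ ≐ (u ⋆ S)

  -- For invertible `g` this is g⁻¹ S, in a form that mentions no inverse.
  pre : E.Carrier → Subset → Subset
  pre g S y = S (g E.* y)

  invertible-pair : ∀ {u u′ e e′} → u * u′ ≈ 1# → e E′.* e′ E′.≈ E′.1# → Invertible (u , e)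
  invertible-pair {u} {u′} {e} {e′} uu′ ee′ = (u′ , e′) ,
    (trans (*-comm u′ u) uu′ , E′.trans (E′.*-comm e′ e) ee′) , (uu′ , ee′)

  module _ {R S : Subset} (isSubmodule : IsSubmodule R S) where
    open IsSubmodule isSubmodule

    pre-submodule : ∀ g → IsSubmodule R (pre g S)
    pre-submodule g = record
      { resp = λ {y} {z} y≈z → resp (E.*-congˡ {g} {y} {z} y≈z)
      ; 0∈ = resp (E.sym {g E.* E.0#} (E.zeroʳ g)) 0∈
      ; +-closed = λ {y} {z} s s′ → resp (E.sym {g E.* (y E.+ z)} (E.distribˡ g y z)) (+-closed s s′)
      ; *-closed = λ {a} {y} a∈ s → resp {a E.* (g E.* y)} {g E.* (a E.* y)}
          (swap-left a g y) (*-closed a∈ s)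
      }

  similar-≐ : ∀ {S J} → J Respects E._≈_ → S ≐ J → Similar S J
  similar-≐ {S} {J} J-resp (S⊆J , J⊆S) = E.1# , (E.1# , E.*-identityˡ E.1# , E.*-identityˡ E.1#) ,
    (λ {y} s → y , J⊆S s , E.sym {E.1# E.* y} {y} (E.*-identityˡ y)) ,
    λ {y} (z , s , y≈) → J-resp {z} {y} (E.sym {y} {z} (E.trans {y} {E.1# E.* z} {z} y≈ (E.*-identityˡ z))) (S⊆J s)

  similar-trans : ∀ {S S′ S″} → Similar S S′ → Similar S′ S″ → Similar S S″
  similar-trans {S} {S′} {S″} (u , (u′ , u′u , uu′) , S′⊆ , ⊆S′) (t , (t′ , t′t , tt′) , S″⊆ , ⊆S″) =
    t E.* u , (u′ E.* t′ ,
      E.trans {(u′ E.* t′) E.* (t E.* u)} {u′ E.* u} (cancel-middle t′t u′ u) u′u ,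
      E.trans {(t E.* u) E.* (u′ E.* t′)} {t E.* t′} (cancel-middle uu′ t t′) tt′) ,
    (λ {y} s → let (z , sz , y≈) = S″⊆ {y} s ; (w , sw , z≈) = S′⊆ {z} sz in
      w , sw , E.trans {y} {t E.* z} {(t E.* u) E.* w} y≈ (E.trans {t E.* z} {t E.* (u E.* w)} (E.*-congˡ {t} {z} {u E.* w} z≈)
        (E.sym {(t E.* u) E.* w} (E.*-assoc t u w)))) ,
    λ {y} (w , sw , y≈) → ⊆S″ {y} (u E.* w , ⊆S′ {u E.* w} (w , sw , E.refl {u E.* w}) ,
      E.trans {y} {(t E.* u) E.* w} y≈ (E.*-assoc t u w))

  similar-sym : ∀ {S S′} → S Respects E._≈_ → Similar S S′ → Similar S′ S
  similar-sym {S} {S′} S-resp (u , (u′ , u′u , uu′) , S′⊆ , ⊆S′) = u′ , (u , uu′ , u′u) ,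
    (λ {y} s → u E.* y , ⊆S′ {u E.* y} (y , s , E.refl {u E.* y}) , E.sym {u′ E.* (u E.* y)} {y} (cancel-inverse u′u y)) ,
    λ {y} (z , s , y≈) → let (w , sw , z≈) = S′⊆ {z} s in
      S-resp {w} {y} (E.sym {y} {w} (E.trans {y} {u′ E.* z} {w} y≈ (E.trans {u′ E.* z} {u′ E.* (u E.* w)} {w}
        (E.*-congˡ {u′} {z} {u E.* w} z≈) (cancel-inverse u′u w)))) sw

  similar-pre : ∀ {J g} → J Respects E._≈_ → Invertible g → Similar (pre g J) J
  similar-pre {J} {g} J-resp (g′ , g′g , gg′) = g , (g′ , g′g , gg′) ,
    (λ {y} s → g′ E.* y , J-resp {y} {g E.* (g′ E.* y)} (E.sym {g E.* (g′ E.* y)} {y} (cancel-inverse gg′ y)) s ,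
      E.sym {g E.* (g′ E.* y)} {y} (cancel-inverse gg′ y)) ,
    λ {y} (z , s , y≈) → J-resp {g E.* z} {y} (E.sym {y} {g E.* z} y≈) s

  𝒪E-* : ∀ {y z} → 𝒪E y → 𝒪E z → 𝒪E (y E.* z)
  𝒪E-* (u∈ , e∈) (u′∈ , e′∈) = ∈-*ˡ u∈ u′∈ , VE.≤v-* {+ 0} {+ 0} e∈ e′∈

  𝒪E-Δπ^ : ∀ k → 𝒪E (Δ (π ^ k))
  𝒪E-Δπ^ k = ∈⇒𝒪 (π^∈ k) , VE.≤v-cong (E′.sym (κ-ι (π ^ k))) (κ-even 0 (∈⇒𝒪 (π^∈ k)) ≤v-0)

  Δ-* : ∀ a b → Δ (a * b) E.≈ Δ a E.* Δ b
  Δ-* a b = refl , *-homo a b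

  private
    𝒪E-Δπ^-weaken : ∀ {k l y} → k ℕ.≤ l → 𝒪E (Δ (π ^ k) E.* y) → 𝒪E (Δ (π ^ l) E.* y)
    𝒪E-Δπ^-weaken {k} {l} {y} k≤l h =
      let (h₁ , h₂) = 𝒪E-* {Δ (π ^ (l ℕ.∸ k))} {Δ (π ^ k) E.* y} (𝒪E-Δπ^ (l ℕ.∸ k)) h
          (e₁ , e₂) = eq
      in ≤v-cong e₁ h₁ , VE.≤v-cong e₂ h₂
      where
      eq : Δ (π ^ (l ℕ.∸ k)) E.* (Δ (π ^ k) E.* y) E.≈ Δ (π ^ l) E.* y
      eq = E.trans {Δ (π ^ (l ℕ.∸ k)) E.* (Δ (π ^ k) E.* y)} {(Δ (π ^ (l ℕ.∸ k)) E.* Δ (π ^ k)) E.* y}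
        (E.sym {(Δ (π ^ (l ℕ.∸ k)) E.* Δ (π ^ k)) E.* y} (E.*-assoc (Δ (π ^ (l ℕ.∸ k))) (Δ (π ^ k)) y))
        (E.*-congʳ {y} {Δ (π ^ (l ℕ.∸ k)) E.* Δ (π ^ k)} {Δ (π ^ l)}
          (E.trans {Δ (π ^ (l ℕ.∸ k)) E.* Δ (π ^ k)} {Δ (π ^ (l ℕ.∸ k) * π ^ k)} {Δ (π ^ l)}
            (E.sym {Δ (π ^ (l ℕ.∸ k) * π ^ k)} (Δ-* (π ^ (l ℕ.∸ k)) (π ^ k)))
            (sym (π^-∸ k≤l) , ι-cong (sym (π^-∸ k≤l)))))

  denominator-E : ∀ y → ∃ λ k → 𝒪E (Δ (π ^ k) E.* y)
  denominator-E y =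
    let (u , p , r , y≈) = ε-surjective y
        (k₁ , h₁) = denominator u
        (k₂ , h₂) = denominator p
        (k₃ , h₃) = denominator r
        k = k₁ ℕ.+ (k₂ ℕ.+ k₃)
        (h , h′) = 𝒪E-ε (denominator-weaken {u} {k₁} {k} (ℕ.m≤m+n k₁ _) h₁)
             (denominator-weaken {p} {k₂} {k} (ℕ.≤-trans (ℕ.m≤m+n k₂ k₃) (ℕ.m≤n+m _ k₁)) h₂)
             (denominator-weaken {r} {k₃} {k} (ℕ.≤-trans (ℕ.m≤n+m k₃ k₂) (ℕ.m≤n+m _ k₁)) h₃)
        (e , e′) = E.sym {Δ (π ^ k) E.* y} {ε (π ^ k * u) (π ^ k * p) (π ^ k * r)}
          (E.trans {Δ (π ^ k) E.* y} {Δ (π ^ k) E.* ε u p r} (E.*-congˡ {Δ (π ^ k)} {y} {ε u p r} y≈) (ε-scale (π ^ k) u p r))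
    in k , ≤v-cong e h , VE.≤v-cong e′ h′

  private
    denominators : ∀ n (g : Fin n → E.Carrier) → ∃ λ k → ∀ i → 𝒪E (Δ (π ^ k) E.* g i)
    denominators zero g = 0 , λ ()
    denominators (suc n) g =
      let (k , h) = denominator-E (g fzero)
          (l , hs) = denominators n (g ∘ fsuc)
      in k ℕ.+ l , λ { fzero → 𝒪E-Δπ^-weaken {k} {k ℕ.+ l} {g fzero} (ℕ.m≤m+n k l) h
                     ; (fsuc i) → 𝒪E-Δπ^-weaken {l} {k ℕ.+ l} {g (fsuc i)} (ℕ.m≤n+m l k) (hs i) }

  bounded : ∀ {R S} → R ⊆ 𝒪E → IsFinitelyGenerated R S → ∃ λ k → ∀ y → S y → 𝒪E (Δ (π ^ k) E.* y)
  bounded {R} {S} R⊆𝒪E (n , g , S⊆ , _) =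
    let (k , gs) = denominators n g
    in k , λ y s → member k gs y (S⊆ s)
    where
    member : ∀ k → (∀ i → 𝒪E (Δ (π ^ k) E.* g i)) → ∀ y → Combinations R g y → 𝒪E (Δ (π ^ k) E.* y)
    member k gs y (a , as , y≈) =
      let (h , h′) = sum-closed (λ z → 𝒪E (Δ (π ^ k) E.* z)) zero∈ plus∈ n (λ i → a i E.* g i) term∈
          (e , e′) = E.*-congˡ {Δ (π ^ k)} {sum (λ i → a i E.* g i)} {y} (E.sym {y} {sum (λ i → a i E.* g i)} y≈)
      in ≤v-cong e h , VE.≤v-cong e′ h′
      where
      zero∈ : 𝒪E (Δ (π ^ k) E.* E.0#)
      zero∈ = ≤v-cong (sym (zeroʳ _)) ≤v-0 , VE.≤v-cong (E′.sym (E′.zeroʳ _)) VE.≤v-0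
      plus∈ : ∀ y z → 𝒪E (Δ (π ^ k) E.* y) → 𝒪E (Δ (π ^ k) E.* z) → 𝒪E (Δ (π ^ k) E.* (y E.+ z))
      plus∈ y z (h , h′) (i , i′) = ≤v-cong (sym (distribˡ _ _ _)) (≤v-+ h i) , VE.≤v-cong (E′.sym (E′.distribˡ _ _ _)) (VE.≤v-+ h′ i′)
      term∈ : ∀ i → 𝒪E (Δ (π ^ k) E.* (a i E.* g i))
      term∈ i =
        let (h , h′) = 𝒪E-* {a i} {Δ (π ^ k) E.* g i} (R⊆𝒪E (as i)) (gs i)
            (e , e′) = swap-left (a i) (Δ (π ^ k)) (g i)
        in ≤v-cong e h , VE.≤v-cong e′ h′

  -- An 𝔬-linear function that vanishes on generators vanishes, whence neither projection of a full module is zero.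
  first≉0 : ∀ {S} → SpansE S → ∃ λ y → S y × ¬ (proj₁ y ≈ 0#)
  first≉0 {S} spans with em {P = ∃ λ y → S y × ¬ (proj₁ y ≈ 0#)}
  ... | yes p = p
  ... | no ¬p = ⊥-elim (vanishing (spans E.1#))
    where
    all≈0 : ∀ y → S y → proj₁ y ≈ 0#
    all≈0 y s with em {P = proj₁ y ≈ 0#}
    ... | yes q = q
    ... | no ¬q = ⊥-elim (¬p (y , s , ¬q))
    vanishing : ¬ ((ΔF · S) E.1#)
    vanishing (n , g , gs , a , as , 1≈) = F.1≉0 (trans (proj₁ 1≈)
      (sum-closed (λ z → proj₁ z ≈ 0#) refl (λ y z h h′ → trans (+-cong h h′) (+-identityˡ _)) n (λ i → a i E.* g i)
        (λ i → trans (*-congˡ (all≈0 (g i) (gs i))) (zeroʳ _))))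

  second≉0 : ∀ {S} → SpansE S → ∃ λ y → S y × ¬ (proj₂ y E′.≈ E′.0#)
  second≉0 {S} spans with em {P = ∃ λ y → S y × ¬ (proj₂ y E′.≈ E′.0#)}
  ... | yes p = p
  ... | no ¬p = ⊥-elim (vanishing (spans E.1#))
    where
    all≈0 : ∀ y → S y → proj₂ y E′.≈ E′.0#
    all≈0 y s with em {P = proj₂ y E′.≈ E′.0#}
    ... | yes q = q
    ... | no ¬q = ⊥-elim (¬p (y , s , ¬q))
    vanishing : ¬ ((ΔF · S) E.1#)
    vanishing (n , g , gs , a , as , 1≈) = E′.1≉0 (E′.trans (proj₂ 1≈)
      (sum-closed (λ z → proj₂ z E′.≈ E′.0#) E′.refl (λ y z h h′ → E′.trans (E′.+-cong h h′) (E′.+-identityˡ _)) n (λ i → a i E.* g i)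
        (λ i → E′.trans (E′.*-congˡ (all≈0 (g i) (gs i))) (E′.zeroʳ _))))

  Full : Subset → Set (c ⊔ ℓ)
  Full S = ∃ λ k → ∀ {p r} → p ∈π^ k → r ∈π^ k → S (ε 0# p r)

  -- If y in S has second coordinate e ≠ 0, then (0, κ p r) is (0, κ p r e⁻¹) times y. The
  -- multiplier lies in R once p and r are divisible enough to clear the denominators of e⁻¹ with
  -- π^f₂ to spare.
  full-submodule : ∀ {R S f₂} → R Respects E._≈_ → (∀ {p r} → p ∈π^ f₂ → r ∈π^ f₂ → R (ε 0# p r)) → IsSubmodule R S →
                   (∃ λ y → S y × ¬ (proj₂ y E′.≈ E′.0#)) → Full S
  full-submodule {R} {S} {f₂} R-respects R-full isS (y , s , e≉0) =
    let (e′ , _ , ee′) = E′.invertible (proj₂ y) e≉0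
        (p′ , r′ , e′≈) = κ-surjective e′
        (k₁ , h₁) = denominator p′
        (k₂ , h₂) = denominator r′
        k = k₁ ℕ.+ k₂
    in k ℕ.+ f₂ , λ {p} {r} p∈ r∈ →
      lemma e′ ee′ p′ r′ e′≈ k (denominator-weaken {p′} {k₁} {k} (ℕ.m≤m+n k₁ k₂) h₁) (denominator-weaken {r′} {k₂} {k} (ℕ.m≤n+m k₂ k₁) h₂) p∈ r∈
    where
    open IsSubmodule isS
    lemma : ∀ e′ → proj₂ y E′.* e′ E′.≈ E′.1# → ∀ p′ r′ → e′ E′.≈ κ p′ r′ → ∀ k → 𝒪 (π ^ k * p′) → 𝒪 (π ^ k * r′) →
            ∀ {p r} → p ∈π^ k ℕ.+ f₂ → r ∈π^ k ℕ.+ f₂ → S (ε 0# p r)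
    lemma e′ ee′ p′ r′ e′≈ k p′∈ r′∈ {p} {r} p∈ r∈ =
      resp {(0# , κ p r E′.* e′) E.* y} {ε 0# p r}
        (zeroˡ _ , E′.trans (E′.*-assoc _ _ _) (E′.trans (E′.*-congˡ (E′.trans (E′.*-comm _ _) ee′)) (E′.*-identityʳ _)))
        (*-closed {0# , κ p r E′.* e′} {y} (R-resp (R-full (≤v-sub (times p∈ p′∈) (∈-*ˡ (∈⇒𝒪 D∈) (times r∈ r′∈)))
          (≤v-+ (≤v-+ (times p∈ r′∈) (times r∈ p′∈)) (∈-*ˡ (∈⇒𝒪 T∈) (times r∈ r′∈))))) s)
      where
      times : ∀ {a b} → a ∈π^ k ℕ.+ f₂ → 𝒪 (π ^ k * b) → a * b ∈π^ f₂
      times {a} {b} a∈ b∈ =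
        let (t , t∈ , a≈) = divide {a} {k ℕ.+ f₂} a∈
        in ≤v-cong (sym (trans (*-congʳ (trans a≈ (*-congˡ (π^-+ k f₂))))
             (solve 4 (λ t y z b → t :* (y :* z) :* b := (t :* (y :* b)) :* z) refl t (π ^ k) (π ^ f₂) b)))
           (∈-*ˡ (∈-*ˡ t∈ b∈) (π^∈ f₂))
      R-resp : R (ε 0# (p * p′ - D * (r * r′)) (p * r′ + r * p′ + T * (r * r′))) → R (0# , κ p r E′.* e′)
      R-resp = R-respects (refl , E′.sym (E′.trans (E′.*-congˡ e′≈) (κ-* p r p′ r′)))

-- Every fractional ideal is a multiple of an order or of a dual

module Surjectivity (em : ∀ {a} → ExcludedMiddle a) {c ℓ} (setting : QuadraticSetting c ℓ) where
  open Coordinates setting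
  open NormalForms em setting
  open DualForms em setting
  open Reduction em setting
  open Cancellation E′.commutativeRing
  private module VEx = VE.Uniformized x x-uniformizer

  -- The minimum is found as the least natural number i for which some element lies outside x^(i+1)
  -- 𝒪E′; such an element has valuation exactly i.
  minimal-valuation : ∀ {a} (Q : Pred E′.Carrier a) → (∀ {e} → Q e → E′.𝒪 e) → (∃₂ λ e k → Q e × ¬ (e VE.∈π^ k)) →
    ∃₂ λ i e → Q e × E′.v e ≡ [ + i ] × (∀ {e} → Q e → e VE.∈π^ i)
  minimal-valuation Q Q⊆𝒪 (e , zero , q , e∉) = ⊥-elim (e∉ (Q⊆𝒪 q))
  minimal-valuation {a} Q Q⊆𝒪 (e , suc k , q , e∉) =
    let (i , (e₀ , q₀ , e₀∉) , minimal) = least em (λ i → ∃ λ e → Q e × ¬ (e VE.∈π^ suc i)) (k , e , q , e∉)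
    in i , e₀ , q₀ , VE.v-exact (all i minimal q₀) (≡.subst (λ j → ¬ (j VE.≤v e₀)) (≡.cong +_ (ℕ.+-comm 1 i)) e₀∉) , all i minimal
    where
    all : ∀ i → (∀ j → (∃ λ e → Q e × ¬ (e VE.∈π^ suc j)) → i ℕ.≤ j) → ∀ {e} → Q e → e VE.∈π^ i
    all zero minimal q = Q⊆𝒪 q
    all (suc i) minimal {e} q with VE.≤v? (+ suc i) e
    ... | yes h = h
    ... | no ¬h = ⊥-elim (ℕ.1+n≰n (minimal i (e , q , ¬h)))

  module _ {S : Subset} {g : E.Carrier} (S-resp : S Respects E._≈_) (g-inv : Invertible g) where
    private
      g′ = proj₁ g-inv
      gg′ = proj₂ (proj₂ g-inv)

    pre-member : ∀ y → S y → pre g S (g′ E.* y)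
    pre-member y = S-resp {y} {g E.* (g′ E.* y)} (E.sym {g E.* (g′ E.* y)} {y}
      (Cancellation.cancel-inverse E gg′ y))

    pre-first≉0 : (∃ λ y → S y × ¬ (proj₁ y ≈ 0#)) → ∃ λ y → pre g S y × ¬ (proj₁ y ≈ 0#)
    pre-first≉0 (y , s , ≉0) = g′ E.* y , pre-member y s , λ ≈0 → ≉0
      (trans (sym (*-identityˡ _)) (trans (*-congʳ (sym (proj₁ gg′))) (trans (*-assoc _ _ _) (trans (*-congˡ ≈0) (zeroʳ _)))))

    pre-second≉0 : (∃ λ y → S y × ¬ (proj₂ y E′.≈ E′.0#)) → ∃ λ y → pre g S y × ¬ (proj₂ y E′.≈ E′.0#)
    pre-second≉0 (y , s , ≉0) = g′ E.* y , pre-member y s , λ ≈0 → ≉0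
      (E′.trans (E′.sym (E′.*-identityˡ _)) (E′.trans (E′.*-congʳ (E′.sym (proj₂ gg′))) (E′.trans (E′.*-assoc _ _ _) (E′.trans (E′.*-congˡ ≈0) (E′.zeroʳ _)))))

  module _ {R : Subset} (isOrder : IsOrder R) (R⊆𝒪E : R ⊆ 𝒪E) {b f f₂ : ℕ} {γ : Carrier}
           (conductor : IsConductorExponents R π x f f₂) (R≐ : R ≐ Over b f γ) where
    open IsOrder isOrder using (𝔬⊆; isSubring)

    private
      R-full : ∀ {p r} → p ∈π^ f₂ → r ∈π^ f₂ → R (ε 0# p r)
      R-full = ConductorOrder.full isOrder R⊆𝒪E {f} {f₂} conductor

      restrict : ∀ {S} → IsSubmodule R S → IsSubmodule Δ𝔬 S
      restrict isS = record { resp = resp ; 0∈ = 0∈ ; +-closed = +-closed ; *-closed = λ a∈ → *-closed (𝔬⊆ a∈) }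
        where open IsSubmodule isS

    Classified : Subset → Set (c ⊔ ℓ)
    Classified J =
      (∃₂ λ m a → ∃ λ β → 𝒪 β × norm m β ∈π^ a × Compatible b f γ m a β × Similar (Over m a β) J) ⊎
      (∃₂ λ m a → ∃ λ β → 𝒪 β × 1 ℕ.≤ a × norm m β ∈π^ suc a × Compatible b f γ m a β × Similar (Dual m a β) J)

    classified-pre : ∀ {J g} → J Respects E._≈_ → Invertible g → Classified (pre g J) → Classified J
    classified-pre {J} {g} J-resp g-inv (inj₁ (m , a , β , β∈ , N∈ , compatible , similar)) =
      inj₁ (m , a , β , β∈ , N∈ , compatible , similar-trans {Over m a β} {pre g J} {J} similar (similar-pre {J} {g} J-resp g-inv))
    classified-pre {J} {g} J-resp g-inv (inj₂ (m , a , β , β∈ , a≥1 , N∈ , compatible , similar)) =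
      inj₂ (m , a , β , β∈ , a≥1 , N∈ , compatible , similar-trans {Dual m a β} {pre g J} {J} similar (similar-pre {J} {g} J-resp g-inv))

    private
      module Normalised {S : Subset} (isS : IsSubmodule R S) (S⊆𝒪E : S ⊆ 𝒪E) (1∈ : S (ε 1# 1# 0#)) where
        open IsSubmodule isS using (resp; *-closed)
        open 𝔬-Submodule (restrict isS)

        R⊆S : R ⊆ S
        R⊆S {y} r = resp {y E.* ε 1# 1# 0#} {y} (E.trans {y E.* ε 1# 1# 0#} {y E.* E.1#} {y}
          (E.*-congˡ {y} {ε 1# 1# 0#} {E.1#} (E.sym {E.1#} {ε 1# 1# 0#} ε-1)) (E.*-identityʳ y)) (*-closed {y} r 1∈)

        integral : ∀ {u p r} → S (ε u p r) → 𝒪 u × 𝒪 p × 𝒪 r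
        integral s = 𝒪E-ε⁻¹ (S⊆𝒪E s)

        full-S : ∀ {p r} → p ∈π^ f₂ → r ∈π^ f₂ → S (ε 0# p r)
        full-S p∈ r∈ = R⊆S (R-full p∈ r∈)

        projection = projection-form (restrict isS) 1∈ {k = f₂} (λ s → proj₂ (integral s)) (full-S ≤v-0 (π^∈ f₂))

        m : ℕ
        m = proj₁ projection

        ∈π^m : ∀ {u p r} → S (ε u p r) → r ∈π^ m
        ∈π^m = proj₁ (proj₂ projection)

        u₀ : Carrier
        u₀ = proj₁ (proj₂ (proj₂ projection))

        s₀ : S (ε u₀ 0# (π ^ m))
        s₀ = proj₂ (proj₂ (proj₂ projection))

        ∈M : ∀ {p r} → 𝒪 p → r ∈π^ m → ∃ λ u → S (ε u p r)
        ∈M {p} {r} p∈ r∈ = let (w , w∈ , r≈) = divide {r} {m} r∈ in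
          p * 1# + w * u₀ , S-resp refl (solve 2 (λ p w → p :* :1 :+ w :* :0 := p) refl p w)
            (trans (solve 3 (λ p w z → p :* :0 :+ w :* z := w :* z) refl p w (π ^ m)) (sym r≈))
            (S-+* w∈ (S-* p∈ 1∈) s₀)

        -- As π^m x generates R_m over 𝔬, this says that N is an R_m-module, the condition that
        -- separates the two families.
        Stable : Set (c ⊔ ℓ)
        Stable = ∀ e → S (0# , e) → S (0# , κ 0# (π ^ m) E′.* e)

        over-case : Stable → Classified S
        over-case stable =
          let (a , β , β∈ , N∈ , _ , S⊆ , ⊆S) = over-form (restrict isS) 1∈ {m} {f₂} {u₀}
                (λ s → let (u∈ , p∈ , _) = integral s in u∈ , p∈ , ∈π^m s) s₀ stable′ (full-S (π^∈ f₂) ≤v-0)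
          in inj₁ (m , a , β , β∈ , N∈ , over-compatible (λ y∈ → S⊆ (R⊆S (proj₂ R≐ y∈))) ,
               similar-≐ {Over m a β} {S} resp (⊆S , S⊆))
          where
          stable′ : ∀ {p r} → S (ε 0# p r) → S (ε 0# (- (D * (π ^ m * r))) (π ^ m * p + T * (π ^ m * r)))
          stable′ {p} {r} s = S-resp refl
            (solve 4 (λ p r z D → :0 :* p :- D :* (z :* r) := :- (D :* (z :* r))) refl p r (π ^ m) D)
            (solve 4 (λ p r z T → :0 :* r :+ z :* p :+ T :* (z :* r) := z :* p :+ T :* (z :* r)) refl p r (π ^ m) T)
            (resp (refl , κ-* 0# (π ^ m) p r) (stable (κ p r) s))

        module Unstable (¬stable : ¬ Stable) where

          -- The search starts from π^f₂, an element of N of finite valuation 2 f₂.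
          minimum = minimal-valuation (λ e → S (0# , e)) (λ s → proj₂ (S⊆𝒪E s))
            (κ (π ^ f₂) 0# , suc (f₂ ℕ.+ f₂) , full-S (π^∈ f₂) ≤v-0 ,
              λ h → ℕ.1+n≰n {f₂} (π^-≤ {suc f₂} {f₂} (proj₁ (κ-odd⁻¹ f₂ h))))

          e₁ : E′.Carrier
          e₁ = proj₁ (proj₂ minimum)

          e₁-val : E′.v e₁ ≡ [ + proj₁ minimum ]
          e₁-val = proj₁ (proj₂ (proj₂ (proj₂ minimum)))

          inverse₁ : ∃ λ w → e₁ E′.* w E′.≈ E′.1# × E′.v w ≡ [ ℤ.- + proj₁ minimum ]
          inverse₁ = VEx.inverse e₁-val

          e₁⁻¹ : E′.Carrier
          e₁⁻¹ = proj₁ inverse₁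

          e₁e₁⁻¹ : e₁ E′.* e₁⁻¹ E′.≈ E′.1#
          e₁e₁⁻¹ = proj₁ (proj₂ inverse₁)

          g : E.Carrier
          g = 1# , e₁

          g-invertible : Invertible g
          g-invertible = invertible-pair (*-identityˡ 1#) e₁e₁⁻¹

          S₁ : Subset
          S₁ = pre g S

          isS₁ : IsSubmodule R S₁
          isS₁ = pre-submodule isS g

          open 𝔬-Submodule (restrict isS₁) using () renaming (S-resp to S₁-resp; S-* to S₁-*; S-+* to S₁-+*; S-sub* to S₁--*)

          undo : ∀ e → e₁ E′.* (e₁⁻¹ E′.* e) E′.≈ e
          undo = cancel-inverse e₁e₁⁻¹

          integral₁ : ∀ {p r} → S₁ (ε 0# p r) → 𝒪 p × 𝒪 r
          integral₁ {p} {r} s = κ-even⁻¹ 0 (VE.≤v-cancel {+ 0} e₁-val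
            (VE.≤v-cong (E′.*-comm e₁ (κ p r)) (proj₂ (proj₂ (proj₂ (proj₂ minimum))) (resp (*-identityˡ 0# , E′.refl) s))))

          u-integral₁ : ∀ {u p r} → S₁ (ε u p r) → 𝒪 u
          u-integral₁ s = ≤v-cong (*-identityˡ _) (proj₁ (S⊆𝒪E s))

          0,1∈ : S₁ (ε 0# 1# 0#)
          0,1∈ = resp (sym (*-identityˡ 0#) , E′.sym (E′.trans (E′.*-congˡ (E′.trans (E′.sym (κ-ι 1#)) 1#-homo)) (E′.*-identityʳ e₁)))
            (proj₁ (proj₂ (proj₂ minimum)))

          full₁ : Full S₁
          full₁ = full-submodule {R} {S₁} {f₂} (IsSubring.resp isSubring) R-full isS₁
            (pre-second≉0 {S} {g} resp g-invertible (ε 1# 1# 0# , 1∈ , λ h → E′.1≉0 (E′.trans (E′.sym (E′.trans (E′.sym (κ-ι 1#)) 1#-homo)) h)))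

          n-minimum : ∃ λ n → S₁ (ε 0# 0# (π ^ n)) × (∀ j → S₁ (ε 0# 0# (π ^ j)) → n ℕ.≤ j)
          n-minimum = least em (λ j → S₁ (ε 0# 0# (π ^ j))) (proj₁ full₁ , proj₂ full₁ ≤v-0 (π^∈ (proj₁ full₁)))

          n : ℕ
          n = proj₁ n-minimum

          ∈π^n : ∀ {p r} → S₁ (ε 0# p r) → r ∈π^ n
          ∈π^n {p} {r} s = ∈-unless (proj₂ (integral₁ s)) λ {i} {w} i<n w∈ rw →
            ℕ.<⇒≱ i<n (proj₂ (proj₂ n-minimum) i (S₁-resp
              (solve 2 (λ w p → w :* (:0 :- p :* :0) := :0) refl w p)
              (solve 2 (λ w p → w :* (p :- p :* :1) := :0) refl w p)
              (trans (solve 3 (λ w p r → w :* (r :- p :* :0) := r :* w) refl w p r) rw)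
              (S₁-* w∈ (S₁--* (proj₁ (integral₁ s)) s 0,1∈))))

          ∈N : ∀ {p r} → 𝒪 p → r ∈π^ n → S₁ (ε 0# p r)
          ∈N {p} {r} p∈ r∈ =
            let (w , w∈ , r≈) = divide {r} {n} r∈
            in S₁-resp (solve 2 (λ p w → p :* :0 :+ w :* :0 := :0) refl p w)
              (solve 2 (λ p w → p :* :1 :+ w :* :0 := p) refl p w)
              (trans (solve 3 (λ p w z → p :* :0 :+ w :* z := w :* z) refl p w (π ^ n)) (sym r≈))
              (S₁-+* w∈ (S₁-* p∈ 0,1∈) (proj₁ (proj₂ n-minimum)))

          -- N is e₁ R_n, and for n ≤ m the ring R_n contains R_m, so N would be stable after all.
          n≰m : ¬ (n ℕ.≤ m)
          n≰m n≤m = ¬stable λ e s → stable-at e s (κ-surjective (e₁⁻¹ E′.* e))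
            where
            stable-at : ∀ e → S (0# , e) → (∃₂ λ p r → e₁⁻¹ E′.* e E′.≈ κ p r) → S (0# , κ 0# (π ^ m) E′.* e)
            stable-at e s (p , r , eq) =
              let s₁ = resp {0# , e} {g E.* ε 0# p r}
                    (sym (*-identityˡ 0#) , E′.sym (E′.trans (E′.*-congˡ (E′.sym eq)) (undo e))) s
                  (p∈ , _) = integral₁ s₁
                  r∈ = ∈π^n s₁
                  t = ∈N {0# * p - D * (π ^ m * r)} {0# * r + π ^ m * p + T * (π ^ m * r)}
                    (≤v-sub (∈-*ˡ {0} ≤v-0 p∈) (∈-*ˡ (∈⇒𝒪 D∈) (∈-*ˡ (∈⇒𝒪 (π^∈ m)) (∈⇒𝒪 r∈))))
                    (≤v-+ (≤v-+ (∈-*ˡ ≤v-0 r∈) (∈-*ʳ (∈-weaken n≤m (π^∈ m)) p∈)) (∈-*ˡ (∈⇒𝒪 T∈) (∈-*ˡ (∈⇒𝒪 (π^∈ m)) r∈)))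
              in resp {g E.* ε 0# (0# * p - D * (π ^ m * r)) (0# * r + π ^ m * p + T * (π ^ m * r))} {0# , κ 0# (π ^ m) E′.* e}
                (*-identityˡ 0# , E′.trans (E′.*-congˡ (E′.trans (E′.sym (κ-* 0# (π ^ m) p r)) (E′.*-congˡ (E′.sym eq))))
                  (swap (κ 0# (π ^ m)) e)) t
              where
              swap : ∀ X e → e₁ E′.* (X E′.* (e₁⁻¹ E′.* e)) E′.≈ X E′.* e
              swap X e = E′.trans (swap-left e₁ X _) (E′.*-congˡ (undo e))

          -- The projection of `S` is the ring R_m, which contains π^n′ x as m ≤ n′, and
          -- multiplication by it commutes with division by `e₁`.
          stable₁ : ∀ {n′} → m ℕ.≤ n′ → ∀ {u p r} → S₁ (ε u p r) →
                    ∃ λ u′ → S₁ (ε u′ (- (D * (π ^ n′ * r))) (π ^ n′ * p + T * (π ^ n′ * r)))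
          stable₁ {n′} m≤n′ {u} {p} {r} s = go (κ-surjective (e₁ E′.* κ p r))
            where
            go : (∃₂ λ p′ r′ → e₁ E′.* κ p r E′.≈ κ p′ r′) → _
            go (p′ , r′ , eq) =
              let s′ = resp {g E.* ε u p r} {ε (1# * u) p′ r′} (refl , eq) s
                  (_ , p′∈ , _) = integral s′
                  r′∈ = ∈π^m s′
                  (u″ , t) = ∈M {0# * p′ - D * (π ^ n′ * r′)} {0# * r′ + π ^ n′ * p′ + T * (π ^ n′ * r′)}
                    (≤v-sub (∈-*ˡ {0} ≤v-0 p′∈) (∈-*ˡ (∈⇒𝒪 D∈) (∈-*ˡ (∈⇒𝒪 (π^∈ n′)) (∈⇒𝒪 r′∈))))
                    (≤v-+ (≤v-+ (∈-*ˡ ≤v-0 r′∈) (∈-*ʳ (∈-weaken m≤n′ (π^∈ n′)) p′∈)) (∈-*ˡ (∈⇒𝒪 T∈) (∈-*ˡ (∈⇒𝒪 (π^∈ n′)) r′∈)))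
              in u″ , resp {ε u″ (0# * p′ - D * (π ^ n′ * r′)) (0# * r′ + π ^ n′ * p′ + T * (π ^ n′ * r′))}
                   {g E.* ε u″ (- (D * (π ^ n′ * r))) (π ^ n′ * p + T * (π ^ n′ * r))}
                   (sym (*-identityˡ u″) , E′.trans (E′.sym (κ-* 0# (π ^ n′) p′ r′)) (E′.trans (E′.*-congˡ (E′.sym eq))
                     (E′.trans (swap-left (κ 0# (π ^ n′)) e₁ _) (E′.*-congˡ (E′.trans (κ-* 0# (π ^ n′) p r) (κ-cong
                         (solve 4 (λ p r z D → :0 :* p :- D :* (z :* r) := :- (D :* (z :* r))) refl p r (π ^ n′) D)
                         (solve 4 (λ p r z T → :0 :* r :+ z :* p :+ T :* (z :* r) := z :* p :+ T :* (z :* r)) refl p r (π ^ n′) T)))))))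
                   t

          module Dualise {n′ : ℕ} (n≡ : n ≡ suc n′) where

            N∈ : ∀ {p r} → S₁ (ε 0# p r) → 𝒪 p × r ∈π^ suc n′
            N∈ {p} {r} s = proj₁ (integral₁ s) , ≡.subst (r ∈π^_) n≡ (∈π^n s)

            ∈N′ : ∀ {p r} → 𝒪 p → r ∈π^ suc n′ → S₁ (ε 0# p r)
            ∈N′ {p} {r} p∈ r∈ = ∈N p∈ (≡.subst (r ∈π^_) (≡.sym n≡) r∈)

            m≤n′ : m ℕ.≤ n′
            m≤n′ = ℕ.≤-pred (≡.subst (suc m ℕ.≤_) n≡ (ℕ.≰⇒> n≰m))

            start : ∀ {p r} → e₁⁻¹ E′.≈ κ p r → S₁ (ε 1# p r)
            start {p} {r} eq = resp {ε 1# 1# 0#} {g E.* ε 1# p r} (sym (*-identityˡ 1#) ,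
              E′.sym (E′.trans (E′.*-congˡ (E′.sym eq)) (E′.trans e₁e₁⁻¹ (E′.trans (E′.sym 1#-homo) (κ-ι 1#))))) 1∈

            module Finish (a : ℕ) (β z z⁻¹ : Carrier) (zz⁻¹ : z * z⁻¹ ≈ 1#)
                (to : ∀ {u p r} → S₁ (ε u (z * p) (z * r)) → Dual (suc n′) a β (ε u p r))
                (from : ∀ {u p r} → Dual (suc n′) a β (ε u p r) → S₁ (ε u (z * p) (z * r))) where
              h : E.Carrier
              h = 1# , ι z

              h-invertible : Invertible h
              h-invertible = invertible-pair (*-identityˡ 1#) (E′.trans (E′.sym (*-homo z z⁻¹)) (E′.trans (ι-cong zz⁻¹) 1#-homo))

              S₂ : Subset
              S₂ = pre h S₁

              isS₂ : IsSubmodule R S₂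
              isS₂ = pre-submodule isS₁ h

              h-ε : ∀ u p r → h E.* ε u p r E.≈ ε u (z * p) (z * r)
              h-ε u p r = *-identityˡ u , proj₂ (ε-scale z u p r)

              S₂⊆ : S₂ ⊆ Dual (suc n′) a β
              S₂⊆ {y} s = let (u , p , r , y≈) = ε-surjective y in
                Dual-resp (E.sym {y} {ε u p r} y≈) (to (IsSubmodule.resp isS₁ {h E.* ε u p r} {ε u (z * p) (z * r)} (h-ε u p r) (IsSubmodule.resp isS₂ {y} {ε u p r} y≈ s)))

              ⊆S₂ : Dual (suc n′) a β ⊆ S₂
              ⊆S₂ {y} s = let (u , p , r , y≈) = ε-surjective y in
                IsSubmodule.resp isS₂ {ε u p r} {y} (E.sym {y} {ε u p r} y≈)
                  (IsSubmodule.resp isS₁ {ε u (z * p) (z * r)} {h E.* ε u p r} (E.sym {h E.* ε u p r} {ε u (z * p) (z * r)} (h-ε u p r)) (from (Dual-resp y≈ s)))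

              closed : ∀ {y y′} → Over b f γ y → Dual (suc n′) a β y′ → Dual (suc n′) a β (y E.* y′)
              closed {y} {y′} r s = S₂⊆ {y E.* y′} (IsSubmodule.*-closed isS₂ {y} {y′} (proj₂ R≐ r) (⊆S₂ s))

              finish : 𝒪 β → 1 ℕ.≤ a → norm (suc n′) β ∈π^ suc a → Classified S₁
              finish β∈ a≥1 N∈ = classified-pre {S₁} {h} (λ {y} {z} → IsSubmodule.resp isS₁ {y} {z}) h-invertible
                (inj₂ (suc n′ , a , β , β∈ , a≥1 , N∈ ,
                  dual-compatible {b} {f} {γ} {suc n′} {a} {β} (λ {y} {z} → closed {y} {z}) ,
                  similar-≐ {Dual (suc n′) a β} {S₂} (λ {y} {z} → IsSubmodule.resp isS₂ {y} {z}) ((λ {y} → ⊆S₂ {y}) , (λ {y} → S₂⊆ {y}))))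

            classified₁ : (∃₂ λ p r → e₁⁻¹ E′.≈ κ p r) → Classified S₁
            classified₁ (p , r , eq) =
              let (a , β , z , z⁻¹ , zz⁻¹ , a≥1 , β∈ , N∈′ , to , from) =
                    dual-form {S₁} (restrict isS₁) {n′} N∈ ∈N′ u-integral₁ (stable₁ m≤n′) {p} {r} (start eq)
              in Finish.finish a β z z⁻¹ zz⁻¹ to from β∈ a≥1 N∈′

          dual-case : Classified S
          dual-case = classified-pre {S} {g} resp g-invertible (split n ≡.refl)
            where
            split : ∀ k → n ≡ k → Classified S₁
            split zero n≡ = ⊥-elim (n≰m (≡.subst (ℕ._≤ m) (≡.sym n≡) z≤n))
            split (suc n′) n≡ = Dualise.classified₁ n≡ (κ-surjective e₁⁻¹)

        classified : Classified S
        classified = decide em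
          where
          decide : Dec Stable → Classified S
          decide (yes stable) = over-case stable
          decide (no ¬stable) = Unstable.dual-case ¬stable

      module Integral {S : Subset} (isS : IsSubmodule R S) (S⊆𝒪E : S ⊆ 𝒪E)
          (nonzero₂ : ∃ λ y → S y × ¬ (proj₂ y E′.≈ E′.0#)) {e₀ : E′.Carrier} (s₀ : S (1# , e₀)) where
        open IsSubmodule isS using (resp)

        minimum = minimal-valuation (λ e → ∃ λ u → S (u , e)) (λ (u , s) → proj₂ (S⊆𝒪E s))
          (let ((u , e) , s , e≉0) = nonzero₂ ; (k , e∉) = VEx.nonzero e≉0 in e , k , (u , s) , e∉)

        i : ℕ
        i = proj₁ minimum

        lower-bound : ∀ {u e} → S (u , e) → e VE.∈π^ i
        lower-bound {u} s = proj₂ (proj₂ (proj₂ (proj₂ minimum))) (u , s)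

        -- A minimal valuation in the projection to E′ is attained by some (1 , e): if (1 , e₀) misses it and
        -- (u₁ , e₁) attains it, then so does (1 , e₁ + (1 - u₁) e₀).
        module Adjust (i : ℕ) {u₁ : Carrier} {e₁ : E′.Carrier} (s₁ : S (u₁ , e₁)) (v₁ : E′.v e₁ ≡ [ + i ])
            (bound : ∀ {e} → (∃ λ u → S (u , e)) → e VE.∈π^ i) where

          exact : ∀ {e} → S (1# , e) → ¬ (e VE.∈π^ suc i) → E′.v e ≡ [ + i ]
          exact {e} s e∉ = VE.v-exact (bound (1# , s)) (≡.subst (λ j → ¬ (j VE.≤v e)) (≡.cong +_ (ℕ.+-comm 1 i)) e∉)

          t : Carrier
          t = 1# - u₁

          t∈ : 𝒪 t
          t∈ = ≤v-sub 𝒪-1 (proj₁ (S⊆𝒪E s₁))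

          ιt∈ : E′.𝒪 (ι t)
          ιt∈ = VE.≤v-cong (E′.sym (κ-ι t)) (κ-even 0 t∈ ≤v-0)

          e₂ : E′.Carrier
          e₂ = e₁ E′.+ ι t E′.* e₀

          s₂ : S (1# , e₂)
          s₂ = resp {(u₁ , e₁) E.+ Δ t E.* (1# , e₀)} {1# , e₂}
            (solve 1 (λ u → u :+ (:1 :- u) :* :1 := :1) refl u₁ , E′.refl)
            (IsSubmodule.+-closed isS {u₁ , e₁} {Δ t E.* (1# , e₀)} s₁
              (IsSubmodule.*-closed isS {Δ t} {1# , e₀} (𝔬⊆ (t , t∈ , E.refl {Δ t})) s₀))

          e₂∉ : e₀ VE.∈π^ suc i → ¬ (e₂ VE.∈π^ suc i)
          e₂∉ e₀∈ h = absurd (≡.subst ([ + suc i ] ≤∞_) v₁ (VE.≤v-cong cancel-e₀ (VE.≤v-sub h (VEx.∈-*ˡ ιt∈ e₀∈))))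
            where
            open IntegerCoefficients E′.commutativeRing using () renaming (solve to solve′; _:=_ to _:=′_; _:+_ to _:+′_; _:-_ to _:-′_)
            cancel-e₀ : e₂ E′.- ι t E′.* e₀ E′.≈ e₁
            cancel-e₀ = solve′ 2 (λ e z → (e :+′ z) :-′ z :=′ e) E′.refl e₁ (ι t E′.* e₀)
            absurd : ¬ ([ + suc i ] ≤∞ [ + i ])
            absurd (fin≤ (ℤ.+≤+ q)) = ℕ.1+n≰n q

          attained-if : Dec (e₀ VE.∈π^ suc i) → ∃ λ e → S (1# , e) × E′.v e ≡ [ + i ]
          attained-if (no e₀∉) = e₀ , s₀ , exact s₀ e₀∉
          attained-if (yes e₀∈) = e₂ , s₂ , exact s₂ (e₂∉ e₀∈)

        attained : ∃ λ e → S (1# , e) × E′.v e ≡ [ + i ]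
        attained =
          let (u₁ , s₁) = proj₁ (proj₂ (proj₂ minimum))
              (v₁ , bound) = proj₂ (proj₂ (proj₂ minimum))
          in Adjust.attained-if i s₁ v₁ bound (VE.≤v? (+ suc i) e₀)

        classified : Classified S
        classified =
          let (e , s , v-e) = attained
              (e⁻¹ , ee⁻¹ , _) = VEx.inverse v-e
          in classified-pre {S} {1# , e} resp (invertible-pair (*-identityˡ 1#) ee⁻¹)
               (Normalised.classified {pre (1# , e) S} (pre-submodule isS (1# , e))
                 (λ {y} s → ≤v-cong (*-identityˡ _) (proj₁ (S⊆𝒪E s)) ,
                            VE.≤v-cancel {+ 0} v-e (VE.≤v-cong (E′.*-comm e (proj₂ y)) (lower-bound s)))
                 (resp {1# , e} {(1# , e) E.* ε 1# 1# 0#} (sym (*-identityˡ 1#) ,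
                   E′.sym (E′.trans (E′.*-congˡ (E′.trans (E′.sym (κ-ι 1#)) 1#-homo)) (E′.*-identityʳ e))) s))

      unit-projection : ∀ {S} → IsSubmodule R S → S ⊆ 𝒪E → (∃ λ y → S y × ¬ (proj₁ y ≈ 0#)) →
                        (∃ λ y → S y × ¬ (proj₂ y E′.≈ E′.0#)) → Classified S
      unit-projection {S} isS S⊆𝒪E ((u , e) , s , u≉0) nonzero₂ =
        let (k , u∉) = nonzero u≉0
            (j , w , _ , w∈ , uw , _) = factor (proj₁ (S⊆𝒪E s)) u∉
            (i , (e₁ , s₁) , minimal) = least em (λ i → ∃ λ e → S (π ^ i , e))
              (j , ι w E′.* e , resp {Δ w E.* (u , e)} {π ^ j , ι w E′.* e} (trans (*-comm w u) uw , E′.refl)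
                (*-closed {Δ w} {u , e} (𝔬⊆ (w , w∈ , E.refl {Δ w})) s))
            inv = invertible-pair (π^*π⁻ i) (E′.*-identityˡ E′.1#)
            S₁⊆𝒪E = λ {y} s → quotient-integral i minimal (proj₁ y) (proj₂ y) s
        in classified-pre {S} {π ^ i , E′.1#} resp inv
             (Integral.classified {pre (π ^ i , E′.1#) S} (pre-submodule isS (π ^ i , E′.1#)) (λ {y} → S₁⊆𝒪E {y})
               (pre-second≉0 {S} {π ^ i , E′.1#} resp inv nonzero₂) {e₁}
               (resp {π ^ i , e₁} {(π ^ i , E′.1#) E.* (1# , e₁)} (sym (*-identityʳ _) , E′.sym (E′.*-identityˡ e₁)) s₁))
        where
        open IsSubmodule isS
        least-first : ∀ i → (∀ j → (∃ λ e → S (π ^ j , e)) → i ℕ.≤ j) → ∀ u e → S (u , e) → u ∈π^ i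
        least-first i minimal u e s = ∈-unless (proj₁ (S⊆𝒪E s)) λ {j} {w} j<i w∈ uw →
          ℕ.<⇒≱ j<i (minimal j (ι w E′.* e , resp {Δ w E.* (u , e)} {π ^ j , ι w E′.* e} (trans (*-comm w u) uw , E′.refl)
            (*-closed {Δ w} {u , e} (𝔬⊆ (w , w∈ , E.refl {Δ w})) s)))
        quotient-integral : ∀ i → (∀ j → (∃ λ e → S (π ^ j , e)) → i ℕ.≤ j) → ∀ u e → S (π ^ i * u , E′.1# E′.* e) → 𝒪E (u , e)
        quotient-integral i minimal u e s =
          cancel {u} {0} i (≤v-cong (*-comm _ u) (least-first i minimal _ _ s)) , VE.≤v-cong (E′.*-identityˡ e) (proj₂ (S⊆𝒪E s))

    classify : (J : FractionalIdeal R) → Classified (FractionalIdeal.carrier J)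
    classify J =
      let (k , integral) = bounded {R} {carrier} R⊆𝒪E fg
          inv = invertible-pair (trans (*-comm (π⁻ k) (π ^ k)) (π^*π⁻ k)) (ι-inverse k)
      in classified-pre {carrier} {Δ (π⁻ k)} resp inv
           (unit-projection {pre (Δ (π⁻ k)) carrier} (pre-submodule isSubmodule (Δ (π⁻ k)))
             (λ {y} s → let (h , h′) = integral (Δ (π⁻ k) E.* y) s in
               ≤v-cong (Cancellation.cancel-inverse F.commutativeRing (π^*π⁻ k) _) h ,
               VE.≤v-cong (cancel-inverse (E′.trans (E′.*-comm _ _) (ι-inverse k)) _) h′)
             (pre-first≉0 {carrier} {Δ (π⁻ k)} resp inv (first≉0 {carrier} spans))
             (pre-second≉0 {carrier} {Δ (π⁻ k)} resp inv (second≉0 {carrier} spans)))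
      where
      open FractionalIdeal J
      open IsSubmodule isSubmodule using (resp)
      ι-inverse : ∀ k → ι (π⁻ k) E′.* ι (π ^ k) E′.≈ E′.1#
      ι-inverse k = E′.trans (E′.sym (*-homo (π⁻ k) (π ^ k))) (E′.trans (ι-cong (trans (*-comm (π⁻ k) (π ^ k)) (π^*π⁻ k))) 1#-homo)

-- Invariants of ideal classes

module Injectivity (em : ∀ {a} → ExcludedMiddle a) {c ℓ} (setting : QuadraticSetting c ℓ) where
  open Coordinates setting
  open NormValuation setting
  open Reduction em setting using (Similar; similar-sym)
  open Cancellation E′.commutativeRing

  Projection Kernel : Subset → Pred E′.Carrier (c ⊔ ℓ)
  Projection S e = ∃ λ u → S (u , e)
  Kernel S e = S (0# , e)

  -- These three properties are invariant under scaling and determine m and a for Over m a β and Dual m a β.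
  ProjectionStable KernelStable Exponent : Subset → ℕ → Set (c ⊔ ℓ)
  ProjectionStable S j = ∀ e → Projection S e → Projection S (κ 0# (π ^ j) E′.* e)
  KernelStable S j = ∀ e → Kernel S e → Kernel S (κ 0# (π ^ j) E′.* e)
  Exponent S i = ∀ e → Projection S e → Kernel S (ι (π ^ i) E′.* e)

  module Transport {S S′ : Subset} (S-resp : S Respects E._≈_) (S′-resp : S′ Respects E._≈_) (similar : Similar S S′) where
    u₁ : Carrier
    u₁ = proj₁ (proj₁ similar)

    u₂ u₂⁻¹ : E′.Carrier
    u₂ = proj₂ (proj₁ similar)
    u₂⁻¹ = proj₂ (proj₁ (proj₁ (proj₂ similar)))

    u₂⁻¹u₂ : u₂⁻¹ E′.* u₂ E′.≈ E′.1#
    u₂⁻¹u₂ = proj₂ (proj₁ (proj₂ (proj₁ (proj₂ similar))))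

    private
      S′⊆ = proj₁ (proj₂ (proj₂ similar))
      ⊆S′ = proj₂ (proj₂ (proj₂ similar))

      undo : ∀ e → u₂ E′.* (u₂⁻¹ E′.* e) E′.≈ e
      undo = cancel-inverse (E′.trans (E′.*-comm _ _) u₂⁻¹u₂)

      undo′ : ∀ {z e} → e E′.≈ u₂ E′.* z → u₂⁻¹ E′.* e E′.≈ z
      undo′ {z} eq = E′.trans (E′.*-congˡ eq) (cancel-inverse u₂⁻¹u₂ z)

      swap : ∀ z e → u₂ E′.* (z E′.* (u₂⁻¹ E′.* e)) E′.≈ z E′.* e
      swap z e = E′.trans (swap-left u₂ z _) (E′.*-congˡ (undo e))

    projection-to : ∀ e → Projection S e → Projection S′ (u₂ E′.* e)
    projection-to e (u , s) = u₁ * u , ⊆S′ {u₁ * u , u₂ E′.* e} ((u , e) , s , refl , E′.refl)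

    kernel-to : ∀ e → Kernel S e → Kernel S′ (u₂ E′.* e)
    kernel-to e s = ⊆S′ {0# , u₂ E′.* e} ((0# , e) , s , sym (zeroʳ u₁) , E′.refl)

    projection-from : ∀ e → Projection S′ e → Projection S (u₂⁻¹ E′.* e)
    projection-from e (u , s) =
      let ((u′ , e′) , s′ , _ , e≈) = S′⊆ {u , e} s
      in u′ , S-resp {u′ , e′} {u′ , u₂⁻¹ E′.* e} (refl , E′.sym (undo′ e≈)) s′

    kernel-from : ∀ e → Kernel S′ e → Kernel S (u₂⁻¹ E′.* e)
    kernel-from e s =
      let ((u′ , e′) , s′ , 0≈ , e≈) = S′⊆ {0# , e} s
      in S-resp {u′ , e′} {0# , u₂⁻¹ E′.* e} (sym (u′≈0 0≈) , E′.sym (undo′ e≈)) s′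
      where
      u₁⁻¹u₁ = proj₁ (proj₁ (proj₂ (proj₁ (proj₂ similar))))
      u′≈0 : ∀ {u′} → 0# ≈ u₁ * u′ → 0# ≈ u′
      u′≈0 {u′} eq = trans (sym (zeroʳ _)) (trans (*-congˡ eq)
        (trans (sym (*-assoc _ _ _)) (trans (*-congʳ u₁⁻¹u₁) (*-identityˡ u′))))

    private
      projection-resp : ∀ {e e′} → e E′.≈ e′ → Projection S′ e → Projection S′ e′
      projection-resp eq (u , s) = u , S′-resp (refl , eq) s

    projection-stable : ∀ {j} → ProjectionStable S j → ProjectionStable S′ j
    projection-stable {j} stable e s = projection-resp (swap (κ 0# (π ^ j)) e)
      (projection-to _ (stable _ (projection-from e s)))

    kernel-stable : ∀ {j} → KernelStable S j → KernelStable S′ j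
    kernel-stable {j} stable e s = S′-resp (refl , swap (κ 0# (π ^ j)) e) (kernel-to _ (stable _ (kernel-from e s)))

    exponent : ∀ {i} → Exponent S i → Exponent S′ i
    exponent {i} exp e s = S′-resp (refl , swap (ι (π ^ i)) e) (kernel-to _ (exp _ (projection-from e s)))

  κ-1 : κ 1# 0# E′.≈ E′.1#
  κ-1 = E′.trans (E′.sym (κ-ι 1#)) 1#-homo

  over-projection : ∀ {m a β e} → 𝒪 β → Projection (Over m a β) e → ∃₂ λ p r → e E′.≈ κ p r × 𝒪 p × r ∈π^ m
  over-projection {m} {a} β∈ (_ , over u p w y≈ u∈ w∈ h) = p , w * π ^ m , proj₂ y≈ , p-integral {m} {a} β∈ u∈ w∈ h , ∈-*ˡ w∈ (π^∈ m)

  projection-over : ∀ {m a β p r} → 𝒪 β → 𝒪 p → r ∈π^ m → Projection (Over m a β) (κ p r)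
  projection-over {m} {a} {β} {p} {r} β∈ p∈ r∈ =
    let (w , w∈ , r≈) = divide {r} {m} r∈
    in p + w * β , Over-intro {m} {a} {β} {w = w} r≈ (≤v-+ p∈ (∈-*ˡ w∈ β∈)) w∈
         (≤v-cong (solve 3 (λ p w β → :0 := p :- (p :+ w :* β) :+ w :* β) refl p w β) ≤v-0)

  projection-over-resp : ∀ {m a β e e′} → e E′.≈ e′ → Projection (Over m a β) e → Projection (Over m a β) e′
  projection-over-resp eq (u , s) = u , Over-resp (refl , eq) s

  over-ideal : ∀ {m a β e e′} → 𝒪 β → norm m β ∈π^ a → Projection (Over m a β) e → Kernel (Over m a β) e′ → Kernel (Over m a β) (e E′.* e′)
  over-ideal β∈ N∈ (u , s) s′ = Over-resp (zeroʳ u , E′.refl) (Over-* β∈ N∈ s s′)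

  module _ {m a β} (β∈ : 𝒪 β) (N∈ : norm m β ∈π^ a) where

    private
      1∈ : Projection (Over m a β) E′.1#
      1∈ = projection-over-resp {m} {a} {β} κ-1 (projection-over β∈ 𝒪-1 ≤v-0)

    over-projection-stable : ∀ {j} → m ℕ.≤ j → ProjectionStable (Over m a β) j
    over-projection-stable {j} m≤j e (u , s) =
      let (u′ , s′) = projection-over {m} {a} β∈ ≤v-0 (∈-weaken m≤j (π^∈ j))
      in u′ * u , Over-* β∈ N∈ s′ s

    over-projection-stable⁻¹ : ∀ {j} → ProjectionStable (Over m a β) j → m ℕ.≤ j
    over-projection-stable⁻¹ {j} stable =
      let (p , r , eq , _ , r∈) = over-projection {m} {a} β∈ (stable E′.1# 1∈)
      in π^-≤ {m} {j} (≤v-cong (sym (proj₂ (κ-injective (E′.trans (E′.sym (E′.*-identityʳ _)) eq)))) r∈)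

    over-kernel-stable : ∀ {j} → m ℕ.≤ j → KernelStable (Over m a β) j
    over-kernel-stable {j} m≤j e s = over-ideal β∈ N∈ (projection-over {m} {a} β∈ ≤v-0 (∈-weaken m≤j (π^∈ j))) s

    over-exponent : Exponent (Over m a β) a
    over-exponent e s = Over-resp (refl , E′.trans (E′.*-comm _ _) (E′.*-congʳ (E′.sym (κ-ι (π ^ a))))) (over-ideal β∈ N∈ s Over-π^)

    over-exponent⁻¹ : ∀ {i} → Exponent (Over m a β) i → a ℕ.≤ i
    over-exponent⁻¹ {i} exp =
      let (_ , w , 0≈ , _ , h) = Over-elim {m} {a} {β} (Over-resp (refl , E′.trans (E′.*-identityʳ _) (κ-ι (π ^ i))) (exp E′.1# 1∈))
          w≈0 = π^-cancelʳ {0#} {w} m (trans (zeroˡ _) 0≈)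
      in π^-≤ {a} {i} (≤v-cong (trans (+-congˡ (*-congʳ (sym w≈0)))
           (solve 2 (λ z β → z :- :0 :+ :0 :* β := z) refl (π ^ i) β)) h)

  over-injective : ∀ {m a β m′ a′ β′} → 𝒪 β → norm m β ∈π^ a → 𝒪 β′ → norm m′ β′ ∈π^ a′ →
                   Similar (Over m a β) (Over m′ a′ β′) → m ≡ m′ × a ≡ a′ × (β - β′) ∈π^ a
  over-injective {m} {a} {β} {m′} {a′} {β′} β∈ N∈ β′∈ N′∈ similar = m≡ , a≡ , difference m≡ a≡ N′∈ similar
    where
    similar′ = similar-sym {Over m a β} {Over m′ a′ β′} Over-resp similar
    m≡ : m ≡ m′
    m≡ = ℕ.≤-antisym
      (over-projection-stable⁻¹ β∈ N∈ (Transport.projection-stable Over-resp Over-resp similar′ {m′} (over-projection-stable β′∈ N′∈ ℕ.≤-refl)))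
      (over-projection-stable⁻¹ β′∈ N′∈ (Transport.projection-stable Over-resp Over-resp similar {m} (over-projection-stable β∈ N∈ ℕ.≤-refl)))
    a≡ : a ≡ a′
    a≡ = ℕ.≤-antisym
      (over-exponent⁻¹ β∈ N∈ (Transport.exponent Over-resp Over-resp similar′ {a′} (over-exponent β′∈ N′∈)))
      (over-exponent⁻¹ β′∈ N′∈ (Transport.exponent Over-resp Over-resp similar {a} (over-exponent β∈ N∈)))
    -- Pulling 1 back shows that `u₂⁻¹` lies in R_m. The kernel of the second order is an ideal of
    -- R_m, so it contains θ = u₂⁻¹ (u₂ θ), and the congruence for θ compares β with β′.
    difference : ∀ {m′ a′} → m ≡ m′ → a ≡ a′ → norm m′ β′ ∈π^ a′ → Similar (Over m a β) (Over m′ a′ β′) → (β - β′) ∈π^ a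
    difference ≡.refl ≡.refl N′∈ similar =
      let open Transport {Over m a β} {Over m a β′} Over-resp Over-resp similar
          (p , r , eq , p∈ , r∈) = over-projection {m} {a} β∈ (projection-over-resp {m} {a} {β} (E′.*-identityʳ u₂⁻¹)
            (projection-from E′.1# (projection-over-resp {m} {a} {β′} κ-1 (projection-over β′∈ 𝒪-1 ≤v-0))))
          θ∈ = Over-resp (refl , cancel-inverse u₂⁻¹u₂ _)
            (over-ideal {m} {a} {β′} β′∈ N′∈ (projection-over-resp {m} {a} {β′} (E′.sym eq) (projection-over β′∈ p∈ r∈)) (kernel-to _ Over-θ))
          (_ , w , 1≈ , _ , h) = Over-elim {m} {a} {β′} θ∈
          w≈1 = π^-cancelʳ {w} {1#} m (trans (sym 1≈) (sym (*-identityˡ _)))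
      in ≤v-cong (trans (-‿cong (+-congˡ (*-congʳ w≈1)))
           (solve 2 (λ β β′ → :- (:- β :- :0 :+ :1 :* β′) := β :- β′) refl β β′)) (≤v-neg h)

  dual-kernel : ∀ {m a β p r} → Kernel (Dual m a β) (κ p r) → p ∈π^ a × ∃ λ w → r ≈ w * π ^ m × w ∈π^ a
  dual-kernel {m} {a} {β} {p} {r} s =
    let (_ , w , r≈ , h , h′) = Dual-elim {m} {a} {β} s
    in ≤v-cong (solve 2 (λ p τ → p :+ :0 :* τ := p) refl p (T[ m ] - β)) h , w , r≈ ,
       ≤v-cong (solve 1 (λ w → w :- :0 := w) refl w) h′

  ι*κ : ∀ t p r → ι t E′.* κ p r E′.≈ κ (t * p) (t * r)
  ι*κ t p r = proj₂ (ε-scale t 0# p r)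

  module _ {m a β} (β∈ : 𝒪 β) (N∈ : norm m β ∈π^ a) where

    dual-kernel-stable : KernelStable (Dual m a β) m
    dual-kernel-stable e s =
      let (u , s′) = projection-over {m} {a} β∈ ≤v-0 (π^∈ m)
      in Dual-resp (zeroʳ u , E′.refl) (Over-*-Dual β∈ N∈ s′ s)

    dual-kernel-stable⁻¹ : ∀ {j} → KernelStable (Dual m a β) j → m ℕ.≤ j
    dual-kernel-stable⁻¹ {j} stable =
      let (_ , w , eq , w∈) = dual-kernel {m} {a} {β} (Dual-resp (refl , κ-* 0# (π ^ j) (π ^ a) 0#) (stable _ Dual-π^))
          eq′ = trans (trans (π^-+ a j)
            (solve 3 (λ z y T → y :* z := :0 :* :0 :+ z :* y :+ T :* (z :* :0)) refl (π ^ j) (π ^ a) T)) eq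
      in ℕ.+-cancelˡ-≤ a m j (π^-≤ {a ℕ.+ m} {a ℕ.+ j} (≤v-cong (sym eq′) (∈-* w∈ (π^∈ m))))

    dual-exponent : Exponent (Dual m a β) a
    dual-exponent e (u , s) = Dual-resp (zeroˡ u , E′.*-congʳ (E′.sym (κ-ι (π ^ a)))) (Over-*-Dual β∈ N∈ Over-π^ s)

    dual-exponent⁻¹ : ∀ {i} → Exponent (Dual m a β) i → a ℕ.≤ i
    dual-exponent⁻¹ {i} exp =
      let (_ , w , eq , w∈) = dual-kernel {m} {a} {β} (Dual-resp (refl , ι*κ (π ^ i) _ (π ^ m)) (exp _ (1# , Dual-1)))
      in π^-≤ {a} {i} (≤v-cong (π^-cancelʳ {w} {π ^ i} m (sym eq)) w∈)

  private
    module DualDifference {m a β β′} (β∈ : 𝒪 β) (β′∈ : 𝒪 β′) (N′∈ : norm m β′ ∈π^ a)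
        (similar : Similar (Dual m a β) (Dual m a β′)) where
      open Transport {Dual m a β} {Dual m a β′} Dual-resp Dual-resp similar

      coordinates : ∃₂ λ p r → u₂⁻¹ E′.≈ κ p r
      coordinates = κ-surjective u₂⁻¹

      p r : Carrier
      p = proj₁ coordinates
      r = proj₁ (proj₂ coordinates)

      scaled : Kernel (Dual m a β) (κ (π ^ a * p) (π ^ a * r))
      scaled = Dual-resp (refl , E′.trans (E′.*-comm _ _)
        (E′.trans (E′.*-cong (E′.sym (κ-ι (π ^ a))) (proj₂ (proj₂ coordinates))) (ι*κ (π ^ a) p r)))
        (kernel-from (κ (π ^ a) 0#) Dual-π^)

      p∈ : 𝒪 p
      p∈ = cancel {p} {0} a (≤v-cong (*-comm (π ^ a) p) (proj₁ (dual-kernel {m} {a} {β} scaled)))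

      r∈ : r ∈π^ m
      r∈ = let (w , r≈ , w∈) = proj₂ (dual-kernel {m} {a} {β} scaled) in
        cancel {r} {m} a (≤v-cong (trans (sym r≈) (*-comm (π ^ a) r)) (≡.subst (w * π ^ m ∈π^_) (ℕ.+-comm a m) (∈-* w∈ (π^∈ m))))

      -- `u₂⁻¹` lies in R_m because it maps π^a into π^a R_m. The projection of the second dual is
      -- an R_m-module, so it contains the generator -θ̄ of the first one.
      back : ∃ λ u → Dual m a β′ (ε u (- (T[ m ] - β)) (π ^ m))
      back =
        let (v , s) = projection-over {m} {a} {β′} {p} {r} β′∈ p∈ r∈
            (u , g∈) = projection-to (κ (- (T[ m ] - β)) (π ^ m)) (1# , Dual-1)
        in v * u , Dual-resp {m} {a} {β′} (refl , E′.trans (E′.*-congʳ (E′.sym (proj₂ (proj₂ coordinates)))) (cancel-inverse u₂⁻¹u₂ _)) (Over-*-Dual β′∈ N′∈ s g∈)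

      difference : (β - β′) ∈π^ a
      difference =
        let (u , s) = back
            (_ , w , 1≈ , h , h′) = Dual-elim {m} {a} {β′} s
            w≈1 = π^-cancelʳ {w} {1#} m (trans (sym 1≈) (sym (*-identityˡ _)))
        in ≤v-cong (trans (+-congˡ (*-congʳ (+-congʳ w≈1)))
             (solve 4 (λ u T β β′ → (:- (T :- β) :+ u :* (T :- β′)) :+ (:1 :- u) :* (T :- β′) := β :- β′) refl u T[ m ] β β′))
             (≤v-+ h (∈-*ʳ h′ (≤v-sub (∈⇒𝒪 (T[]∈ m)) β′∈)))

  dual-injective : ∀ {m a β m′ a′ β′} → 𝒪 β → norm m β ∈π^ a → 𝒪 β′ → norm m′ β′ ∈π^ a′ →
                   Similar (Dual m a β) (Dual m′ a′ β′) → m ≡ m′ × a ≡ a′ × (β - β′) ∈π^ a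
  dual-injective {m} {a} {β} {m′} {a′} {β′} β∈ N∈ β′∈ N′∈ similar = m≡ , a≡ , difference m≡ a≡ N′∈ similar
    where
    similar′ = similar-sym {Dual m a β} {Dual m′ a′ β′} Dual-resp similar
    m≡ : m ≡ m′
    m≡ = ℕ.≤-antisym
      (dual-kernel-stable⁻¹ β∈ N∈ (Transport.kernel-stable Dual-resp Dual-resp similar′ {m′} (dual-kernel-stable β′∈ N′∈)))
      (dual-kernel-stable⁻¹ β′∈ N′∈ (Transport.kernel-stable Dual-resp Dual-resp similar {m} (dual-kernel-stable β∈ N∈)))
    a≡ : a ≡ a′
    a≡ = ℕ.≤-antisym
      (dual-exponent⁻¹ β∈ N∈ (Transport.exponent Dual-resp Dual-resp similar′ {a′} (dual-exponent β′∈ N′∈)))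
      (dual-exponent⁻¹ β′∈ N′∈ (Transport.exponent Dual-resp Dual-resp similar {a} (dual-exponent β∈ N∈)))
    difference : ∀ {m′ a′} → m ≡ m′ → a ≡ a′ → norm m′ β′ ∈π^ a′ → Similar (Dual m a β) (Dual m′ a′ β′) → (β - β′) ∈π^ a
    difference ≡.refl ≡.refl N′∈ similar = DualDifference.difference {m} {a} {β} {β′} β∈ β′∈ N′∈ similar

  -- The congruence for π^n x times an element is verified after multiplication by π, where it
  -- involves π^(n+1) x and the norm, known modulo π^(a+1). Divisibility of β by π, and with it of
  -- the coordinate `p`, keeps the x-coordinate of the product in π^(n+1) 𝔬.
  dual-projection-stable : ∀ {n a β} → 𝒪 β → 1 ℕ.≤ a → norm (suc n) β ∈π^ suc a → ProjectionStable (Dual (suc n) a β) n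
  dual-projection-stable {n} {a} {β} β∈ a≥1 N∈ e (_ , dual u p w y≈ u∈ h h′) =
    let (p′ , p′∈ , p≈) = divide {p} {1} p∈ in
    p′ + T * π ^ n * w , Dual-resp (refl , E′.trans (E′.sym (κ-* 0# (π ^ n) p (w * π ^ suc n))) (E′.*-congˡ (E′.sym (proj₂ y≈))))
      (Dual-intro {suc n} {a} {β} {w = p′ + T * π ^ n * w}
        (trans (+-congʳ (+-congˡ (*-congˡ p≈)))
          (solve 5 (λ p′ w π z T → :0 :* (w :* (π :* z)) :+ z :* (p′ :* (π :* :1)) :+ T :* (z :* (w :* (π :* z)))
            := (p′ :+ T :* z :* w) :* (π :* z)) refl p′ w π (π ^ n) T))
        (≤v-+ p′∈ (∈-*ˡ (∈-*ˡ (∈⇒𝒪 T∈) (∈⇒𝒪 (π^∈ n))) w∈))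
        (p″∈ p≈)
        (≤v-cong (sym (-‿inverseʳ _)) ≤v-0))
    where
    ∈-*-suc : ∀ {y z} → y ∈π^ a → z ∈π^ 1 → y * z ∈π^ suc a
    ∈-*-suc {y} {z} y∈ z∈ = ≡.subst (y * z ∈π^_) (ℕ.+-comm a 1) (∈-* y∈ z∈)
    β∈π : β ∈π^ 1
    β∈π = let (_ , j , a≤ , β∈j) = norm∈⁻¹ {suc n} {suc a} β∈ N∈ in positive j a≤ β∈j
      where
      positive : ∀ j → suc a ℕ.≤ j ℕ.+ j → β ∈π^ j → β ∈π^ 1
      positive zero () _
      positive (suc j) _ β∈j = ∈-weaken (s≤s z≤n) β∈j
    τ∈π : T[ suc n ] - β ∈π^ 1
    τ∈π = ≤v-sub (∈-weaken (s≤s z≤n) (T[]∈ (suc n))) β∈π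
    τ∈ = ∈⇒𝒪 τ∈π
    p∈ : p ∈π^ 1
    p∈ = ≤v-cong (solve 3 (λ p u τ → (p :+ u :* τ) :- u :* τ := p) refl p u (T[ suc n ] - β))
      (≤v-sub (∈-weaken a≥1 h) (∈-*ˡ u∈ τ∈π))
    p″∈ : ∀ {p′} → p ≈ p′ * π ^ 1 →
          0# * p - D * (π ^ n * (w * π ^ suc n)) + (p′ + T * π ^ n * w) * (T[ suc n ] - β) ∈π^ a
    p″∈ {p′} p≈ = cancel {p″} {a} 1 (≡.subst (p″ * π ^ 1 ∈π^_) (ℕ.+-comm 1 a) (≤v-cong π-multiple
      (≤v-sub (≤v-+ (∈-*-suc h τ∈π) (∈-*-suc h′ (≤v-sub (∈-*ʳ (∈-weaken (s≤s z≤n) (T[]∈ (suc n))) τ∈) (∈-weaken (s≤s z≤n) (D[]∈ (suc n)))))) (∈-*ˡ u∈ N∈))))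
      where
      p″ = 0# * p - D * (π ^ n * (w * π ^ suc n)) + (p′ + T * π ^ n * w) * (T[ suc n ] - β)
      π-multiple : (p + u * (T[ suc n ] - β)) * (T[ suc n ] - β) + (w - u) * (T[ suc n ] * (T[ suc n ] - β) - D[ suc n ]) - u * norm (suc n) β
                   ≈ p″ * π ^ 1
      π-multiple = trans
        (solve 6 (λ u p w T D β → ((p :+ u :* (T :- β)) :* (T :- β) :+ (w :- u) :* (T :* (T :- β) :- D)) :- u :* (β :* β :- β :* T :+ D)
          := :- (D :* w) :+ (p :+ T :* w) :* (T :- β)) refl u p w T[ suc n ] D[ suc n ] β)
        (trans (+-congˡ (*-congʳ (+-congʳ p≈)))
          (solve 8 (λ p p′ w π z T D β → :- (D :* ((π :* z) :* (π :* z)) :* w) :+ (p′ :* (π :* :1) :+ T :* (π :* z) :* w) :* (T :* (π :* z) :- β)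
            := (:0 :* p :- D :* (z :* (w :* (π :* z))) :+ (p′ :+ T :* z :* w) :* (T :* (π :* z) :- β)) :* (π :* :1))
            refl p p′ w π (π ^ n) T D β))
    w∈ : 𝒪 w
    w∈ = ≤v-cong (solve 2 (λ w u → (w :- u) :+ u := w) refl w u) (≤v-+ (∈⇒𝒪 h′) u∈)

  -- For an order, stability of the projection under π^j x implies that of the kernel. A counted
  -- dual violates this at j = m′ - 1: its projection is stable there, while its kernel π^a′ R_m′ is
  -- stable only from m′ on.
  over≁dual : ∀ {m a β m′ a′ β′} → 𝒪 β → norm m β ∈π^ a → 𝒪 β′ → 1 ℕ.≤ a′ → norm m′ β′ ∈π^ suc a′ →
              ¬ Similar (Over m a β) (Dual m′ a′ β′)
  -- For m′ = 0 the norm has valuation at most 1, which leaves no a′ ≥ 1.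
  over≁dual {m} {a} {β} {zero} {a′} {β′} β∈ N∈ β′∈ a≥1 N′∈ similar =
    ℕ.<⇒≱ (s≤s a≥1) (proj₁ (norm∈⁻¹ {zero} {suc a′} β′∈ N′∈))
  over≁dual {m} {a} {β} {suc n} {a′} {β′} β∈ N∈ β′∈ a≥1 N′∈ similar =
    ℕ.1+n≰n {n} (dual-kernel-stable⁻¹ {suc n} {a′} β′∈ (∈-weaken (ℕ.n≤1+n a′) N′∈) {n}
      (Transport.kernel-stable Over-resp Dual-resp similar {n} (over-kernel-stable β∈ N∈ {n}
        (over-projection-stable⁻¹ β∈ N∈ {n} (Transport.projection-stable Dual-resp Over-resp
          (similar-sym {Over m a β} {Dual (suc n) a′ β′} Over-resp similar) {n} (dual-projection-stable {n} β′∈ a≥1 N′∈))))))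

-- Counting solutions of congruences

-- The decisions are arguments, so that one case split reduces this count and the summands of the
-- formula together.
choose : ∀ {p p′} {P : Set p} {P′ : Set p′} → (q a j h : ℕ) → Dec P → Dec P′ → ℕ
choose q a j h P? P′? =
  if does P? then q ℕ.^ ((a ℕ.∸ j) ℕ.⊓ h) else
  if does P′? then q ℕ.^ h else 0

module Counting {c ℓ} (F : LocalField c ℓ) (π : LocalField.Carrier F) (π-uniformizer : LocalField.IsUniformizer F π) where
  open LocalField F
  open Valuation discretelyValuedField
  open Uniformized π π-uniformizer
  open IntegerCoefficients commutativeRing

  -- A count of residues modulo π^k by representatives, which avoids forming a quotient.
  record Enumeration {a} (P : Pred Carrier a) (k n : ℕ) : Set (c ⊔ a) where
    field
      element    : Fin n → Carrier
      member     : ∀ i → P (element i)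
      injective  : ∀ i j → element i - element j ∈π^ k → i ≡ j
      surjective : ∀ {β} → P β → ∃ λ i → β - element i ∈π^ k

  empty : ∀ {a} {P : Pred Carrier a} {k} → (∀ {β} → ¬ P β) → Enumeration P k 0
  empty ¬P = record { element = λ () ; member = λ () ; injective = λ () ; surjective = λ p → ⊥-elim (¬P p) }

  enumeration-resp : ∀ {a a′} {P : Pred Carrier a} {Q : Pred Carrier a′} {k m n} → m ≡ n → P ⊆ Q → Q ⊆ P →
                     Enumeration P k m → Enumeration Q k n
  enumeration-resp ≡.refl P⊆Q Q⊆P enum = record
    { element = element ; member = P⊆Q ∘ member ; injective = injective ; surjective = surjective ∘ Q⊆P }
    where open Enumeration enum

  private
    module Residue = Inverse residueField-q

    digit : Fin q → Carrier
    digit d = proj₁ (Residue.from d)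

    digit∈ : ∀ d → 𝒪 (digit d)
    digit∈ d = proj₂ (Residue.from d)

    digit-injective : ∀ d d′ → digit d - digit d′ ∈π^ 1 → d ≡ d′
    digit-injective d d′ h = ≡.trans (≡.sym (Residue.strictlyInverseˡ d))
      (≡.trans (Residue.to-cong {Residue.from d} {Residue.from d′} h) (Residue.strictlyInverseˡ d′))

    digit-surjective : ∀ {β} → 𝒪 β → ∃ λ d → β - digit d ∈π^ 1
    digit-surjective {β} β∈ = Residue.to (β , β∈) ,
      ≤v-cong (solve 2 (λ x y → :- (x :- y) := y :- x) refl (digit (Residue.to (β , β∈))) β)
        (≤v-neg (Residue.strictlyInverseʳ (β , β∈)))

    integers : ∀ k → Enumeration 𝒪 k (q ℕ.^ k)
    integers zero = record
      { element = λ _ → 0#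
      ; member = λ _ → ≤v-0
      ; injective = λ { fzero fzero _ → ≡.refl }
      ; surjective = λ β∈ → fzero , ≤v-sub β∈ ≤v-0
      }
    integers (suc k) = record
      { element = element′ ∘ Fin.remQuot {q} (q ℕ.^ k)
      ; member = λ i → member′ (Fin.remQuot {q} (q ℕ.^ k) i)
      ; injective = λ i j h → ≡.trans (≡.sym (Fin.combine-remQuot {q} (q ℕ.^ k) i))
          (≡.trans (≡.cong (λ (d , l) → Fin.combine d l)
            (injective′ (Fin.remQuot {q} (q ℕ.^ k) i) (Fin.remQuot {q} (q ℕ.^ k) j) h))
          (Fin.combine-remQuot {q} (q ℕ.^ k) j))
      ; surjective = λ {β} β∈ → let (d , h) = digit-surjective β∈ in surjective′ d h
      }
      where
      open Enumeration (integers k)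
      element′ : Fin q × Fin (q ℕ.^ k) → Carrier
      element′ (d , i) = digit d + element i * π ^ 1

      member′ : ∀ i → 𝒪 (element′ i)
      member′ (d , i) = ≤v-+ (digit∈ d) (∈-*ˡ (member i) (∈⇒𝒪 (π^∈ 1)))

      digits-agree : ∀ d i d′ j → element′ (d , i) - element′ (d′ , j) ∈π^ suc k → d ≡ d′
      digits-agree d i d′ j h = digit-injective d d′ (≤v-cong
        (solve 5 (λ d d′ x y z → (d :+ x :* z :- (d′ :+ y :* z)) :- (x :- y) :* z := d :- d′)
          refl (digit d) (digit d′) (element i) (element j) (π ^ 1))
        (≤v-sub (∈-weaken (s≤s z≤n) h) (∈-*ˡ (≤v-sub (member i) (member j)) (π^∈ 1))))

      tails-agree : ∀ d i j → element′ (d , i) - element′ (d , j) ∈π^ suc k → i ≡ j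
      tails-agree d i j h = injective i j (cancel {element i - element j} {k} 1
        (≡.subst ((element i - element j) * π ^ 1 ∈π^_) (ℕ.+-comm 1 k) (≤v-cong
          (solve 4 (λ d x y z → d :+ x :* z :- (d :+ y :* z) := (x :- y) :* z) refl (digit d) (element i) (element j) (π ^ 1)) h)))

      injective′ : ∀ i j → element′ i - element′ j ∈π^ suc k → i ≡ j
      injective′ (d , i) (d′ , j) h = combine (digits-agree d i d′ j h) h
        where
        combine : d ≡ d′ → element′ (d , i) - element′ (d′ , j) ∈π^ suc k → (d , i) ≡ (d′ , j)
        combine ≡.refl h = ≡.cong (d ,_) (tails-agree d i j h)

      surjective′ : ∀ {β} d → β - digit d ∈π^ 1 → ∃ λ i → β - element′ (Fin.remQuot {q} (q ℕ.^ k) i) ∈π^ suc k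
      surjective′ {β} d h =
        let (t , t∈ , eq) = divide {β - digit d} {1} h
            (i , h′) = surjective t∈
        in Fin.combine d i , ≡.subst (λ z → β - element′ z ∈π^ suc k) (≡.sym (Fin.remQuot-combine {q} d i))
             (≤v-cong (trans (solve 3 (λ t x z → (t :- x) :* z := t :* z :- x :* z) refl t (element i) (π ^ 1))
                  (trans (+-congʳ (sym eq)) (solve 3 (λ b d y → b :- d :- y := b :- (d :+ y)) refl β (digit d) (element i * π ^ 1))))
               (≡.subst ((t - element i) * π ^ 1 ∈π^_) (ℕ.+-comm k 1) (∈-* h′ (π^∈ 1))))

  coset : ∀ β₀ {i k} → i ℕ.≤ k → Enumeration (λ β → β - β₀ ∈π^ i) k (q ℕ.^ (k ℕ.∸ i))
  coset β₀ {i} {k} i≤k = record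
    { element = λ l → β₀ + element l * π ^ i
    ; member = λ l → ≤v-cong (solve 2 (λ b x → x := (b :+ x) :- b) refl β₀ (element l * π ^ i)) (∈-*ˡ (member l) (π^∈ i))
    ; injective = λ l l′ h → injective l l′ (cancel {element l - element l′} {k ℕ.∸ i} i
        (≡.subst ((element l - element l′) * π ^ i ∈π^_) (≡.sym (ℕ.m∸n+n≡m i≤k)) (≤v-cong
          (solve 4 (λ b x y z → b :+ x :* z :- (b :+ y :* z) := (x :- y) :* z) refl β₀ (element l) (element l′) (π ^ i)) h)))
    ; surjective = λ {β} h →
        let (t , t∈ , eq) = divide {β - β₀} {i} h
            (l , h′) = surjective t∈
        in l , ≤v-cong (trans (solve 3 (λ t x z → (t :- x) :* z := t :* z :- x :* z) refl t (element l) (π ^ i))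
                 (trans (+-congʳ (sym eq)) (solve 3 (λ b b₀ y → b :- b₀ :- y := b :- (b₀ :+ y)) refl β β₀ (element l * π ^ i))))
               (≡.subst ((t - element l) * π ^ i ∈π^_) (ℕ.m∸n+n≡m i≤k) (∈-* h′ (π^∈ i)))
    }
    where open Enumeration (integers (k ℕ.∸ i))

  solutions-count : (C a j h : ℕ) → ℕ
  solutions-count C a j h = choose q a j h (a ℕ.≤? C) (j ℕ.+ h ℕ.≤? C)

  -- `j` will be half of the exponent required of the norm, rounded up, and `h` the difference b - m
  -- in the condition of compatibility.
  Solution : Carrier → ℕ → ℕ → ℕ → Pred Carrier 0ℓ
  Solution γ a j h β = β ∈π^ j × π ^ h * β - γ ∈π^ a

  private
    -- When γ is 0 modulo π^a, β has to lie in both π^j 𝔬 and π^(a-h) 𝔬 and is counted modulo π^a.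
    -- Truncated subtraction covers h > a, where the second condition is void.
    ∸-⊔-∸ : ∀ a j h → a ℕ.∸ (j ℕ.⊔ (a ℕ.∸ h)) ≡ (a ℕ.∸ j) ℕ.⊓ h
    ∸-⊔-∸ a j h with h ℕ.≤? a
    ... | yes h≤a = ≡.trans (ℕ.∸-distribˡ-⊔-⊓ a j (a ℕ.∸ h)) (≡.cong ((a ℕ.∸ j) ℕ.⊓_) (ℕ.m∸[m∸n]≡n h≤a))
    ... | no h≰a = ≡.trans (≡.cong (λ z → a ℕ.∸ (j ℕ.⊔ z)) (ℕ.m≤n⇒m∸n≡0 (ℕ.<⇒≤ (ℕ.≰⇒> h≰a))))
      (≡.trans (≡.cong (a ℕ.∸_) (ℕ.⊔-identityʳ j)) (≡.sym (ℕ.m≤n⇒m⊓n≡m (ℕ.≤-trans (ℕ.m∸n≤m a j) (ℕ.<⇒≤ (ℕ.≰⇒> h≰a))))))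

  -- For a ≤ C the congruence reads π^h β ≡ 0; otherwise γ has valuation exactly C < a or C = b + 1.
  solutions : ∀ {γ C b f} → γ ∈π^ C → C ≡ f ⊎ C ≡ suc b ⊎ ¬ (γ ∈π^ suc C) →
              ∀ {a j h} → a ℕ.≤ f → j ℕ.≤ a → j ℕ.+ h ℕ.≤ suc b →
              Enumeration (Solution γ a j h) a (solutions-count C a j h)
  solutions {γ} {C} {b} {f} γ∈ sharp {a} {j} {h} a≤f j≤a j+h≤ = decide (a ℕ.≤? C) (j ℕ.+ h ℕ.≤? C)
   where
   decide : (d : Dec (a ℕ.≤ C)) (d′ : Dec (j ℕ.+ h ℕ.≤ C)) → Enumeration (Solution γ a j h) a (choose q a j h d d′)
   decide (yes a≤C) _ = enumeration-resp (≡.cong (q ℕ.^_) (∸-⊔-∸ a j h)) to from (coset 0# {j ℕ.⊔ (a ℕ.∸ h)} {a} (ℕ.⊔-lub j≤a (ℕ.m∸n≤m a h)))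
    where
    to : ∀ {β} → β - 0# ∈π^ j ℕ.⊔ (a ℕ.∸ h) → Solution γ a j h β
    to {β} β∈ =
      let β∈′ = ≤v-cong (solve 1 (λ b → b :- :0 := b) refl β) β∈
      in ∈-weaken (ℕ.m≤m⊔n j _) β∈′ ,
         ≤v-sub (∈-weaken (ℕ.≤-trans (ℕ.m≤n+m∸n a h) (ℕ.+-monoʳ-≤ h (ℕ.m≤n⊔m j (a ℕ.∸ h)))) (∈-* (π^∈ h) β∈′)) (∈-weaken a≤C γ∈)
    from : ∀ {β} → Solution γ a j h β → β - 0# ∈π^ j ℕ.⊔ (a ℕ.∸ h)
    from {β} (β∈j , eq) = ≤v-cong (solve 1 (λ b → b := b :- :0) refl β) (max (ℕ.⊔-sel j (a ℕ.∸ h)))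
      where
      πʰβ∈ : β * π ^ h ∈π^ a
      πʰβ∈ = ≤v-cong (trans (solve 2 (λ x g → (x :- g) :+ g := x) refl (π ^ h * β) γ) (*-comm _ _)) (≤v-+ eq (∈-weaken a≤C γ∈))
      low : β ∈π^ a ℕ.∸ h
      low with h ℕ.≤? a
      ... | yes h≤a = cancel {β} {a ℕ.∸ h} h (≡.subst (β * π ^ h ∈π^_) (≡.sym (ℕ.m∸n+n≡m h≤a)) πʰβ∈)
      ... | no h≰a = ≡.subst (β ∈π^_) (≡.sym (ℕ.m≤n⇒m∸n≡0 (ℕ.<⇒≤ (ℕ.≰⇒> h≰a)))) (∈⇒𝒪 β∈j)
      max : j ℕ.⊔ (a ℕ.∸ h) ≡ j ⊎ j ℕ.⊔ (a ℕ.∸ h) ≡ a ℕ.∸ h → β ∈π^ j ℕ.⊔ (a ℕ.∸ h)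
      max (inj₁ eq) = ≡.subst (β ∈π^_) (≡.sym eq) β∈j
      max (inj₂ eq) = ≡.subst (β ∈π^_) (≡.sym eq) low
   decide (no a≰C) (yes j+h≤C) = enumeration-resp (≡.cong (q ℕ.^_) (ℕ.m∸[m∸n]≡n h≤a)) to from (coset β₀ (ℕ.m∸n≤m a h))
    where
    h≤C : h ℕ.≤ C
    h≤C = ℕ.≤-trans (ℕ.m≤n+m h j) j+h≤C
    h≤a : h ℕ.≤ a
    h≤a = ℕ.≤-trans h≤C (ℕ.<⇒≤ (ℕ.≰⇒> a≰C))
    -- The particular solution is γ / π^h. It lies in π^j 𝔬 because π^C divides γ and j + h ≤ C.
    quotient = divide {γ} {h} (∈-weaken h≤C γ∈)
    β₀ = proj₁ quotient
    β₀∈ : β₀ ∈π^ j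
    β₀∈ = cancel {β₀} {j} h (≤v-cong (proj₂ (proj₂ quotient)) (∈-weaken j+h≤C γ∈))
    difference : ∀ β → (β - β₀) * π ^ h ≈ π ^ h * β - γ
    difference β = trans (solve 3 (λ b b₀ z → (b :- b₀) :* z := z :* b :- b₀ :* z) refl β β₀ (π ^ h))
      (+-congˡ (-‿cong (sym (proj₂ (proj₂ quotient)))))
    j≤a∸h : j ℕ.≤ a ℕ.∸ h
    j≤a∸h = ℕ.≤-trans (ℕ.≤-reflexive (≡.sym (ℕ.m+n∸n≡m j h))) (ℕ.∸-monoˡ-≤ h (ℕ.≤-trans j+h≤C (ℕ.<⇒≤ (ℕ.≰⇒> a≰C))))
    to : ∀ {β} → β - β₀ ∈π^ a ℕ.∸ h → Solution γ a j h β
    to {β} k = ≤v-cong (solve 2 (λ b b₀ → (b :- b₀) :+ b₀ := b) refl β β₀) (≤v-+ (∈-weaken j≤a∸h k) β₀∈) ,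
      ≡.subst (π ^ h * β - γ ∈π^_) (ℕ.m∸n+n≡m h≤a) (≤v-cong (difference β) (∈-* k (π^∈ h)))
    from : ∀ {β} → Solution γ a j h β → β - β₀ ∈π^ a ℕ.∸ h
    from {β} (_ , k) = cancel {β - β₀} {a ℕ.∸ h} h (≡.subst ((β - β₀) * π ^ h ∈π^_) (≡.sym (ℕ.m∸n+n≡m h≤a)) (≤v-cong (sym (difference β)) k))
   -- C = f is excluded by a ≤ f, and C = b + 1 by j + h ≤ b + 1. Otherwise γ, congruent modulo π^a
   -- to a multiple of π^(j+h), would be divisible by π^(C+1).
   decide (no a≰C) (no j+h≰C) = empty λ {β} → [ (λ C≡f _ → a≰C (≡.subst (a ℕ.≤_) (≡.sym C≡f) a≤f)) ,
          [ (λ C≡ _ → j+h≰C (≡.subst (j ℕ.+ h ℕ.≤_) (≡.sym C≡) j+h≤)) ,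
            (λ γ∉ (β∈ , k) → γ∉ (≤v-cong (solve 2 (λ x g → x :- (x :- g) := g) refl (π ^ h * β) γ)
              (≤v-sub (∈-weaken (ℕ.≤-trans (ℕ.≰⇒> j+h≰C) (ℕ.≤-reflexive (ℕ.+-comm j h))) (∈-* (π^∈ h) β∈)) (∈-weaken (ℕ.≰⇒> a≰C) k)))) ]′ ]′ sharp

-- Evaluation of the formula

Σ< : ℕ → (ℕ → ℕ) → ℕ
Σ< zero g = 0
Σ< (suc n) g = g 0 ℕ.+ Σ< n (g ∘ suc)

Σ<-cong : ∀ n {g h : ℕ → ℕ} → (∀ i → i ℕ.< n → g i ≡ h i) → Σ< n g ≡ Σ< n h
Σ<-cong zero eq = ≡.refl
Σ<-cong (suc n) eq = ≡.cong₂ ℕ._+_ (eq 0 (s≤s z≤n)) (Σ<-cong n (λ i i<n → eq (suc i) (s≤s i<n)))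

Σ<-+ : ∀ n (g h : ℕ → ℕ) → Σ< n (λ i → g i ℕ.+ h i) ≡ Σ< n g ℕ.+ Σ< n h
Σ<-+ zero g h = ≡.refl
Σ<-+ (suc n) g h = ≡.trans (≡.cong (g 0 ℕ.+ h 0 ℕ.+_) (Σ<-+ n (g ∘ suc) (h ∘ suc)))
  (interchange (g 0) (h 0) (Σ< n (g ∘ suc)) (Σ< n (h ∘ suc)))
  where open Algebra.Properties.CommutativeSemigroup ℕ.+-commutativeSemigroup using (interchange)

Σ<-0 : ∀ n {g : ℕ → ℕ} → (∀ i → i ℕ.< n → g i ≡ 0) → Σ< n g ≡ 0
Σ<-0 zero eq = ≡.refl
Σ<-0 (suc n) eq = ≡.cong₂ ℕ._+_ (eq 0 (s≤s z≤n)) (Σ<-0 n (λ i i<n → eq (suc i) (s≤s i<n)))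

Σ<-swap : ∀ m n (g : ℕ → ℕ → ℕ) → Σ< m (λ i → Σ< n (g i)) ≡ Σ< n (λ j → Σ< m (λ i → g i j))
Σ<-swap zero n g = ≡.sym (Σ<-0 n (λ _ _ → ≡.refl))
Σ<-swap (suc m) n g = ≡.trans (≡.cong (Σ< n (g 0) ℕ.+_) (Σ<-swap m n (g ∘ suc))) (≡.sym (Σ<-+ n (g 0) (λ j → Σ< m (λ i → g (suc i) j))))

Σ<-update : ∀ n {g h : ℕ → ℕ} {d} k → k ℕ.< n → g k ≡ h k ℕ.+ d → (∀ i → i ℕ.< n → i ≢ k → g i ≡ h i) → Σ< n g ≡ Σ< n h ℕ.+ d
Σ<-update (suc n) {g} {h} {d} zero _ eq rest = ≡.trans
  (≡.cong₂ ℕ._+_ eq (Σ<-cong n (λ i i<n → rest (suc i) (s≤s i<n) λ ())))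
  (≡.trans (ℕ.+-assoc (h 0) d _) (≡.trans (≡.cong (h 0 ℕ.+_) (ℕ.+-comm d _)) (≡.sym (ℕ.+-assoc (h 0) _ d))))
Σ<-update (suc n) {g} {h} (suc k) (s≤s k<n) eq rest = ≡.trans
  (≡.cong₂ ℕ._+_ (rest 0 (s≤s z≤n) λ ()) (Σ<-update n k k<n eq (λ i i<n i≢k → rest (suc i) (s≤s i<n) (i≢k ∘ ℕ.suc-injective))))
  (≡.sym (ℕ.+-assoc (h 0) _ _))

Σ<-split : ∀ l n g → Σ< (l ℕ.+ n) g ≡ Σ< l g ℕ.+ Σ< n (λ j → g (l ℕ.+ j))
Σ<-split zero n g = ≡.refl
Σ<-split (suc l) n g = ≡.trans (≡.cong (g 0 ℕ.+_) (Σ<-split l n (g ∘ suc))) (≡.sym (ℕ.+-assoc (g 0) _ _))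

abstract
  -- Abstract, so that sums are compared through the homomorphism property and not by normalising
  -- fractions.
  fromℕ : ℕ → ℚ
  fromℕ n = + n / 1

  fromℕ-+ : ∀ m n → fromℕ (m ℕ.+ n) ≡ fromℕ m ℚ.+ fromℕ n
  fromℕ-+ m n = ℚ.toℚᵘ-injective (ℚᵘ.≃-trans (to (m ℕ.+ n)) (ℚᵘ.≃-trans sum
    (ℚᵘ.≃-trans (ℚᵘ.+-cong (ℚᵘ.≃-sym (to m)) (ℚᵘ.≃-sym (to n))) (ℚᵘ.≃-sym (ℚ.toℚᵘ-homo-+ (fromℕ m) (fromℕ n))))))
    where
    to : ∀ n → ℚ.toℚᵘ (fromℕ n) ℚᵘ.≃ ℚᵘ.mkℚᵘ (+ n) 0
    to n = ℚ.toℚᵘ-fromℚᵘ (ℚᵘ.mkℚᵘ (+ n) 0)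
    sum : ℚᵘ.mkℚᵘ (+ (m ℕ.+ n)) 0 ℚᵘ.≃ ℚᵘ.mkℚᵘ (+ m) 0 ℚᵘ.+ ℚᵘ.mkℚᵘ (+ n) 0
    sum = ℚᵘ.*≡* (≡.cong (ℤ._* + 1) (≡.cong₂ ℤ._+_ (≡.sym (ℤ.*-identityʳ (+ m))) (≡.sym (ℤ.*-identityʳ (+ n)))))

  fromℕ-0 : fromℕ 0 ≡ 0ℚ
  fromℕ-0 = ≡.refl

  fromℕ-≡ : ∀ n → fromℕ n ≡ + n / 1
  fromℕ-≡ n = ≡.refl

fromℕ-∸ : ∀ {m n} → n ℕ.≤ m → fromℕ (m ℕ.∸ n) ≡ fromℕ m ℚ.- fromℕ n
fromℕ-∸ {m} {n} n≤m = ≡.trans (≡.sym (ℚ.+-identityʳ _)) (≡.trans (≡.cong (fromℕ (m ℕ.∸ n) ℚ.+_) (≡.sym (ℚ.+-inverseʳ (fromℕ n))))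
  (≡.trans (≡.sym (ℚ.+-assoc (fromℕ (m ℕ.∸ n)) (fromℕ n) (ℚ.- fromℕ n)))
  (≡.cong (ℚ._- fromℕ n) (≡.trans (≡.sym (fromℕ-+ (m ℕ.∸ n) n)) (≡.cong fromℕ (ℕ.m∸n+n≡m n≤m))))))

-- The bound l ≤ h + 1 admits the empty range, as for the sums over C < a′ ≤ f₁ when C = f₁.
∑-⋯ : ∀ {l h} → l ℕ.≤ suc h → ∀ {t : ℤ → ℚ} {g : ℕ → ℕ} → (∀ j → j ℕ.< suc h ℕ.∸ l → t (+ (l ℕ.+ j)) ≡ fromℕ (g j)) →
      ∑ (+ l ⋯ + h) t ≡ fromℕ (Σ< (suc h ℕ.∸ l) g)
∑-⋯ {l} {h} l≤ {t} {g} eq = ≡.trans (≡.cong (λ is → ∑ is t) (range (ℕ.m≤n⇒m<n∨m≡n l≤))) (sum (suc h ℕ.∸ l) id g eq)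
  where
  range : l ℕ.< suc h ⊎ l ≡ suc h → (+ l ⋯ + h) ≡ map (λ i → + l ℤ.+ + i) (upTo (suc h ℕ.∸ l))
  range (inj₁ (s≤s l≤h)) rewrite ℤ.m-n≡m⊖n h l | ℤ.⊖-≥ l≤h | ℕ.+-∸-assoc 1 l≤h = ≡.refl
  range (inj₂ ≡.refl) rewrite ℤ.m-n≡m⊖n h (suc h) | ℤ.⊖-< (ℕ.n<1+n h) | ℕ.m+n∸n≡m 1 h | ℕ.n∸n≡0 h = ≡.refl

  sum : ∀ n (s : ℕ → ℕ) (g : ℕ → ℕ) → (∀ j → j ℕ.< n → t (+ (l ℕ.+ s j)) ≡ fromℕ (g j)) →
        foldr ℚ._+_ 0ℚ (map t (map (λ i → + l ℤ.+ + i) (applyUpTo s n))) ≡ fromℕ (Σ< n g)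
  sum zero s g eq = ≡.sym fromℕ-0
  sum (suc n) s g eq = ≡.trans (≡.cong₂ ℚ._+_ (eq 0 (s≤s z≤n)) (sum n (s ∘ suc) (g ∘ suc) (λ j j<n → eq (suc j) (s≤s j<n))))
    (≡.sym (fromℕ-+ (g 0) (Σ< n (g ∘ suc))))

when-≡ : ∀ {p} {P : Set p} {t : ℚ} {n : ℕ} {b : Bool} (P? : Dec P) → does P? ≡ b → (P → t ≡ fromℕ n) →
         (t when P?) ≡ fromℕ (if b then n else 0)
when-≡ (yes p) ≡.refl eq = eq p
when-≡ (no ¬p) ≡.refl eq = ≡.sym fromℕ-0

/2-≡ : ∀ n → n ℕ./ 2 ≡ ℕ.⌊ n /2⌋
/2-≡ zero = ≡.refl
/2-≡ (suc zero) = ≡.refl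
/2-≡ (suc (suc n)) = ≡.trans (ℕ.m/n≡1+[m∸n]/n {suc (suc n)} {2} (s≤s (s≤s z≤n))) (≡.cong suc (/2-≡ n))

⌊+/2⌋ : ∀ n → ⌊ + n /2⌋ ≡ + ℕ.⌊ n /2⌋
⌊+/2⌋ n = ≡.trans (ℤ.*-identityˡ (+ (n ℕ./ 2))) (≡.cong +_ (/2-≡ n))

⌈+/2⌉ : ∀ n → ⌈ + n /2⌉ ≡ + ℕ.⌈ n /2⌉
⌈+/2⌉ zero = ≡.refl
⌈+/2⌉ (suc n) = ≡.trans (≡.cong ℤ.-_ (ℤ.*-identityˡ (-[1+ n ] ℤ./ℕ 2))) (negate n)
  where
  %2 : ∀ n → (n ℕ.% 2 ≡ 0 → ℕ.⌈ n /2⌉ ≡ ℕ.⌊ n /2⌋) × (∀ {r} → n ℕ.% 2 ≡ suc r → ℕ.⌈ n /2⌉ ≡ suc ℕ.⌊ n /2⌋)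
  %2 zero = (λ _ → ≡.refl) , λ ()
  %2 (suc zero) = (λ ()) , λ _ → ≡.refl
  %2 (suc (suc n)) = let (h , h′) = %2 n ; eq = ℕ.[m+n]%n≡m%n n 2 ; comm = ≡.cong (ℕ._% 2) (ℕ.+-comm n 2) in
    (λ e → ≡.cong suc (h (≡.trans (≡.sym eq) (≡.trans comm e)))) , λ e → ≡.cong suc (h′ (≡.trans (≡.sym eq) (≡.trans comm e)))
  negate : ∀ n → ℤ.- (-[1+ n ] ℤ./ℕ 2) ≡ + ℕ.⌈ suc n /2⌉
  negate n with suc n ℕ.% 2 in eq
  ... | zero = ≡.trans (ℤ.neg-involutive _) (≡.cong +_ (≡.trans (/2-≡ (suc n)) (≡.sym (proj₁ (%2 (suc n)) eq))))
  ... | suc r = ≡.cong +_ (≡.trans (≡.cong suc (/2-≡ (suc n))) (≡.sym (proj₂ (%2 (suc n)) eq)))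

+-∸ : ∀ {m n} → n ℕ.≤ m → + m ℤ.- + n ≡ + (m ℕ.∸ n)
+-∸ {m} {n} n≤m = ≡.trans (ℤ.m-n≡m⊖n m n) (ℤ.⊖-≥ n≤m)

2*+ : ∀ n → + 2 ℤ.* + n ≡ + (n ℕ.+ n)
2*+ n = ≡.trans (≡.sym (ℤ.pos-* 2 n)) (≡.cong (λ z → + (n ℕ.+ z)) (ℕ.+-identityʳ n))

⌊double/2⌋ : ∀ i → ℕ.⌊ i ℕ.+ i /2⌋ ≡ i
⌊double/2⌋ i = ≡.sym (ℕ.n≡⌊n+n/2⌋ i)

⌊1+double/2⌋ : ∀ i → ℕ.⌊ suc (i ℕ.+ i) /2⌋ ≡ i
⌊1+double/2⌋ i = ≡.sym (ℕ.n≡⌈n+n/2⌉ i)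

infixr 7 ⟨_⟩_

⟨_⟩_ : ∀ {p} {P : Set p} → Dec P → ℕ → ℕ
⟨ P? ⟩ n = if does P? then n else 0

⟨⟩-yes : ∀ {p} {P : Set p} {n} (P? : Dec P) → P → ⟨ P? ⟩ n ≡ n
⟨⟩-yes (yes _) p = ≡.refl
⟨⟩-yes (no ¬p) p = ⊥-elim (¬p p)

⟨⟩-no : ∀ {p} {P : Set p} {n} (P? : Dec P) → ¬ P → ⟨ P? ⟩ n ≡ 0
⟨⟩-no (yes p) ¬p = ⊥-elim (¬p p)
⟨⟩-no (no _) ¬p = ≡.refl

⟨⟩-cong : ∀ {p p′} {P : Set p} {Q : Set p′} {m n} (P? : Dec P) (Q? : Dec Q) → P ⇔ Q → (P → m ≡ n) → ⟨ P? ⟩ m ≡ ⟨ Q? ⟩ n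
⟨⟩-cong (yes p) Q? P⇔Q eq = ≡.trans (eq p) (≡.sym (⟨⟩-yes Q? (Equivalence.to P⇔Q p)))
⟨⟩-cong (no ¬p) Q? P⇔Q eq = ≡.sym (⟨⟩-no Q? (¬p ∘ Equivalence.from P⇔Q))

Σ<-shift : ∀ l n (g : ℕ → ℕ) → l ℕ.≤ n → Σ< (n ℕ.∸ l) (λ j → g (l ℕ.+ j)) ≡ Σ< n (λ a → ⟨ l ℕ.≤? a ⟩ g a)
Σ<-shift l n g l≤n = ≡.trans (Σ<-cong (n ℕ.∸ l) (λ j _ → ≡.sym (⟨⟩-yes (l ℕ.≤? l ℕ.+ j) (ℕ.m≤m+n l j))))
  (≡.trans (≡.cong (ℕ._+ Σ< (n ℕ.∸ l) (λ j → g′ (l ℕ.+ j))) (≡.sym (Σ<-0 l (λ i i<l → ⟨⟩-no (l ℕ.≤? i) (ℕ.<⇒≱ i<l)))))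
  (≡.trans (≡.sym (Σ<-split l (n ℕ.∸ l) g′)) (≡.cong (λ k → Σ< k g′) (ℕ.m+[n∸m]≡n l≤n))))
  where
  g′ : ℕ → ℕ
  g′ a = ⟨ l ℕ.≤? a ⟩ g a

≤-⇔ : ∀ {x y i j} → x ≡ + i → y ≡ + j → (x ℤ.≤ y) ⇔ (i ℕ.≤ j)
≤-⇔ ≡.refl ≡.refl = mk⇔ ℤ.drop‿+≤+ ℤ.+≤+

<-⇔ : ∀ {x y i j} → x ≡ + i → y ≡ + j → (x ℤ.< y) ⇔ (i ℕ.< j)
<-⇔ ≡.refl ≡.refl = mk⇔ ℤ.drop‿+<+ ℤ.+<+

id-⇔ : ∀ {p} {P : Set p} → P ⇔ P
id-⇔ = mk⇔ id id

_×-⇔_ : ∀ {p q r s} {P : Set p} {Q : Set q} {R : Set r} {S : Set s} → P ⇔ Q → R ⇔ S → (P × R) ⇔ (Q × S)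
f ×-⇔ g = mk⇔ (λ (p , r) → Equivalence.to f p , Equivalence.to g r) (λ (q , s) → Equivalence.from f q , Equivalence.from g s)

when-⟨⟩ : ∀ {p p′} {P : Set p} {Q : Set p′} {t : ℚ} {n : ℕ} (P? : Dec P) (Q? : Dec Q) → P ⇔ Q → (Q → t ≡ fromℕ n) →
          (t when P?) ≡ fromℕ (⟨ Q? ⟩ n)
when-⟨⟩ P? Q? P⇔Q eq = when-≡ P? (does-⇔ P⇔Q P? Q?) (eq ∘ Equivalence.to P⇔Q)

module _ {p p′} {P : ℤ → Set p} {Q : ℕ → Set p′} (t : ℤ → ℚ) (P? : ∀ a → Dec (P a)) {n : ℕ → ℕ} (Q? : ∀ j → Dec (Q j)) where

  ∑-when : ∀ l h → l ℕ.≤ suc h → (∀ j → P (+ (l ℕ.+ j)) ⇔ Q j) →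
           (∀ j → j ℕ.< suc h ℕ.∸ l → Q j → t (+ (l ℕ.+ j)) ≡ fromℕ (n j)) →
           ∑ (+ l ⋯ + h) (λ a → t a when P? a) ≡ fromℕ (Σ< (suc h ℕ.∸ l) (λ j → ⟨ Q? j ⟩ n j))
  ∑-when l h l≤ P⇔Q eq = ∑-⋯ {l} {h} l≤ {λ a → t a when P? a} {λ j → ⟨ Q? j ⟩ n j}
    (λ j j< → when-⟨⟩ (P? (+ (l ℕ.+ j))) (Q? j) (P⇔Q j) (eq j j<))

  -- With k = a′ - 1 the sum extends over all k < f, so that summands with a′ > C can be added
  -- termwise to those with a′ ≤ C.
  ∑-when-tail : ∀ {z} C f → z ≡ + suc C → C ℕ.≤ f → (∀ k → P (+ suc k) ⇔ Q k) →
                (∀ k → k ℕ.< f → Q k → t (+ suc k) ≡ fromℕ (n k)) →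
                ∑ (z ⋯ + f) (λ a → t a when P? a) ≡ fromℕ (Σ< f (λ k → ⟨ C ℕ.≤? k ⟩ ⟨ Q? k ⟩ n k))
  ∑-when-tail C f ≡.refl C≤f P⇔Q eq = ≡.trans
    (∑-⋯ {suc C} {f} (s≤s C≤f) {λ a → t a when P? a} {λ j → ⟨ Q? (C ℕ.+ j) ⟩ n (C ℕ.+ j)} λ j j< →
      when-⟨⟩ (P? (+ suc (C ℕ.+ j))) (Q? (C ℕ.+ j)) (P⇔Q (C ℕ.+ j))
        (eq (C ℕ.+ j) (ℕ.≤-trans (ℕ.+-monoʳ-< C j<) (ℕ.≤-reflexive (ℕ.m+[n∸m]≡n C≤f)))))
    (≡.cong fromℕ (Σ<-shift C f (λ k → ⟨ Q? k ⟩ n k) C≤f))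

module Terms (q b C : ℕ) where
  -- The numbers of classes with given m and a. For orders a ≤ 2 m + 1, and β lies in π^⌈a/2⌉ 𝔬; for
  -- duals a + 1 replaces a in the condition on the norm, whence a ≤ 2 m and ⌈(a+1)/2⌉ = ⌊a/2⌋ + 1.
  over-count dual-count : ℕ → ℕ → ℕ
  over-count m a = ⟨ a ℕ.≤? suc (m ℕ.+ m) ⟩ choose q a ℕ.⌈ a /2⌉ (b ℕ.∸ m) (a ℕ.≤? C) (ℕ.⌈ a /2⌉ ℕ.+ (b ℕ.∸ m) ℕ.≤? C)
  dual-count m a = ⟨ 1 ℕ.≤? a ×-dec a ℕ.≤? m ℕ.+ m ⟩
    choose q a (suc ℕ.⌊ a /2⌋) (b ℕ.∸ m) (a ℕ.≤? C) (suc ℕ.⌊ a /2⌋ ℕ.+ (b ℕ.∸ m) ℕ.≤? C)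

  main₁-term main₂-term even₁-term : ℕ → ℕ → ℕ
  main₁-term m a = ⟨ a ℕ.≤? suc (m ℕ.+ m) ×-dec a ℕ.≤? C ⟩ q ℕ.^ (ℕ.⌊ a /2⌋ ℕ.⊓ (b ℕ.∸ m))
  main₂-term m a = ⟨ a ℕ.≤? suc (m ℕ.+ m) ×-dec ℕ.⌈ a /2⌉ ℕ.+ (b ℕ.∸ m) ℕ.≤? C ⟩ q ℕ.^ (b ℕ.∸ m)
  even₁-term m a = ⟨ a ℕ.<? suc (m ℕ.+ m) ×-dec 2 ℕ.∣? a ×-dec a ℕ.≤? C ×-dec ℕ.⌊ a /2⌋ ℕ.≤? b ℕ.∸ m ⟩
    (q ℕ.^ ℕ.⌊ a /2⌋ ℕ.∸ q ℕ.^ (ℕ.⌊ a /2⌋ ℕ.∸ 1))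

  -- The sums over a′ ≥ 1 are indexed by k = a′ - 1, and so are the odd terms.
  odd₁-term odd₂-term even₂-term : ℕ → ℕ
  odd₁-term k = ⟨ suc k ℕ.≤? C ×-dec 2 ℕ.∣? k ⟩ q ℕ.^ (ℕ.⌊ k /2⌋ ℕ.⊓ (b ℕ.∸ ℕ.⌊ k /2⌋))
  odd₂-term k = ⟨ 2 ℕ.∣? k ×-dec suc b ℕ.≤? C ⟩ q ℕ.^ (b ℕ.∸ ℕ.⌊ k /2⌋)
  even₂-term a = ⟨ 2 ℕ.∣? a ×-dec C ℕ.≤? b ⟩ q ℕ.^ (C ℕ.∸ ℕ.⌊ a /2⌋)

module Evaluation (q : ℕ) .{{_ : ℕ.NonZero q}} (s f f₂ : ℕ) {b C : ℕ}
    (b≡ : Formula.b q s f f₂ ≡ + b) (C≡ : Formula.C q s f f₂ ≡ + C)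
    (C≤f : C ℕ.≤ f) (C≤1+b : C ℕ.≤ suc b) (f≤1+2b : f ℕ.≤ suc (b ℕ.+ b)) (f≤2C : f ℕ.≤ C ℕ.+ C) where
  open Formula q s f f₂ using (q^_; main₁; main₂; odd₁; odd₂; even₁; even₂; count) renaming (b to bℤ; C to Cℤ)
  open Terms q b C public

  private
    b-≡ : ∀ {m x} → m ℕ.≤ b → x ≡ + m → bℤ ℤ.- x ≡ + (b ℕ.∸ m)
    b-≡ m≤b ≡.refl = ≡.trans (≡.cong (ℤ._- + _) b≡) (+-∸ m≤b)

    2m+1≡ : ∀ m → + 2 ℤ.* + m ℤ.+ + 1 ≡ + suc (m ℕ.+ m)
    2m+1≡ m = ≡.trans (≡.cong (ℤ._+ + 1) (2*+ m)) (≡.cong +_ (ℕ.+-comm (m ℕ.+ m) 1))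

    C+1≡ : Cℤ ℤ.+ + 1 ≡ + suc C
    C+1≡ = ≡.trans (≡.cong (ℤ._+ + 1) C≡) (≡.cong +_ (ℕ.+-comm C 1))

    floor-suc : ∀ k → ⌊ + suc k ℤ.- + 1 /2⌋ ≡ + ℕ.⌊ k /2⌋
    floor-suc k = ⌊+/2⌋ k

    q^-≡ : ∀ {x n} → x ≡ + n → q^ x ≡ fromℕ (q ℕ.^ n)
    q^-≡ ≡.refl = ≡.sym (fromℕ-≡ _)

    -- The bounds on f keep the exponents b - (a′ - 1)/2, and likewise C - a′/2, nonnegative, so
    -- that the integer powers of q are natural numbers.
    half≤b : ∀ {k} → k ℕ.< f → ℕ.⌊ k /2⌋ ℕ.≤ b
    half≤b k<f = ℕ.≤-trans (ℕ.⌊n/2⌋-mono (ℕ.≤-pred (ℕ.≤-trans k<f f≤1+2b))) (ℕ.≤-reflexive (⌊double/2⌋ b))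

    half≤C : ∀ {k} → k ℕ.< f → ℕ.⌊ suc k /2⌋ ℕ.≤ C
    half≤C k<f = ℕ.≤-trans (ℕ.⌊n/2⌋-mono (ℕ.≤-trans k<f f≤2C)) (ℕ.≤-reflexive (⌊double/2⌋ C))

  main₁-≡ : ∀ {m} → m ℕ.≤ b → main₁ (+ m) ≡ fromℕ (Σ< (suc f) (main₁-term m))
  main₁-≡ {m} m≤b = ∑-when
    (λ a → q^ (⌊ a /2⌋ ℤ.⊓ (bℤ ℤ.- + m))) (λ a → a ℤ.≤? + 2 ℤ.* + m ℤ.+ + 1 ×-dec a ℤ.≤? Cℤ)
    (λ a → a ℕ.≤? suc (m ℕ.+ m) ×-dec a ℕ.≤? C) 0 f z≤n
    (λ a → ≤-⇔ ≡.refl (2m+1≡ m) ×-⇔ ≤-⇔ ≡.refl C≡)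
    (λ a _ _ → q^-≡ (≡.cong₂ ℤ._⊓_ (⌊+/2⌋ a) (b-≡ m≤b ≡.refl)))

  main₂-≡ : ∀ {m} → m ℕ.≤ b → main₂ (+ m) ≡ fromℕ (Σ< f (λ k → ⟨ C ℕ.≤? k ⟩ main₂-term m (suc k)))
  main₂-≡ {m} m≤b = ∑-when-tail
    (λ a → q^ (bℤ ℤ.- + m)) (λ a → a ℤ.≤? + 2 ℤ.* + m ℤ.+ + 1 ×-dec ⌈ a /2⌉ ℤ.- + m ℤ.≤? Cℤ ℤ.- bℤ)
    (λ k → suc k ℕ.≤? suc (m ℕ.+ m) ×-dec ℕ.⌈ suc k /2⌉ ℕ.+ (b ℕ.∸ m) ℕ.≤? C) C f C+1≡ C≤f
    (λ k → ≤-⇔ ≡.refl (2m+1≡ m) ×-⇔ difference (suc k))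
    (λ k _ _ → q^-≡ (b-≡ m≤b ≡.refl))
    where
    open IntegerCoefficients ℤ.+-*-commutativeRing using (solve; _:=_; _:+_; _:-_; :-_)
    difference : ∀ a → (⌈ + a /2⌉ ℤ.- + m ℤ.≤ Cℤ ℤ.- bℤ) ⇔ (ℕ.⌈ a /2⌉ ℕ.+ (b ℕ.∸ m) ℕ.≤ C)
    difference a = ≡.subst₂ (λ x y → (x ℤ.≤ y) ⇔ (ℕ.⌈ a /2⌉ ℕ.+ (b ℕ.∸ m) ℕ.≤ C))
      (≡.cong (ℤ._- + m) (≡.sym (⌈+/2⌉ a))) (≡.cong₂ ℤ._-_ (≡.sym C≡) (≡.sym b≡)) (mk⇔
      (λ h → ℤ.drop‿+≤+ (≡.subst₂ ℤ._≤_
        (≡.trans (solve 3 (λ x m b → x :- m :+ b := x :+ (b :- m)) ≡.refl (+ ℕ.⌈ a /2⌉) (+ m) (+ b)) (≡.cong (λ z → + ℕ.⌈ a /2⌉ ℤ.+ z) (+-∸ m≤b)))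
        (solve 2 (λ c b → c :- b :+ b := c) ≡.refl (+ C) (+ b)) (ℤ.+-monoˡ-≤ (+ b) h)))
      (λ h → ≡.subst (ℤ._≤ + C ℤ.- + b)
        (≡.trans (≡.cong (λ z → + ℕ.⌈ a /2⌉ ℤ.+ z ℤ.- + b) (≡.sym (+-∸ m≤b)))
          (solve 3 (λ x m b → x :+ (b :- m) :- b := x :- m) ≡.refl (+ ℕ.⌈ a /2⌉) (+ m) (+ b)))
        (ℤ.+-monoˡ-≤ (ℤ.- + b) (ℤ.+≤+ h))))

  odd₁-≡ : odd₁ ≡ fromℕ (Σ< f odd₁-term)
  odd₁-≡ = ∑-when
    (λ a → q^ (⌊ a ℤ.- + 1 /2⌋ ℤ.⊓ (bℤ ℤ.- ⌊ a ℤ.- + 1 /2⌋))) (λ a → a ℤ.≤? Cℤ ×-dec 2∣? (a ℤ.- + 1))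
    (λ k → suc k ℕ.≤? C ×-dec 2 ℕ.∣? k) 1 f (s≤s z≤n)
    (λ k → ≤-⇔ ≡.refl C≡ ×-⇔ id-⇔)
    (λ k k<f _ → q^-≡ (≡.cong₂ ℤ._⊓_ (floor-suc k) (b-≡ (half≤b k<f) (floor-suc k))))

  odd₂-≡ : odd₂ ≡ fromℕ (Σ< f (λ k → ⟨ C ℕ.≤? k ⟩ odd₂-term k))
  odd₂-≡ = ∑-when-tail
    (λ a → q^ (bℤ ℤ.- ⌊ a ℤ.- + 1 /2⌋)) (λ a → 2∣? (a ℤ.- + 1) ×-dec bℤ ℤ.+ + 1 ℤ.≤? Cℤ)
    (λ k → 2 ℕ.∣? k ×-dec suc b ℕ.≤? C) C f C+1≡ C≤f
    (λ k → id-⇔ ×-⇔ ≤-⇔ (≡.trans (≡.cong (ℤ._+ + 1) b≡) (≡.cong +_ (ℕ.+-comm b 1))) C≡)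
    (λ k k<f _ → q^-≡ (b-≡ (half≤b k<f) (floor-suc k)))

  even₂-≡ : even₂ ≡ fromℕ (Σ< f (λ k → ⟨ C ℕ.≤? k ⟩ even₂-term (suc k)))
  even₂-≡ = ∑-when-tail
    (λ a → q^ (Cℤ ℤ.- ⌊ a /2⌋)) (λ a → 2∣? a ×-dec Cℤ ℤ.≤? bℤ)
    (λ k → 2 ℕ.∣? suc k ×-dec C ℕ.≤? b) C f C+1≡ C≤f
    (λ k → id-⇔ ×-⇔ ≤-⇔ C≡ b≡)
    (λ k k<f _ → q^-≡ (≡.trans (≡.cong₂ ℤ._-_ C≡ (⌊+/2⌋ (suc k))) (+-∸ (half≤C k<f))))

  even₁-≡ : ∀ {m} → m ℕ.≤ b → even₁ (+ m) ≡ fromℕ (Σ< f (λ k → even₁-term m (suc k)))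
  even₁-≡ {m} m≤b = ∑-when
    (λ a → q^ ⌊ a /2⌋ ℚ.- q^ (⌊ a /2⌋ ℤ.- + 1))
    (λ a → a ℤ.<? + 2 ℤ.* + m ℤ.+ + 1 ×-dec 2∣? a ×-dec a ℤ.≤? Cℤ ×-dec ⌊ a /2⌋ ℤ.≤? bℤ ℤ.- + m)
    (λ k → suc k ℕ.<? suc (m ℕ.+ m) ×-dec 2 ℕ.∣? suc k ×-dec suc k ℕ.≤? C ×-dec ℕ.⌊ suc k /2⌋ ℕ.≤? b ℕ.∸ m) 1 f (s≤s z≤n)
    (λ k → <-⇔ ≡.refl (2m+1≡ m) ×-⇔ (id-⇔ ×-⇔ (≤-⇔ ≡.refl C≡ ×-⇔ ≤-⇔ (⌊+/2⌋ (suc k)) (b-≡ m≤b ≡.refl))))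
    (λ k k<f (_ , 2∣a , _) → term k (positive k 2∣a))
    where
    positive : ∀ k → 2 ℕ.∣ suc k → 1 ℕ.≤ ℕ.⌊ suc k /2⌋
    positive zero 2∣1 = ⊥-elim (ℕ.<⇒≱ (ℕ.n<1+n 1) (ℕ.∣⇒≤ 2∣1))
    positive (suc k) _ = s≤s z≤n
    term : ∀ k → 1 ℕ.≤ ℕ.⌊ suc k /2⌋ →
           q^ ⌊ + suc k /2⌋ ℚ.- q^ (⌊ + suc k /2⌋ ℤ.- + 1) ≡ fromℕ (q ℕ.^ ℕ.⌊ suc k /2⌋ ℕ.∸ q ℕ.^ (ℕ.⌊ suc k /2⌋ ℕ.∸ 1))
    term k i≥1 = ≡.trans (≡.cong₂ ℚ._-_ (q^-≡ (⌊+/2⌋ (suc k))) (q^-≡ (≡.trans (≡.cong (ℤ._- + 1) (⌊+/2⌋ (suc k))) (+-∸ i≥1))))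
      (≡.sym (fromℕ-∸ (ℕ.^-monoʳ-≤ q (ℕ.m∸n≤m ℕ.⌊ suc k /2⌋ 1))))

double-cancel-≤ : ∀ {i m} → i ℕ.+ i ℕ.≤ m ℕ.+ m → i ℕ.≤ m
double-cancel-≤ {i} {m} h = ≡.subst₂ ℕ._≤_ (⌊double/2⌋ i) (⌊double/2⌋ m) (ℕ.⌊n/2⌋-mono h)

2∣double : ∀ i → 2 ℕ.∣ i ℕ.+ i
2∣double i = ℕ.divides i (≡.trans (≡.cong (i ℕ.+_) (≡.sym (ℕ.+-identityʳ i))) (ℕ.*-comm 2 i))

2∤1+double : ∀ i → ¬ (2 ℕ.∣ suc (i ℕ.+ i))
2∤1+double i h = ℕ.<⇒≱ (ℕ.n<1+n 1) (ℕ.∣⇒≤ (ℕ.∣m+n∣m⇒∣n (≡.subst (2 ℕ.∣_) (ℕ.+-comm 1 (i ℕ.+ i)) h) (2∣double i)))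

choose-yes : ∀ {p p′} {P : Set p} {P′ : Set p′} q a j h (d : Dec P) (d′ : Dec P′) → P → choose q a j h d d′ ≡ q ℕ.^ ((a ℕ.∸ j) ℕ.⊓ h)
choose-yes q a j h (yes _) d′ p = ≡.refl
choose-yes q a j h (no ¬p) d′ p = ⊥-elim (¬p p)

choose-no : ∀ {p p′} {P : Set p} {P′ : Set p′} q a j h (d : Dec P) (d′ : Dec P′) → ¬ P → choose q a j h d d′ ≡ ⟨ d′ ⟩ q ℕ.^ h
choose-no q a j h (yes p) d′ ¬p = ⊥-elim (¬p p)
choose-no q a j h (no _) d′ ¬p = ≡.refl

-- Comparing the numbers of orders and duals for each exponent

module CountIdentity (q b C f : ℕ) .{{_ : ℕ.NonZero q}}
    (C≤f : C ℕ.≤ f) (C≤1+b : C ℕ.≤ suc b) (f≤1+2b : f ℕ.≤ suc (b ℕ.+ b)) (f≤2C : f ℕ.≤ C ℕ.+ C) where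
  open Terms q b C

  private
    Ch : ℕ → ℕ → ℕ → ℕ
    Ch a j h = choose q a j h (a ℕ.≤? C) (j ℕ.+ h ℕ.≤? C)

    Ch-low : ∀ a j h → a ℕ.≤ C → Ch a j h ≡ q ℕ.^ ((a ℕ.∸ j) ℕ.⊓ h)
    Ch-low a j h = choose-yes q a j h (a ℕ.≤? C) (j ℕ.+ h ℕ.≤? C)

    Ch-high : ∀ a j h → ¬ (a ℕ.≤ C) → Ch a j h ≡ ⟨ j ℕ.+ h ℕ.≤? C ⟩ q ℕ.^ h
    Ch-high a j h = choose-no q a j h (a ℕ.≤? C) (j ℕ.+ h ℕ.≤? C)

  -- The two main sums are the two branches of one count: a′ ≤ C, where γ is 0 modulo π^a′, and a′ >
  -- C.
  over-split : ∀ m k → main₁-term m (suc k) ℕ.+ ⟨ C ℕ.≤? k ⟩ main₂-term m (suc k) ≡ over-count m (suc k)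
  over-split m k = go (suc k ℕ.≤? suc (m ℕ.+ m)) (suc k ℕ.≤? C) (C ℕ.≤? k) (j ℕ.+ h ℕ.≤? C)
    where
    j = ℕ.⌈ suc k /2⌉
    h = b ℕ.∸ m
    half : suc k ℕ.∸ j ≡ ℕ.⌊ suc k /2⌋
    half = ≡.trans (≡.cong (ℕ._∸ j) (≡.sym (ℕ.⌊n/2⌋+⌈n/2⌉≡n (suc k)))) (ℕ.m+n∸n≡m ℕ.⌊ suc k /2⌋ j)
    go : ∀ {P Q : Set} (d₁ : Dec P) (d₂ : Dec (suc k ℕ.≤ C)) (d₃ : Dec (C ℕ.≤ k)) (d₄ : Dec Q) →
         (⟨ d₁ ×-dec d₂ ⟩ q ℕ.^ (ℕ.⌊ suc k /2⌋ ℕ.⊓ h)) ℕ.+ (⟨ d₃ ⟩ ⟨ d₁ ×-dec d₄ ⟩ q ℕ.^ h) ≡ ⟨ d₁ ⟩ choose q (suc k) j h d₂ d₄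
    go (no _) d₂ (yes _) d₄ = ≡.refl
    go (no _) d₂ (no _) d₄ = ≡.refl
    go (yes _) (yes a≤C) (yes C≤k) d₄ = ⊥-elim (ℕ.<⇒≱ a≤C C≤k)
    go (yes _) (yes _) (no _) d₄ = ≡.trans (ℕ.+-identityʳ _) (≡.cong (λ z → q ℕ.^ (z ℕ.⊓ h)) (≡.sym half))
    go (yes _) (no _) (yes _) (yes _) = ≡.refl
    go (yes _) (no _) (yes _) (no _) = ≡.refl
    go (yes _) (no a≰C) (no C≰k) d₄ = ⊥-elim (a≰C (ℕ.≰⇒> C≰k))

  over-total : ∀ m → Σ< (suc f) (main₁-term m) ℕ.+ Σ< f (λ k → ⟨ C ℕ.≤? k ⟩ main₂-term m (suc k)) ≡ Σ< (suc f) (over-count m)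
  over-total m = ≡.trans (ℕ.+-assoc (main₁-term m 0) (Σ< f (main₁-term m ∘ suc)) (Σ< f (λ k → ⟨ C ℕ.≤? k ⟩ main₂-term m (suc k)))) (≡.cong₂ ℕ._+_ ≡.refl
    (≡.trans (≡.sym (Σ<-+ f (main₁-term m ∘ suc) (λ k → ⟨ C ℕ.≤? k ⟩ main₂-term m (suc k)))) (Σ<-cong f (λ k _ → over-split m k))))

  -- over-count and dual-count differ by the number of self-dual classes.
  self-dual : ℕ → ℕ
  self-dual k = odd₁-term k ℕ.+ ((⟨ C ℕ.≤? k ⟩ odd₂-term k) ℕ.+ (Σ< b (λ i → even₁-term (suc i) (suc k)) ℕ.+ (⟨ C ℕ.≤? k ⟩ even₂-term (suc k))))

  private
    ⟨⟩-0 : ∀ {p} {P : Set p} {n} (P? : Dec P) → n ≡ 0 → ⟨ P? ⟩ n ≡ 0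
    ⟨⟩-0 (yes _) eq = eq
    ⟨⟩-0 (no _) eq = ≡.refl

    -- For a = 2 i + 1 both counts ask for β in π^(i+1) 𝔬 and differ only in the range of m, which
    -- starts at i for orders and at i + 1 for duals. The row m = i is the whole difference.
    odd-case : ∀ i → i ℕ.+ i ℕ.< f →
               Σ< (suc b) (λ m → over-count m (suc (i ℕ.+ i))) ≡ Σ< (suc b) (λ m → dual-count m (suc (i ℕ.+ i))) ℕ.+ self-dual (i ℕ.+ i)
    odd-case i k<f = Σ<-update (suc b) i (s≤s i≤b) at-i (λ m _ → elsewhere m)
      where
      k = i ℕ.+ i
      i≤b : i ℕ.≤ b
      i≤b = double-cancel-≤ (ℕ.≤-pred (ℕ.≤-trans k<f f≤1+2b))
      x = ℕ.⌊ k /2⌋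
      h = b ℕ.∸ i
      x≡i : x ≡ i
      x≡i = ⌊double/2⌋ i
      evens≡0 : Σ< b (λ i → even₁-term (suc i) (suc k)) ℕ.+ (⟨ C ℕ.≤? k ⟩ even₂-term (suc k)) ≡ 0
      evens≡0 = ≡.cong₂ ℕ._+_ (Σ<-0 b (λ m _ → ⟨⟩-no (suc k ℕ.<? suc (suc m ℕ.+ suc m) ×-dec 2 ℕ.∣? suc k ×-dec suc k ℕ.≤? C ×-dec ℕ.⌊ suc k /2⌋ ℕ.≤? b ℕ.∸ suc m)
          (λ (_ , 2∣ , _) → 2∤1+double i 2∣)))
        (⟨⟩-0 (C ℕ.≤? k) (⟨⟩-no (2 ℕ.∣? suc k ×-dec C ℕ.≤? b) (λ (2∣ , _) → 2∤1+double i 2∣)))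
      go : ∀ {Q} (d₂ : Dec (suc k ℕ.≤ C)) (d₃ : Dec (C ℕ.≤ k)) (d₅ : Dec (2 ℕ.∣ k)) (d₆ : Dec Q) (d₇ : Dec (suc b ℕ.≤ C)) → Q ⇔ (suc b ℕ.≤ C) →
           choose q (suc k) (suc x) h d₂ d₆ ≡ (⟨ d₂ ×-dec d₅ ⟩ q ℕ.^ (x ℕ.⊓ (b ℕ.∸ x))) ℕ.+ (⟨ d₃ ⟩ ⟨ d₅ ×-dec d₇ ⟩ q ℕ.^ (b ℕ.∸ x))
      go d₂ d₃ (no 2∤k) d₆ d₇ _ = ⊥-elim (2∤k (2∣double i))
      go (yes a≤C) (yes C≤k) (yes _) d₆ d₇ _ = ⊥-elim (ℕ.<⇒≱ a≤C C≤k)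
      go (yes a≤C) (no _) (yes _) d₆ d₇ _ = ≡.trans (≡.cong₂ (λ y z → q ℕ.^ (y ℕ.⊓ (b ℕ.∸ z)))
        (≡.trans (≡.cong (k ℕ.∸_) x≡i) (≡.trans (ℕ.m+n∸n≡m i i) (≡.sym x≡i))) (≡.sym x≡i)) (≡.sym (ℕ.+-identityʳ _))
      go (no a≰C) (no C≰k) (yes _) d₆ d₇ _ = ⊥-elim (a≰C (ℕ.≰⇒> C≰k))
      go (no a≰C) (yes _) (yes _) d₆ d₇ Q⇔ = ⟨⟩-cong d₆ d₇ Q⇔ (λ _ → ≡.cong (λ z → q ℕ.^ (b ℕ.∸ z)) (≡.sym x≡i))
      sum≡ : suc x ℕ.+ h ≡ suc b
      sum≡ = ≡.trans (≡.cong (λ z → suc z ℕ.+ h) x≡i) (≡.cong suc (ℕ.m+[n∸m]≡n i≤b))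
      at-i : over-count i (suc k) ≡ dual-count i (suc k) ℕ.+ self-dual k
      at-i = ≡.trans (⟨⟩-yes (suc k ℕ.≤? suc (i ℕ.+ i)) ℕ.≤-refl)
        (≡.trans (go (suc k ℕ.≤? C) (C ℕ.≤? k) (2 ℕ.∣? k) (suc x ℕ.+ h ℕ.≤? C) (suc b ℕ.≤? C)
          (mk⇔ (≡.subst (ℕ._≤ C) sum≡) (≡.subst (ℕ._≤ C) (≡.sym sum≡))))
        (≡.trans (≡.cong (odd₁-term k ℕ.+_) (≡.trans (≡.sym (ℕ.+-identityʳ _)) (≡.cong ((⟨ C ℕ.≤? k ⟩ odd₂-term k) ℕ.+_) (≡.sym evens≡0))))
        (≡.cong (ℕ._+ self-dual k) (≡.sym (⟨⟩-no (1 ℕ.≤? suc k ×-dec suc k ℕ.≤? i ℕ.+ i) (λ (_ , le) → ℕ.1+n≰n le))))))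
      elsewhere : ∀ m → m ≢ i → over-count m (suc k) ≡ dual-count m (suc k)
      elsewhere m m≢i = ⟨⟩-cong (suc k ℕ.≤? suc (m ℕ.+ m)) (1 ℕ.≤? suc k ×-dec suc k ℕ.≤? m ℕ.+ m)
        (mk⇔ (λ { (s≤s le) → s≤s z≤n , ℕ.+-mono-<-≤ (i<m le) (double-cancel-≤ le) }) (λ (_ , le) → ℕ.m≤n⇒m≤1+n le))
        (λ _ → ≡.cong (λ z → Ch (suc k) z (b ℕ.∸ m)) (≡.cong suc (≡.trans x≡i (≡.sym (⌊1+double/2⌋ i)))))
        where
        i<m : k ℕ.≤ m ℕ.+ m → i ℕ.< m
        i<m le = ℕ.≤∧≢⇒< (double-cancel-≤ le) (m≢i ∘ ≡.sym)

    module Even (i : ℕ) (k<f : suc (i ℕ.+ i) ℕ.< f) where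
      k a i′ : ℕ
      k = suc (i ℕ.+ i)
      a = suc k
      i′ = suc i

      a≡ : a ≡ i′ ℕ.+ i′
      a≡ = ≡.cong suc (≡.sym (ℕ.+-suc i i))

      ⌊a/2⌋≡ : ℕ.⌊ a /2⌋ ≡ i′
      ⌊a/2⌋≡ = ≡.cong suc (⌊double/2⌋ i)

      ⌈a/2⌉≡ : ℕ.⌈ a /2⌉ ≡ i′
      ⌈a/2⌉≡ = ≡.cong suc (⌊1+double/2⌋ i)

      i′≤C : i′ ℕ.≤ C
      i′≤C = double-cancel-≤ (ℕ.≤-trans (ℕ.≤-reflexive (≡.sym a≡)) (ℕ.≤-trans k<f f≤2C))

      ≤⇒i′≤ : ∀ m → a ℕ.≤ suc (m ℕ.+ m) → i′ ℕ.≤ m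
      ≤⇒i′≤ m (s≤s le) = ≡.subst₂ ℕ._≤_ (≡.cong suc (⌊double/2⌋ i)) (⌊1+double/2⌋ m) (ℕ.⌊n/2⌋-mono (s≤s le))

      i′≤⇒≤ : ∀ m → i′ ℕ.≤ m → a ℕ.≤ m ℕ.+ m
      i′≤⇒≤ m le = ℕ.≤-trans (ℕ.≤-reflexive a≡) (ℕ.+-mono-≤ le le)

      bounds⇔ : ∀ m → (a ℕ.≤ suc (m ℕ.+ m)) ⇔ (1 ℕ.≤ a × a ℕ.≤ m ℕ.+ m)
      bounds⇔ m = mk⇔ (λ le → s≤s z≤n , i′≤⇒≤ m (≤⇒i′≤ m le)) (λ (_ , le) → ℕ.m≤n⇒m≤1+n le)

      over-≡ : ∀ m → over-count m a ≡ ⟨ a ℕ.≤? suc (m ℕ.+ m) ⟩ Ch a i′ (b ℕ.∸ m)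
      over-≡ m = ≡.cong (λ z → ⟨ a ℕ.≤? suc (m ℕ.+ m) ⟩ Ch a z (b ℕ.∸ m)) ⌈a/2⌉≡

      dual-≡ : ∀ m → dual-count m a ≡ ⟨ 1 ℕ.≤? a ×-dec a ℕ.≤? m ℕ.+ m ⟩ Ch a (suc i′) (b ℕ.∸ m)
      dual-≡ m = ≡.cong (λ z → ⟨ 1 ℕ.≤? a ×-dec a ℕ.≤? m ℕ.+ m ⟩ Ch a (suc z) (b ℕ.∸ m)) ⌊a/2⌋≡

      odds≡0 : odd₁-term k ℕ.+ ((⟨ C ℕ.≤? k ⟩ odd₂-term k)) ≡ 0
      odds≡0 = ≡.cong₂ ℕ._+_ (⟨⟩-no (suc k ℕ.≤? C ×-dec 2 ℕ.∣? k) (λ (_ , 2∣) → 2∤1+double i 2∣))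
        (⟨⟩-0 (C ℕ.≤? k) (⟨⟩-no (2 ℕ.∣? k ×-dec suc b ℕ.≤? C) (λ (2∣ , _) → 2∤1+double i 2∣)))

      self-dual-≡ : self-dual k ≡ Σ< b (λ m → even₁-term (suc m) a) ℕ.+ (⟨ C ℕ.≤? k ⟩ even₂-term a)
      self-dual-≡ = ≡.trans (≡.sym (ℕ.+-assoc (odd₁-term k) _ _)) (≡.cong (ℕ._+ (Σ< b (λ m → even₁-term (suc m) a) ℕ.+ (⟨ C ℕ.≤? k ⟩ even₂-term a))) odds≡0)

      2∣a : 2 ℕ.∣ a
      2∣a = ≡.subst (2 ℕ.∣_) (≡.sym a≡) (2∣double i′)

      a∸i′ : a ℕ.∸ i′ ≡ i′
      a∸i′ = ≡.trans (≡.cong (ℕ._∸ i′) a≡) (ℕ.m+n∸n≡m i′ i′)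

      a∸1+i′ : a ℕ.∸ suc i′ ≡ i
      a∸1+i′ = ℕ.m+n∸n≡m i i

      Result : Set
      Result = Σ< (suc b) (λ m → over-count m a) ≡ Σ< (suc b) (λ m → dual-count m a) ℕ.+ self-dual k

      -- For a = 2 i′ both ranges start at m = i′, but duals need β in π^(i′+1) 𝔬 instead of π^i′ 𝔬.
      -- With h = b - m this compares q^min(i′, h) with q^min(i′ - 1, h), which can differ only if
      -- i′ ≤ h.
      low : a ℕ.≤ C → Result
      low a≤C = ≡.trans (Σ<-cong (suc b) (λ m _ → pointwise m))
        (≡.trans (Σ<-+ (suc b) (λ m → dual-count m a) (λ m → even₁-term m a))
        (≡.cong (Σ< (suc b) (λ m → dual-count m a) ℕ.+_) (≡.trans (≡.cong (ℕ._+ Σ< b (λ m → even₁-term (suc m) a)) first≡0)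
          (≡.trans (≡.sym (ℕ.+-identityʳ _)) (≡.trans (≡.cong (Σ< b (λ m → even₁-term (suc m) a) ℕ.+_) (≡.sym (⟨⟩-no (C ℕ.≤? k) (ℕ.<⇒≱ a≤C))))
          (≡.sym self-dual-≡))))))
        where
        E? : ∀ m → Dec (a ℕ.< suc (m ℕ.+ m) × 2 ℕ.∣ a × a ℕ.≤ C × ℕ.⌊ a /2⌋ ℕ.≤ b ℕ.∸ m)
        E? m = a ℕ.<? suc (m ℕ.+ m) ×-dec 2 ℕ.∣? a ×-dec a ℕ.≤? C ×-dec ℕ.⌊ a /2⌋ ℕ.≤? b ℕ.∸ m
        -- The formula starts this sum at b′ = 1; the row m = 0 contributes nothing, because a < 1
        -- fails.
        first≡0 : even₁-term 0 a ≡ 0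
        first≡0 = ≡.refl
        powers : ∀ h → (d : Dec (i′ ℕ.≤ h)) → q ℕ.^ (i′ ℕ.⊓ h) ≡ q ℕ.^ (i ℕ.⊓ h) ℕ.+ (⟨ d ⟩ (q ℕ.^ i′ ℕ.∸ q ℕ.^ i))
        powers h (yes le) = ≡.trans (≡.cong (q ℕ.^_) (ℕ.m≤n⇒m⊓n≡m le)) (≡.trans (≡.sym (ℕ.m+[n∸m]≡n (ℕ.^-monoʳ-≤ q (ℕ.n≤1+n i))))
          (≡.cong (λ z → q ℕ.^ z ℕ.+ (q ℕ.^ i′ ℕ.∸ q ℕ.^ i)) (≡.sym (ℕ.m≤n⇒m⊓n≡m (ℕ.<⇒≤ le)))))
        powers h (no ≰) = ≡.trans (≡.cong (q ℕ.^_) (≡.trans (ℕ.m≥n⇒m⊓n≡n (ℕ.<⇒≤ (ℕ.≰⇒> ≰))) (≡.sym (ℕ.m≥n⇒m⊓n≡n (ℕ.≤-pred (ℕ.≰⇒> ≰))))))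
          (≡.sym (ℕ.+-identityʳ _))
        pointwise : ∀ m → over-count m a ≡ dual-count m a ℕ.+ even₁-term m a
        pointwise m = decide (a ℕ.≤? suc (m ℕ.+ m))
          where
          decide : Dec (a ℕ.≤ suc (m ℕ.+ m)) → over-count m a ≡ dual-count m a ℕ.+ even₁-term m a
          decide (no ≰) = ≡.trans (⟨⟩-no (a ℕ.≤? suc (m ℕ.+ m)) ≰) (≡.sym (≡.cong₂ ℕ._+_
            (⟨⟩-no (1 ℕ.≤? a ×-dec a ℕ.≤? m ℕ.+ m) (≰ ∘ Equivalence.from (bounds⇔ m))) (⟨⟩-no (E? m) (λ { (s≤s lt , _) → ≰ (ℕ.m≤n⇒m≤1+n lt) }))))
          decide (yes le) = ≡.trans (over-≡ m) (≡.trans (⟨⟩-yes (a ℕ.≤? suc (m ℕ.+ m)) le) (≡.trans (Ch-low a i′ (b ℕ.∸ m) a≤C)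
            (≡.trans (≡.cong (λ z → q ℕ.^ (z ℕ.⊓ (b ℕ.∸ m))) a∸i′) (≡.trans (powers (b ℕ.∸ m) (i′ ℕ.≤? b ℕ.∸ m))
            (≡.sym (≡.cong₂ ℕ._+_
              (≡.trans (dual-≡ m) (≡.trans (⟨⟩-yes (1 ℕ.≤? a ×-dec a ℕ.≤? m ℕ.+ m) (Equivalence.to (bounds⇔ m) le))
                (≡.trans (Ch-low a (suc i′) (b ℕ.∸ m) a≤C) (≡.cong (λ z → q ℕ.^ (z ℕ.⊓ (b ℕ.∸ m))) a∸1+i′))))
              (⟨⟩-cong (E? m) (i′ ℕ.≤? b ℕ.∸ m)
                (mk⇔ (λ (_ , _ , _ , le) → ≡.subst (ℕ._≤ b ℕ.∸ m) ⌊a/2⌋≡ le)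
                     (λ le′ → s≤s (proj₂ (Equivalence.to (bounds⇔ m) le)) , 2∣a , a≤C , ≡.subst (ℕ._≤ b ℕ.∸ m) (≡.sym ⌊a/2⌋≡) le′))
                (λ _ → ≡.cong (λ z → q ℕ.^ z ℕ.∸ q ℕ.^ (z ℕ.∸ 1)) ⌊a/2⌋≡))))))))

      module High (a≰C : ¬ (a ℕ.≤ C)) where
        C≤k : C ℕ.≤ k
        C≤k = ℕ.≤-pred (ℕ.≰⇒> a≰C)

        self-dual-high : self-dual k ≡ even₂-term a
        self-dual-high = ≡.trans self-dual-≡ (≡.cong₂ ℕ._+_
          (Σ<-0 b (λ m _ → ⟨⟩-no (a ℕ.<? suc (suc m ℕ.+ suc m) ×-dec 2 ℕ.∣? a ×-dec a ℕ.≤? C ×-dec ℕ.⌊ a /2⌋ ℕ.≤? b ℕ.∸ suc m) (λ (_ , _ , le , _) → a≰C le)))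
          (⟨⟩-yes (C ℕ.≤? k) C≤k))

        same : ∀ m → (i′ ℕ.≤ m → i′ ℕ.+ (b ℕ.∸ m) ℕ.≤ C → suc i′ ℕ.+ (b ℕ.∸ m) ℕ.≤ C) → over-count m a ≡ dual-count m a
        same m strict = ≡.trans (over-≡ m) (≡.trans
          (⟨⟩-cong (a ℕ.≤? suc (m ℕ.+ m)) (1 ℕ.≤? a ×-dec a ℕ.≤? m ℕ.+ m) (bounds⇔ m) (λ le →
            ≡.trans (Ch-high a i′ (b ℕ.∸ m) a≰C) (≡.trans (⟨⟩-cong (i′ ℕ.+ (b ℕ.∸ m) ℕ.≤? C) (suc i′ ℕ.+ (b ℕ.∸ m) ℕ.≤? C)
              (mk⇔ (strict (≤⇒i′≤ m le)) ℕ.<⇒≤) (λ _ → ≡.refl)) (≡.sym (Ch-high a (suc i′) (b ℕ.∸ m) a≰C)))))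
          (≡.sym (dual-≡ m)))

        -- Above C a row contributes q^h or 0, according to i′ + h ≤ C for orders and i′ + 1 + h ≤ C
        -- for duals. They differ only where i′ + h = C, that is in the row b - (C - i′), and this
        -- row satisfies m ≥ i′ just when C ≤ b.
        high : Dec (C ℕ.≤ b) → Result
        high (no C≰b) = ≡.trans (Σ<-cong (suc b) (λ m m<1+b → same m (λ i′≤m _ →
            ℕ.≤-trans (s≤s (ℕ.≤-trans (ℕ.+-monoˡ-≤ (b ℕ.∸ m) i′≤m) (ℕ.≤-reflexive (ℕ.m+[n∸m]≡n (ℕ.≤-pred m<1+b))))) (ℕ.≰⇒> C≰b))))
          (≡.trans (≡.sym (ℕ.+-identityʳ _)) (≡.cong (Σ< (suc b) (λ m → dual-count m a) ℕ.+_)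
            (≡.sym (≡.trans self-dual-high (⟨⟩-no (2 ℕ.∣? a ×-dec C ℕ.≤? b) (λ (_ , le) → C≰b le))))))
        high (yes C≤b) = Σ<-update (suc b) m₀ (s≤s (ℕ.m∸n≤m b d₀)) at-m₀ (λ m m<1+b m≢m₀ → same m (elsewhere m (ℕ.≤-pred m<1+b) m≢m₀))
          where
          d₀ m₀ : ℕ
          d₀ = C ℕ.∸ i′
          m₀ = b ℕ.∸ d₀
          i′+d₀ : i′ ℕ.+ d₀ ≡ C
          i′+d₀ = ℕ.m+[n∸m]≡n i′≤C
          d₀≤b : d₀ ℕ.≤ b
          d₀≤b = ℕ.≤-trans (ℕ.m∸n≤m C i′) C≤b
          b∸m₀ : b ℕ.∸ m₀ ≡ d₀
          b∸m₀ = ℕ.m∸[m∸n]≡n d₀≤b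
          i′≤m₀ : i′ ℕ.≤ m₀
          i′≤m₀ = ℕ.m+n≤o⇒m≤o∸n i′ (ℕ.≤-trans (ℕ.≤-reflexive i′+d₀) C≤b)
          elsewhere : ∀ m → m ℕ.≤ b → m ≢ m₀ → i′ ℕ.≤ m → i′ ℕ.+ (b ℕ.∸ m) ℕ.≤ C → suc i′ ℕ.+ (b ℕ.∸ m) ℕ.≤ C
          elsewhere m m≤b m≢m₀ _ le = ℕ.≤∧≢⇒< le λ eq → m≢m₀ (≡.trans (≡.sym (ℕ.m∸[m∸n]≡n m≤b))
            (≡.cong (b ℕ.∸_) (ℕ.+-cancelˡ-≡ i′ (b ℕ.∸ m) d₀ (≡.trans eq (≡.sym i′+d₀)))))
          at-m₀ : over-count m₀ a ≡ dual-count m₀ a ℕ.+ self-dual k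
          at-m₀ = ≡.trans (over-≡ m₀) (≡.trans (⟨⟩-yes (a ℕ.≤? suc (m₀ ℕ.+ m₀)) (ℕ.m≤n⇒m≤1+n (i′≤⇒≤ m₀ i′≤m₀)))
            (≡.trans (≡.cong (Ch a i′) b∸m₀) (≡.trans (Ch-high a i′ d₀ a≰C) (≡.trans (⟨⟩-yes (i′ ℕ.+ d₀ ℕ.≤? C) (ℕ.≤-reflexive i′+d₀))
            (≡.sym (≡.cong₂ ℕ._+_
              (≡.trans (dual-≡ m₀) (⟨⟩-0 (1 ℕ.≤? a ×-dec a ℕ.≤? m₀ ℕ.+ m₀) (≡.trans (≡.cong (Ch a (suc i′)) b∸m₀)
                (≡.trans (Ch-high a (suc i′) d₀ a≰C) (⟨⟩-no (suc i′ ℕ.+ d₀ ℕ.≤? C) (λ le → ℕ.1+n≰n (ℕ.≤-trans le (ℕ.≤-reflexive (≡.sym i′+d₀)))))))))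
              (≡.trans self-dual-high (≡.trans (⟨⟩-yes (2 ℕ.∣? a ×-dec C ℕ.≤? b) (2∣a , C≤b)) (≡.cong (λ z → q ℕ.^ (C ℕ.∸ z)) ⌊a/2⌋≡)))))))))

      even-case : Result
      even-case = decide (a ℕ.≤? C)
        where
        decide : Dec (a ℕ.≤ C) → Result
        decide (yes a≤C) = low a≤C
        decide (no a≰C) = High.high a≰C (C ℕ.≤? b)

  column : ∀ k → k ℕ.< f → Σ< (suc b) (λ m → over-count m (suc k)) ≡ Σ< (suc b) (λ m → dual-count m (suc k)) ℕ.+ self-dual k
  column k k<f with parity k
  ... | i , inj₁ ≡.refl = odd-case i k<f
  ... | i , inj₂ ≡.refl = Even.even-case i k<f

  Σ<-const-1 : ∀ n → Σ< n (λ _ → 1) ≡ n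
  Σ<-const-1 zero = ≡.refl
  Σ<-const-1 (suc n) = ≡.cong suc (Σ<-const-1 n)

  overs duals : ℕ
  overs = Σ< (suc b) (λ m → Σ< (suc f) (over-count m))
  duals = Σ< (suc b) (λ m → Σ< (suc f) (dual-count m))

  -- The column a = 0 holds one order 𝔬 × R_m for each m ≤ b and no dual, which accounts for the
  -- term b + 1.
  overs≡ : overs ≡ duals ℕ.+ (suc b ℕ.+ Σ< f self-dual)
  overs≡ = begin
    Σ< (suc b) (λ m → 1 ℕ.+ Σ< f (λ k → over-count m (suc k)))
      ≡⟨ Σ<-+ (suc b) (λ _ → 1) (λ m → Σ< f (λ k → over-count m (suc k))) ⟩
    Σ< (suc b) (λ _ → 1) ℕ.+ Σ< (suc b) (λ m → Σ< f (λ k → over-count m (suc k)))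
      ≡⟨ ≡.cong₂ ℕ._+_ (Σ<-const-1 (suc b)) (Σ<-swap (suc b) f (λ m k → over-count m (suc k))) ⟩
    suc b ℕ.+ Σ< f (λ k → Σ< (suc b) (λ m → over-count m (suc k)))
      ≡⟨ ≡.cong (suc b ℕ.+_) (Σ<-cong f column) ⟩
    suc b ℕ.+ Σ< f (λ k → Σ< (suc b) (λ m → dual-count m (suc k)) ℕ.+ self-dual k)
      ≡⟨ ≡.cong (suc b ℕ.+_) (Σ<-+ f (λ k → Σ< (suc b) (λ m → dual-count m (suc k))) self-dual) ⟩
    suc b ℕ.+ (Σ< f (λ k → Σ< (suc b) (λ m → dual-count m (suc k))) ℕ.+ Σ< f self-dual)
      ≡⟨ ≡.cong (λ z → suc b ℕ.+ (z ℕ.+ Σ< f self-dual)) (Σ<-swap (suc b) f (λ m k → dual-count m (suc k))) ⟨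
    suc b ℕ.+ (duals ℕ.+ Σ< f self-dual)
      ≡⟨ ℕ.+-assoc (suc b) duals _ ⟨
    suc b ℕ.+ duals ℕ.+ Σ< f self-dual
      ≡⟨ ≡.cong (ℕ._+ Σ< f self-dual) (ℕ.+-comm (suc b) duals) ⟩
    duals ℕ.+ suc b ℕ.+ Σ< f self-dual
      ≡⟨ ℕ.+-assoc duals (suc b) _ ⟩
    duals ℕ.+ (suc b ℕ.+ Σ< f self-dual) ∎
    where open ≡.≡-Reasoning

  odd₁s odd₂s even₁s even₂s : ℕ
  odd₁s = Σ< f odd₁-term
  odd₂s = Σ< f (λ k → ⟨ C ℕ.≤? k ⟩ odd₂-term k)
  even₁s = Σ< b (λ i → Σ< f (λ k → even₁-term (suc i) (suc k)))
  even₂s = Σ< f (λ k → ⟨ C ℕ.≤? k ⟩ even₂-term (suc k))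

  self-dual≡ : Σ< f self-dual ≡ odd₁s ℕ.+ (odd₂s ℕ.+ (even₁s ℕ.+ even₂s))
  self-dual≡ = ≡.trans (Σ<-+ f odd₁-term _) (≡.cong (odd₁s ℕ.+_)
    (≡.trans (Σ<-+ f (λ k → ⟨ C ℕ.≤? k ⟩ odd₂-term k) _) (≡.cong (odd₂s ℕ.+_)
    (≡.trans (Σ<-+ f (λ k → Σ< b (λ i → even₁-term (suc i) (suc k))) _)
      (≡.cong (ℕ._+ even₂s) (≡.sym (Σ<-swap b f (λ i k → even₁-term (suc i) (suc k)))))))))

module CountFormula (q : ℕ) .{{_ : ℕ.NonZero q}} (s f f₂ : ℕ) {b C : ℕ}
    (b≡ : Formula.b q s f f₂ ≡ + b) (C≡ : Formula.C q s f f₂ ≡ + C)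
    (C≤f : C ℕ.≤ f) (C≤1+b : C ℕ.≤ suc b) (f≤1+2b : f ℕ.≤ suc (b ℕ.+ b)) (f≤2C : f ℕ.≤ C ℕ.+ C) where
  open Formula q s f f₂ using (main₁; main₂; odd₁; odd₂; even₁; even₂; count) renaming (b to bℤ)
  open Evaluation q s f f₂ b≡ C≡ C≤f C≤1+b f≤1+2b f≤2C
  open CountIdentity q b C f C≤f C≤1+b f≤1+2b f≤2C

  private
    mains-≡ : ∑ (+ 0 ⋯ bℤ) (λ m → main₁ m ℚ.+ main₂ m) ≡ fromℕ overs
    mains-≡ = ≡.trans (≡.cong (λ z → ∑ (+ 0 ⋯ z) (λ m → main₁ m ℚ.+ main₂ m)) b≡)
      (∑-⋯ {0} {b} z≤n {λ m → main₁ m ℚ.+ main₂ m} {λ m → Σ< (suc f) (over-count m)} λ m m<1+b →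
        ≡.trans (≡.cong₂ ℚ._+_ (main₁-≡ (ℕ.≤-pred m<1+b)) (main₂-≡ (ℕ.≤-pred m<1+b)))
          (≡.trans (≡.sym (fromℕ-+ (Σ< (suc f) (main₁-term m)) (Σ< f (λ k → ⟨ C ℕ.≤? k ⟩ main₂-term m (suc k)))))
            (≡.cong fromℕ (over-total m))))

    evens-≡ : ∑ (+ 1 ⋯ bℤ) even₁ ≡ fromℕ even₁s
    evens-≡ = ≡.trans (≡.cong (λ z → ∑ (+ 1 ⋯ z) even₁) b≡)
      (∑-⋯ {1} {b} (s≤s z≤n) {even₁} {λ i → Σ< f (λ k → even₁-term (suc i) (suc k))} λ i i<b → even₁-≡ i<b)

    b+1-≡ : (bℤ ℤ.+ + 1) / 1 ≡ fromℕ (suc b)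
    b+1-≡ = ≡.trans (≡.cong (λ z → (z ℤ.+ + 1) / 1) b≡) (≡.trans (≡.cong (λ z → + z / 1) (ℕ.+-comm b 1)) (≡.sym (fromℕ-≡ (suc b))))

    2*-≡ : ∀ n → (+ 2 / 1) ℚ.* fromℕ n ≡ fromℕ n ℚ.+ fromℕ n
    2*-≡ n = ≡.trans (≡.cong (ℚ._* fromℕ n) (≡.trans (≡.sym (fromℕ-≡ 2)) (≡.trans (fromℕ-+ 1 1) (≡.cong₂ ℚ._+_ (fromℕ-≡ 1) (fromℕ-≡ 1)))))
      (≡.trans (ℚ.*-distribʳ-+ (fromℕ n) ℚ.1ℚ ℚ.1ℚ) (≡.cong₂ ℚ._+_ (ℚ.*-identityˡ (fromℕ n)) (ℚ.*-identityˡ (fromℕ n))))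

  count-≡ : fromℕ (overs ℕ.+ duals) ≡ count
  count-≡ = begin
    fromℕ (overs ℕ.+ duals)
      ≡⟨ fromℕ-+ overs duals ⟩
    fromℕ overs ℚ.+ fromℕ duals
      ≡⟨ solve 7 (λ a d b o₁ o₂ e₁ e₂ → a :+ d := (a :+ (d :+ (b :+ (o₁ :+ (o₂ :+ (e₁ :+ e₂)))))) :- b :- o₁ :- o₂ :- e₁ :- e₂)
         ≡.refl (fromℕ overs) (fromℕ duals) (fromℕ (suc b)) (fromℕ odd₁s) (fromℕ odd₂s) (fromℕ even₁s) (fromℕ even₂s) ⟩
    (fromℕ overs ℚ.+ (fromℕ duals ℚ.+ (fromℕ (suc b) ℚ.+ (fromℕ odd₁s ℚ.+ (fromℕ odd₂s ℚ.+ (fromℕ even₁s ℚ.+ fromℕ even₂s))))))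
      ℚ.- fromℕ (suc b) ℚ.- fromℕ odd₁s ℚ.- fromℕ odd₂s ℚ.- fromℕ even₁s ℚ.- fromℕ even₂s
      ≡⟨ ≡.cong (λ z → (fromℕ overs ℚ.+ z) ℚ.- fromℕ (suc b) ℚ.- fromℕ odd₁s ℚ.- fromℕ odd₂s ℚ.- fromℕ even₁s ℚ.- fromℕ even₂s) overs-≡ ⟨
    (fromℕ overs ℚ.+ fromℕ overs) ℚ.- fromℕ (suc b) ℚ.- fromℕ odd₁s ℚ.- fromℕ odd₂s ℚ.- fromℕ even₁s ℚ.- fromℕ even₂s
      ≡⟨ ≡.cong₂ ℚ._-_ (≡.cong₂ ℚ._-_ (≡.cong₂ ℚ._-_ (≡.cong₂ ℚ._-_ (≡.cong₂ ℚ._-_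
           (≡.trans (≡.cong ((+ 2 / 1) ℚ.*_) mains-≡) (2*-≡ overs)) b+1-≡) odd₁-≡) odd₂-≡) evens-≡) even₂-≡ ⟨
    count ∎
    where
    open ≡.≡-Reasoning
    open IntegerCoefficients ℚ.+-*-commutativeRing using (solve; _:=_; _:+_; _:-_)
    overs-≡ : fromℕ overs ≡ fromℕ duals ℚ.+ (fromℕ (suc b) ℚ.+ (fromℕ odd₁s ℚ.+ (fromℕ odd₂s ℚ.+ (fromℕ even₁s ℚ.+ fromℕ even₂s))))
    overs-≡ = ≡.trans (≡.cong fromℕ (≡.trans overs≡ (≡.cong (λ z → duals ℕ.+ (suc b ℕ.+ z)) self-dual≡)))
      (≡.trans (fromℕ-+ duals _) (≡.cong (fromℕ duals ℚ.+_) (≡.trans (fromℕ-+ (suc b) _) (≡.cong (fromℕ (suc b) ℚ.+_)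
      (≡.trans (fromℕ-+ odd₁s _) (≡.cong (fromℕ odd₁s ℚ.+_) (≡.trans (fromℕ-+ odd₂s _) (≡.cong (fromℕ odd₂s ℚ.+_) (fromℕ-+ even₁s even₂s)))))))))

-- Representatives of the ideal classes

record Representatives {s ℓ p} (S : Setoid s ℓ) (P : Pred (Setoid.Carrier S) p) (n : ℕ) : Set (s ⊔ ℓ ⊔ p) where
  open Setoid S using (_≈_; Carrier)
  field
    rep        : Fin n → Carrier
    member     : ∀ i → P (rep i)
    injective  : ∀ i j → rep i ≈ rep j → i ≡ j
    surjective : ∀ {J} → P J → ∃ λ i → rep i ≈ J

module _ {s ℓ} {S : Setoid s ℓ} where
  open Setoid S using (_≈_; Carrier; sym; trans; reflexive)
  open Representatives

  representatives-resp : ∀ {p p′} {P : Pred Carrier p} {Q : Pred Carrier p′} {n} → P ⊆ Q → Q ⊆ P → Representatives S P n → Representatives S Q n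
  representatives-resp P⊆Q Q⊆P r = record
    { rep = rep r ; member = λ i → P⊆Q (member r i) ; injective = injective r ; surjective = λ q → surjective r (Q⊆P q) }

  no-representatives : ∀ {p} {P : Pred Carrier p} → (∀ {J} → ¬ P J) → Representatives S P 0
  no-representatives ¬P = record { rep = λ () ; member = λ () ; injective = λ () ; surjective = λ p → ⊥-elim (¬P p) }

  module _ {p p′} {P : Pred Carrier p} {Q : Pred Carrier p′} {m n}
      (disjoint : ∀ {J J′} → P J → Q J′ → ¬ (J ≈ J′)) (r : Representatives S P m) (r′ : Representatives S Q n) where

    private
      either : Fin m ⊎ Fin n → Carrier
      either = [ rep r , rep r′ ]′

      either-member : ∀ i → (P (either i)) ⊎ (Q (either i))
      either-member (inj₁ i) = inj₁ (member r i)
      either-member (inj₂ i) = inj₂ (member r′ i)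

      either-injective : ∀ i j → either i ≈ either j → i ≡ j
      either-injective (inj₁ i) (inj₁ j) eq = ≡.cong inj₁ (injective r i j eq)
      either-injective (inj₁ i) (inj₂ j) eq = ⊥-elim (disjoint (member r i) (member r′ j) eq)
      either-injective (inj₂ i) (inj₁ j) eq = ⊥-elim (disjoint (member r j) (member r′ i) (sym eq))
      either-injective (inj₂ i) (inj₂ j) eq = ≡.cong inj₂ (injective r′ i j eq)

    union : Representatives S (λ J → P J ⊎ Q J) (m ℕ.+ n)
    union = record
      { rep = either ∘ Fin.splitAt m
      ; member = either-member ∘ Fin.splitAt m
      ; injective = λ i j eq → ≡.trans (≡.sym (Fin.join-splitAt m n i))
          (≡.trans (≡.cong (Fin.join m n) (either-injective (Fin.splitAt m i) (Fin.splitAt m j) eq)) (Fin.join-splitAt m n j))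
      ; surjective = λ
          { (inj₁ p) → let (i , eq) = surjective r p in
              i Fin.↑ˡ n , trans (reflexive (≡.cong either (Fin.splitAt-↑ˡ m i n))) eq
          ; (inj₂ q) → let (i , eq) = surjective r′ q in
              m Fin.↑ʳ i , trans (reflexive (≡.cong either (Fin.splitAt-↑ʳ m n i))) eq
          }
      }

  unions : ∀ {p} n (P : ℕ → Pred Carrier p) {g : ℕ → ℕ} →
           (∀ i j {J J′} → P i J → P j J′ → J ≈ J′ → i ≡ j) →
           (∀ i → i ℕ.< n → Representatives S (P i) (g i)) →
           Representatives S (λ J → ∃ λ i → i ℕ.< n × P i J) (Σ< n g)
  unions zero P disjoint r = no-representatives λ { (_ , () , _) }
  unions (suc n) P disjoint r = representatives-resp
    [ (λ p → 0 , s≤s z≤n , p) , (λ (i , i<n , p) → suc i , s≤s i<n , p) ]′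
    (λ { (zero , _ , p) → inj₁ p ; (suc i , s≤s i<n , p) → inj₂ (i , i<n , p) })
    (union (λ p (i , _ , p′) eq → case disjoint 0 (suc i) p p′ eq of λ ())
      (r 0 (s≤s z≤n))
      (unions n (P ∘ suc) (λ i j p p′ eq → ℕ.suc-injective (disjoint (suc i) (suc j) p p′ eq)) (λ i i<n → r (suc i) (s≤s i<n))))

  classification : ∀ {p} {P : Pred Carrier p} {n} → Representatives S P n → (∀ J → P J) → Inverse S (≡.setoid (Fin n))
  classification r all = record
    { to = index
    ; from = rep r
    ; to-cong = λ {J} {J′} eq → injective r (index J) (index J′) (trans (index≈ J) (trans eq (sym (index≈ J′))))
    ; from-cong = λ eq → reflexive (≡.cong (rep r) eq)
    ; inverse = (λ {i} {J} eq → injective r (index J) i (trans (index≈ J) eq)) ,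
                (λ {J} {i} eq → trans (reflexive (≡.cong (rep r) eq)) (index≈ J))
    }
    where
    index : Carrier → Fin _
    index J = proj₁ (surjective r (all J))
    index≈ : ∀ J → rep r (index J) ≈ J
    index≈ J = proj₂ (surjective r (all J))

module IdealClasses (em : ∀ {a} → ExcludedMiddle a) {c ℓ} (setting : QuadraticSetting c ℓ) where
  open Coordinates setting
  open NormValuation setting
  open Ideals setting
  open DualForms em setting using (Compatible)
  open Reduction em setting using (Similar; similar-≐; similar-trans; similar-sym)
  open Injectivity em setting using (over-injective; dual-injective; over≁dual)
  open Counting F π π-uniformizer
  open F using (q)

  similar-resp : ∀ {S S′ J} → S ≐ S′ → Similar S J → Similar S′ J
  similar-resp (S⊆S′ , S′⊆S) (u , inv , J⊆ , ⊆J) = u , inv ,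
    (λ s → let (z , sz , eq) = J⊆ s in z , S⊆S′ sz , eq) , λ (z , sz , eq) → ⊆J (z , S′⊆S sz , eq)

  over-≐ : ∀ {m a β β′} → β - β′ ∈π^ a → Over m a β ≐ Over m a β′
  over-≐ {m} {a} {β} {β′} h =
    (λ (over u p w y≈ u∈ w∈ k) → over u p w y≈ u∈ w∈ (≤v-cong
      (solve 5 (λ u p w β β′ → (p :- u :+ w :* β) :- w :* (β :- β′) := p :- u :+ w :* β′) refl u p w β β′) (≤v-sub k (∈-*ˡ w∈ h)))) ,
    λ (over u p w y≈ u∈ w∈ k) → over u p w y≈ u∈ w∈ (≤v-cong
      (solve 5 (λ u p w β β′ → (p :- u :+ w :* β′) :+ w :* (β :- β′) := p :- u :+ w :* β) refl u p w β β′) (≤v-+ k (∈-*ˡ w∈ h)))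

  dual-≐ : ∀ {m a β β′} → β - β′ ∈π^ a → Dual m a β ≐ Dual m a β′
  dual-≐ {m} {a} {β} {β′} h =
    (λ (dual u p w y≈ u∈ k k′) → dual u p w y≈ u∈ (≤v-cong
      (solve 5 (λ u p T β β′ → (p :+ u :* (T :- β)) :+ u :* (β :- β′) := p :+ u :* (T :- β′)) refl u p T[ m ] β β′) (≤v-+ k (∈-*ˡ u∈ h))) k′) ,
    λ (dual u p w y≈ u∈ k k′) → dual u p w y≈ u∈ (≤v-cong
      (solve 5 (λ u p T β β′ → (p :+ u :* (T :- β′)) :- u :* (β :- β′) := p :+ u :* (T :- β)) refl u p T[ m ] β β′) (≤v-sub k (∈-*ˡ u∈ h))) k′

  half-∈ : ∀ {a j β} → a ℕ.≤ j ℕ.+ j → β ∈π^ j → β ∈π^ ℕ.⌈ a /2⌉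
  half-∈ {a} {j} a≤ = ∈-weaken (ℕ.≤-trans (ℕ.⌈n/2⌉-mono a≤) (ℕ.≤-reflexive (≡.sym (ℕ.n≡⌈n+n/2⌉ j))))

  ≤half+half : ∀ a → a ℕ.≤ ℕ.⌈ a /2⌉ ℕ.+ ℕ.⌈ a /2⌉
  ≤half+half a = ℕ.≤-trans (ℕ.≤-reflexive (≡.sym (ℕ.⌊n/2⌋+⌈n/2⌉≡n a))) (ℕ.+-monoˡ-≤ ℕ.⌈ a /2⌉ (ℕ.⌊n/2⌋≤⌈n/2⌉ a))

  module _ {R : Subset} (isOrder : IsOrder R) {b f γ C} (R⊆ : R ⊆ Over b f γ)
           (γ∈ : γ ∈π^ C) (sharp : C ≡ f ⊎ C ≡ suc b ⊎ ¬ (γ ∈π^ suc C)) where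
    open Terms q b C using (over-count; dual-count)
    open FractionalIdeal using (carrier)

    OverClass DualClass : ℕ → ℕ → Pred (FractionalIdeal R) (c ⊔ ℓ)
    OverClass m a J = ∃ λ β → 𝒪 β × norm m β ∈π^ a × π ^ (b ℕ.∸ m) * β - γ ∈π^ a × Similar (Over m a β) (carrier J)
    DualClass m a J = ∃ λ β → 𝒪 β × 1 ℕ.≤ a × norm m β ∈π^ suc a × π ^ (b ℕ.∸ m) * β - γ ∈π^ a × Similar (Dual m a β) (carrier J)

    private
      chain : ∀ {S S′ J J′} → S′ Respects E._≈_ → Similar S (carrier J) → Similar S′ (carrier J′) → Setoid._≈_ (Cl R) J J′ → Similar S S′
      chain {S} {S′} {J} {J′} S′-resp s s′ J~J′ =
        similar-trans {S} {carrier J} {S′} s (similar-trans {carrier J} {carrier J′} {S′} J~J′ (similar-sym {S′} {carrier J′} S′-resp s′))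

    over-classes : ∀ m a → m ℕ.≤ b → a ℕ.≤ f → Representatives (Cl R) (OverClass m a) (over-count m a)
    over-classes m a m≤b a≤f = decide (a ℕ.≤? suc (m ℕ.+ m))
      where
      module Cell (a≤ : a ℕ.≤ suc (m ℕ.+ m)) where
        -- From a ≤ 2 m + 1 follows ⌈a/2⌉ + (b - m) ≤ b + 1, so a valuation of γ beyond b + 1 makes
        -- no difference; hence the truncation of C.
        open Enumeration (solutions {γ} {C} {b} {f} γ∈ sharp {a} {ℕ.⌈ a /2⌉} {b ℕ.∸ m} a≤f (ℕ.⌈n/2⌉≤n a)
          (ℕ.≤-trans (ℕ.+-monoˡ-≤ (b ℕ.∸ m) (ℕ.≤-trans (ℕ.⌈n/2⌉-mono a≤) (ℕ.≤-reflexive (≡.cong suc (⌊double/2⌋ m)))))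
            (ℕ.≤-reflexive (≡.cong suc (ℕ.m+[n∸m]≡n m≤b)))))
        β∈ : ∀ i → 𝒪 (element i)
        β∈ i = ∈⇒𝒪 (proj₁ (member i))
        N∈ : ∀ i → norm m (element i) ∈π^ a
        N∈ i = norm∈ {m} {a} {element i} ℕ.⌈ a /2⌉ a≤ (≤half+half a) (proj₁ (member i))
        ideal : Fin _ → FractionalIdeal R
        ideal i = overIdeal isOrder {b} {f} {γ} R⊆ {m} {a} {element i} (β∈ i) m≤b a≤f (proj₂ (member i)) (N∈ i)
        representatives : Representatives (Cl R) (OverClass m a) _
        representatives = record
          { rep = ideal
          ; member = λ i → element i , β∈ i , N∈ i , proj₂ (member i) , similar-≐ {Over m a (element i)} {Over m a (element i)} Over-resp ((λ s → s) , (λ s → s))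
          ; injective = λ i j eq → injective i j (proj₂ (proj₂ (over-injective (β∈ i) (N∈ i) (β∈ j) (N∈ j) eq)))
          ; surjective = λ {J} (β , β∈ , N∈ , h , similar) →
              let (_ , j , a≤2j , β∈j) = norm∈⁻¹ {m} {a} β∈ N∈
                  (i , β≈) = surjective {β} (half-∈ {a} {j} a≤2j β∈j , h)
              in i , similar-resp {Over m a β} {Over m a (element i)} {carrier J} (over-≐ {m} {a} {β} {element i} β≈) similar
          }
      decide : (d : Dec (a ℕ.≤ suc (m ℕ.+ m))) → Representatives (Cl R) (OverClass m a) (⟨ d ⟩ solutions-count C a ℕ.⌈ a /2⌉ (b ℕ.∸ m))
      decide (yes a≤) = Cell.representatives a≤
      decide (no a≰) = no-representatives λ (β , β∈ , N∈ , _) → a≰ (proj₁ (norm∈⁻¹ {m} {a} β∈ N∈))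

    dual-classes : ∀ m a → m ℕ.≤ b → a ℕ.≤ f → Representatives (Cl R) (DualClass m a) (dual-count m a)
    dual-classes m a m≤b a≤f = decide (1 ℕ.≤? a ×-dec a ℕ.≤? m ℕ.+ m)
      where
      -- This is ⌈(a + 1)/2⌉: the norm is required to vanish modulo π^(a+1), while β is counted
      -- modulo π^a.
      j₀ = suc ℕ.⌊ a /2⌋
      module Cell (a≥1 : 1 ℕ.≤ a) (a≤ : a ℕ.≤ m ℕ.+ m) where
        j₀≤a : ∀ a → 1 ℕ.≤ a → suc ℕ.⌊ a /2⌋ ℕ.≤ a
        j₀≤a (suc a) _ = ℕ.⌊n/2⌋<n a
        open Enumeration (solutions {γ} {C} {b} {f} γ∈ sharp {a} {j₀} {b ℕ.∸ m} a≤f (j₀≤a a a≥1)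
          (ℕ.≤-trans (ℕ.+-monoˡ-≤ (b ℕ.∸ m) (s≤s (ℕ.≤-trans (ℕ.⌊n/2⌋-mono a≤) (ℕ.≤-reflexive (⌊double/2⌋ m)))))
            (ℕ.≤-reflexive (≡.cong suc (ℕ.m+[n∸m]≡n m≤b)))))
        β∈ : ∀ i → 𝒪 (element i)
        β∈ i = ∈⇒𝒪 (proj₁ (member i))
        N∈ : ∀ i → norm m (element i) ∈π^ suc a
        N∈ i = norm∈ {m} {suc a} {element i} j₀ (s≤s a≤) (≤half+half (suc a)) (proj₁ (member i))
        N∈a : ∀ i → norm m (element i) ∈π^ a
        N∈a i = ∈-weaken (ℕ.n≤1+n a) (N∈ i)
        ideal : Fin _ → FractionalIdeal R
        ideal i = dualIdeal isOrder {b} {f} {γ} R⊆ {m} {a} {element i} (β∈ i) m≤b a≤f (proj₂ (member i)) (N∈a i)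
        representatives : Representatives (Cl R) (DualClass m a) _
        representatives = record
          { rep = ideal
          ; member = λ i → element i , β∈ i , a≥1 , N∈ i , proj₂ (member i) , similar-≐ {Dual m a (element i)} {Dual m a (element i)} Dual-resp ((λ s → s) , (λ s → s))
          ; injective = λ i j eq → injective i j (proj₂ (proj₂ (dual-injective (β∈ i) (N∈a i) (β∈ j) (N∈a j) eq)))
          ; surjective = λ {J} (β , β∈ , _ , N∈ , h , similar) →
              let (_ , j , a≤2j , β∈j) = norm∈⁻¹ {m} {suc a} β∈ N∈
                  (i , β≈) = surjective {β} (half-∈ {suc a} {j} a≤2j β∈j , h)
              in i , similar-resp {Dual m a β} {Dual m a (element i)} {carrier J} (dual-≐ {m} {a} {β} {element i} β≈) similar
          }
      decide : (d : Dec (1 ℕ.≤ a × a ℕ.≤ m ℕ.+ m)) → Representatives (Cl R) (DualClass m a) (⟨ d ⟩ solutions-count C a j₀ (b ℕ.∸ m))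
      decide (yes (a≥1 , a≤)) = Cell.representatives a≥1 a≤
      decide (no ≰) = no-representatives λ (β , β∈ , a≥1 , N∈ , _) → ≰ (a≥1 , ℕ.≤-pred (proj₁ (norm∈⁻¹ {m} {suc a} β∈ N∈)))

    over-all : Representatives (Cl R) (λ J → ∃ λ m → m ℕ.< suc b × ∃ λ a → a ℕ.< suc f × OverClass m a J)
                 (Σ< (suc b) (λ m → Σ< (suc f) (over-count m)))
    over-all = unions (suc b) _
      (λ { m m′ {J} {J′} (a , _ , p) (a′ , _ , p′) eq → proj₁ (same {m} {m′} {a} {a′} {J} {J′} p p′ eq) })
      (λ m m<1+b → unions (suc f) (OverClass m) (λ a a′ {J} {J′} p p′ eq → proj₂ (same {m} {m} {a} {a′} {J} {J′} p p′ eq))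
        (λ a a<1+f → over-classes m a (ℕ.≤-pred m<1+b) (ℕ.≤-pred a<1+f)))
      where
      same : ∀ {m m′ a a′ J J′} → OverClass m a J → OverClass m′ a′ J′ → Setoid._≈_ (Cl R) J J′ → m ≡ m′ × a ≡ a′
      same {m} {m′} {a} {a′} {J} {J′} (β , β∈ , N∈ , _ , s) (β′ , β′∈ , N′∈ , _ , s′) eq =
        let (m≡ , a≡ , _) = over-injective β∈ N∈ β′∈ N′∈ (chain {Over m a β} {Over m′ a′ β′} {J} {J′} Over-resp s s′ eq) in m≡ , a≡

    dual-all : Representatives (Cl R) (λ J → ∃ λ m → m ℕ.< suc b × ∃ λ a → a ℕ.< suc f × DualClass m a J)
                 (Σ< (suc b) (λ m → Σ< (suc f) (dual-count m)))
    dual-all = unions (suc b) _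
      (λ { m m′ {J} {J′} (a , _ , p) (a′ , _ , p′) eq → proj₁ (same {m} {m′} {a} {a′} {J} {J′} p p′ eq) })
      (λ m m<1+b → unions (suc f) (DualClass m) (λ a a′ {J} {J′} p p′ eq → proj₂ (same {m} {m} {a} {a′} {J} {J′} p p′ eq))
        (λ a a<1+f → dual-classes m a (ℕ.≤-pred m<1+b) (ℕ.≤-pred a<1+f)))
      where
      same : ∀ {m m′ a a′ J J′} → DualClass m a J → DualClass m′ a′ J′ → Setoid._≈_ (Cl R) J J′ → m ≡ m′ × a ≡ a′
      same {m} {m′} {a} {a′} {J} {J′} (β , β∈ , _ , N∈ , _ , s) (β′ , β′∈ , _ , N′∈ , _ , s′) eq =
        let (m≡ , a≡ , _) = dual-injective β∈ (∈-weaken (ℕ.n≤1+n a) N∈) β′∈ (∈-weaken (ℕ.n≤1+n a′) N′∈)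
              (chain {Dual m a β} {Dual m′ a′ β′} {J} {J′} Dual-resp s s′ eq)
        in m≡ , a≡

    class-representatives : Representatives (Cl R) _ (Σ< (suc b) (λ m → Σ< (suc f) (over-count m)) ℕ.+ Σ< (suc b) (λ m → Σ< (suc f) (dual-count m)))
    class-representatives = union
      (λ { {J} {J′} (m , _ , a , _ , (β , β∈ , N∈ , _ , s)) (m′ , _ , a′ , _ , (β′ , β′∈ , a′≥1 , N′∈ , _ , s′)) eq →
        over≁dual β∈ N∈ β′∈ a′≥1 N′∈ (chain {Over m a β} {Dual m′ a′ β′} {J} {J′} Dual-resp s s′ eq) })
      over-all dual-all

-- As s = C + t, the numerator is 2 C for f₂ = 2 t and 2 C - 1 for f₂ = 2 t + 1; half of it rounds
-- up to C in both cases. The bound 1 ≤ C lets 2 C - 1 be computed as a natural number.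
conductor-half : ∀ {s C t b f f₂} → s ≡ f ℕ.+ b → C ℕ.+ t ≡ f ℕ.+ b → f₂ ≡ t ℕ.+ t ⊎ (f₂ ≡ suc (t ℕ.+ t) × 1 ℕ.≤ C) →
                 ⌈ + 2 ℤ.* + s ℤ.- + f₂ /2⌉ ≡ + C
conductor-half {_} {C} {t} {b} {f} ≡.refl sum (inj₁ ≡.refl) = ≡.trans
  (≡.cong ⌈_/2⌉ (≡.trans (≡.cong (ℤ._- + (t ℕ.+ t)) (≡.trans (2*+ (f ℕ.+ b)) (≡.cong (λ z → + (z ℕ.+ z)) (≡.sym sum))))
    (≡.trans (+-∸ (ℕ.+-mono-≤ (ℕ.m≤n+m t C) (ℕ.m≤n+m t C))) (≡.cong +_ (≡.trans (≡.cong (ℕ._∸ (t ℕ.+ t)) (interchange C t C t)) (ℕ.m+n∸n≡m (C ℕ.+ C) (t ℕ.+ t)))))))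
  (≡.trans (⌈+/2⌉ (C ℕ.+ C)) (≡.cong +_ (≡.sym (ℕ.n≡⌈n+n/2⌉ C))))
  where open Algebra.Properties.CommutativeSemigroup ℕ.+-commutativeSemigroup using (interchange)
conductor-half {_} {suc C} {t} {b} {f} ≡.refl sum (inj₂ (≡.refl , _)) = ≡.trans
  (≡.cong ⌈_/2⌉ (≡.trans (≡.cong (ℤ._- + suc (t ℕ.+ t)) (≡.trans (2*+ (f ℕ.+ b)) (≡.cong (λ z → + (z ℕ.+ z)) (≡.sym sum))))
    (≡.trans (≡.cong (λ z → + z ℤ.- + suc (t ℕ.+ t)) double) (≡.trans (+-∸ (ℕ.m≤n+m (suc (t ℕ.+ t)) (suc (C ℕ.+ C)))) (≡.cong +_ (ℕ.m+n∸n≡m (suc (C ℕ.+ C)) (suc (t ℕ.+ t))))))))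
  (≡.trans (⌈+/2⌉ (suc (C ℕ.+ C))) (≡.cong (λ z → + suc z) (⌊double/2⌋ C)))
  where
  open Algebra.Properties.CommutativeSemigroup ℕ.+-commutativeSemigroup using (interchange)
  double : suc C ℕ.+ t ℕ.+ (suc C ℕ.+ t) ≡ suc (C ℕ.+ C) ℕ.+ suc (t ℕ.+ t)
  double = ≡.cong suc (≡.trans (ℕ.+-suc (C ℕ.+ t) (C ℕ.+ t)) (≡.trans (≡.cong suc (interchange C t C t)) (≡.sym (ℕ.+-suc (C ℕ.+ C) (t ℕ.+ t)))))

-- The class number

module ClassNumber (em : ∀ {a} → ExcludedMiddle a) {c ℓ} (setting : QuadraticSetting c ℓ) where
  open Coordinates setting
  open NormValuation setting
  open F using (q; q-nonZero)

  module _ {R : Subset} (isOrder : IsOrder R) (R⊆𝒪E : R ⊆ 𝒪E) {f₁ f₂ : ℕ} (conductor : IsConductorExponents R π x f₁ f₂)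
      {s b : ℕ} {γ : Carrier} (s≡ : s ≡ f₁ ℕ.+ b) (γ∈ : 𝒪 γ) (N∈ : norm b γ ∈π^ f₁) (R≐ : R ≐ Over b f₁ γ)
      {t C : ℕ} (f₂≡ : f₂ ≡ t ℕ.+ t ⊎ f₂ ≡ suc (t ℕ.+ t) × 1 ℕ.≤ C) (C+t≡ : C ℕ.+ t ≡ f₁ ℕ.+ b)
      (C≤f : C ℕ.≤ f₁) (C≤1+b : C ℕ.≤ suc b) (γ∈C : γ ∈π^ C) (sharp : C ≡ f₁ ⊎ C ≡ suc b ⊎ ¬ (γ ∈π^ suc C)) where

    open IdealClasses em setting using (class-representatives; OverClass; DualClass)
    open Surjectivity em setting using (classify)

    f≤1+2b : f₁ ℕ.≤ suc (b ℕ.+ b)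
    f≤1+2b = proj₁ (norm∈⁻¹ {b} {f₁} γ∈ N∈)

    -- Since π^f₁ divides the norm of π^b x - γ, γ lies in π^j 𝔬 for some j with 2 j ≥ f₁. The
    -- truncations of C at f₁ and at b + 1 respect the bound too, the latter by f₁ ≤ 2 b + 1.
    f≤2C : f₁ ℕ.≤ C ℕ.+ C
    f≤2C = [ (λ C≡f → ℕ.≤-trans (ℕ.m≤m+n f₁ f₁) (ℕ.≤-reflexive (≡.cong (λ z → z ℕ.+ z) (≡.sym C≡f)))) ,
      [ (λ C≡1+b → ℕ.≤-trans f≤1+2b (ℕ.≤-trans (s≤s (ℕ.+-monoʳ-≤ b (ℕ.n≤1+n b))) (ℕ.≤-reflexive (≡.cong (λ z → z ℕ.+ z) (≡.sym C≡1+b))))) ,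
        (λ γ∉ → let (_ , j , f≤2j , γ∈j) = norm∈⁻¹ {b} {f₁} γ∈ N∈
                    j≤C = ℕ.≮⇒≥ (λ C<j → γ∉ (∈-weaken C<j γ∈j))
                in ℕ.≤-trans f≤2j (ℕ.+-mono-≤ j≤C j≤C)) ]′ ]′ sharp

    open CountFormula q {{q-nonZero}} s f₁ f₂ {b} {C}
      (≡.trans (≡.cong (λ z → + z ℤ.- + f₁) s≡) (≡.trans (+-∸ (ℕ.m≤m+n f₁ b)) (≡.cong +_ (ℕ.m+n∸m≡n f₁ b))))
      (conductor-half {s} {C} {t} {b} {f₁} {f₂} s≡ C+t≡ f₂≡) C≤f C≤1+b f≤1+2b f≤2C using (count-≡)
    open CountIdentity q b C f₁ {{q-nonZero}} C≤f C≤1+b f≤1+2b f≤2C using (overs; duals)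

    classified : ∀ J → (∃ λ m → m ℕ.< suc b × ∃ λ a → a ℕ.< suc f₁ × OverClass isOrder (proj₁ R≐) γ∈C sharp m a J) ⊎
                       (∃ λ m → m ℕ.< suc b × ∃ λ a → a ℕ.< suc f₁ × DualClass isOrder (proj₁ R≐) γ∈C sharp m a J)
    classified J =
      [ (λ (m , a , β , β∈ , N∈ , (m≤b , a≤f , h) , similar) → inj₁ (m , s≤s m≤b , a , s≤s a≤f , β , β∈ , N∈ , h , similar)) ,
        (λ (m , a , β , β∈ , a≥1 , N∈ , (m≤b , a≤f , h) , similar) → inj₂ (m , s≤s m≤b , a , s≤s a≤f , β , β∈ , a≥1 , N∈ , h , similar)) ]′
      (classify isOrder R⊆𝒪E {b} {f₁} {f₂} {γ} conductor R≐ J)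

    class-number : ∃ λ n → Inverse (Cl R) (≡.setoid (Fin n)) × + n / 1 ≡ Formula.count q {{q-nonZero}} s f₁ f₂
    class-number = overs ℕ.+ duals ,
      classification (class-representatives isOrder (proj₁ R≐) γ∈C sharp) classified ,
      ≡.trans (≡.sym (fromℕ-≡ (overs ℕ.+ duals))) count-≡

open ≡ using (setoid)

theorem5p5 : (∀ {a} → ExcludedMiddle a) →
    ∀ {c ℓ : Level} (F E′ : LocalField c ℓ) (ext : Extension F E′) →
    Extension.HasDegree ext 2 →
    Extension.IsRamified ext →
    (π : LocalField.Carrier F) → LocalField.IsUniformizer F π →
    (x : LocalField.Carrier E′) → LocalField.IsUniformizer E′ x →
    let open Product ext in
    (R : Subset) → IsOrder R →
    (f₁ f₂ : ℕ) → IsConductorExponents R π x f₁ f₂ →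
    (s : ℕ) → QuotientLength R s →
    ∃[ n ] Inverse (Cl R) (setoid (Fin n)) ×
    + n / 1 ≡ Formula.count (LocalField.q F) {{LocalField.q-nonZero F}} s f₁ f₂
theorem5p5 em F E′ ext degree-2 ramified π π-uniformizer x x-uniformizer R isOrder f₁ f₂ conductor s length =
  let (b , γ , γ∈ , N∈ , R≐) = NormalForms.ConductorOrder.order-form em setting isOrder R⊆𝒪E {f₁} {f₂} conductor
      (t , C , f₂≡ , C+t≡ , C≤f , C≤1+b , γ∈C , sharp) = ConductorExponent.threshold em setting isOrder R⊆𝒪E {b} {f₁} {f₂} {γ} conductor R≐ γ∈
      s≡ = Length.quotientLength em setting {R} {b} {f₁} {γ} γ∈ R≐ length
  in ClassNumber.class-number em setting isOrder R⊆𝒪E {f₁} {f₂} conductor {s} {b} {γ} s≡ γ∈ N∈ R≐ {t} {C} f₂≡ C+t≡ C≤f C≤1+b γ∈C sharp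
  where
  setting : QuadraticSetting _ _
  setting = record { F = F ; E′ = E′ ; ext = ext ; degree-2 = degree-2 ; ramified = ramified
                   ; π = π ; π-uniformizer = π-uniformizer ; x = x ; x-uniformizer = x-uniformizer }
  -- The chain that realises the length has terms between R and 𝒪E, so it also shows that R is
  -- integral.
  R⊆𝒪E : R ⊆ Product.𝒪E ext
  R⊆𝒪E r = Product.Chain.upper (proj₁ length) Fin.zero (Product.Chain.lower (proj₁ length) Fin.zero r)
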